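{- The class of multi-path matroids is closed under duality and under taking minors, and it properly contains the class of lattice path matroids.
   Context: A set system on a finite set $S$ is a multiset $\mathcal{A}=(A_j:j\in J)$ of subsets of $S$. A partial transversal of $\mathcal{A}$ is a set $\{x_k:k\in K\}$ of $|K|$ distinct elements, for some $K\subseteq J$, with $x_k\in A_k$ for all $k\in K$. The partial transversals are the independent sets of a matroid $M[\mathcal{A}]$ on $S$; such matroids are transversal matroids and $\mathcal{A}$ is a presentation of $M[\mathcal{A}]$. Let $\sigma$ be a cyclic permutation of $S$. A $\sigma$-interval is a nonempty subset $I\subseteq S$ of the form $\{f_I,\sigma(f_I),\sigma^2(f_I),\ldots,l_I\}$, written $[f_I,l_I]$; $f_I$ and $l_I$ are its first and last elements. A set system is an antichain if no member contains another member. A multi-path matroid is a transversal matroid having a presentation by an antichain of $\sigma$-intervals for some cyclic permutation $\sigma$ of its ground set. Lattice path matroids: for lattice paths $P,Q$ from $(0,0)$ to $(m,r)$ using steps $E=(1,0)$ and $N=(0,1)$, with $P$ never above $Q$, let $\mathcal{P}$ be the set of such lattice paths from $(0,0)$ to $(m,r)$ going neither above $Q$ nor below $P$; for $1\le i\le r$ let $N_i$ be the set of $j$ such that the $j$-th step of some path in $\mathcal{P}$ is its $i$-th North step. $M[P,Q]$ is the transversal matroid on $[m+r]$ with presentation $(N_1,\ldots,N_r)$, and a lattice path matroid is any matroid isomorphic to some $M[P,Q]$. -}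

module Defs where

open import Data.Nat using (ℕ; zero; suc; _+_; _≤_)
open import Data.Bool using (Bool; true; false; if_then_else_)
open import Data.Fin using (Fin; toℕ)
open import Data.Fin.Subset using (Subset; _∈_; _∉_; _⊆_)
open import Data.Fin.Permutation using (Permutation′; Permutation; _⟨$⟩ʳ_)
open import Data.Vec using (Vec; []; _∷_; lookup)
open import Data.Product using (Σ; ∃; ∃-syntax; _×_; _,_)
open import Data.Sum using (_⊎_)
open import Function.Bundles using (_⇔_)
open import Relation.Nullary using (¬_)
open import Relation.Binary.PropositionalEquality using (_≡_; _≢_)
open import Relation.Unary as U using (Pred)
open import Level using (0ℓ)

-- Matroids on the ground set Fin n are given by their independence
-- predicate on subsets of Fin n.

IndepPred : ℕ → Set₁
IndepPred n = Subset n → Set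

SetSystem : ℕ → ℕ → Set₁
SetSystem n k = Fin k → Pred (Fin n) 0ℓ

PartialTransversal : ∀ {n k} → SetSystem n k → IndepPred n
PartialTransversal {n} {k} A X =
  Σ ((x : Fin n) → x ∈ X → Fin k) λ f →
    (∀ x y (p : x ∈ X) (q : y ∈ X) → f x p ≡ f y q → x ≡ y) ×
    (∀ x (p : x ∈ X) → A (f x p) x)

M[_] : ∀ {n k} → SetSystem n k → IndepPred n
M[ A ] = PartialTransversal A

iter : ∀ {n} → Permutation′ n → ℕ → Fin n → Fin n
iter σ zero    x = x
iter σ (suc i) x = σ ⟨$⟩ʳ (iter σ i x)

IsCyclic : ∀ {n} → Permutation′ n → Set
IsCyclic {n} σ = ∀ (x y : Fin n) → ∃[ i ] iter σ i x ≡ y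

IsInterval : ∀ {n} → Permutation′ n → Pred (Fin n) 0ℓ → Set
IsInterval {n} σ I =
  ∃[ f ] ∃[ k ] (∀ (x : Fin n) → I x ⇔ (∃[ i ] (i ≤ k × iter σ i f ≡ x)))

IsAntichain : ∀ {n k} → SetSystem n k → Set
IsAntichain {n} {k} A = ∀ (i j : Fin k) → i ≢ j → ¬ (A i U.⊆ A j)

IsMultiPath : ∀ {n} → IndepPred n → Set₁
IsMultiPath {n} Ind =
  Σ (Permutation′ n) λ σ → IsCyclic σ ×
  Σ ℕ λ k → Σ (SetSystem n k) λ A →
    (∀ j → IsInterval σ (A j)) × IsAntichain A ×
    (∀ X → Ind X ⇔ M[ A ] X)

IsBasis : ∀ {n} → IndepPred n → Subset n → Set
IsBasis {n} Ind B = Ind B × (∀ (Y : Subset n) → Ind Y → B ⊆ Y → Y ⊆ B)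

dual : ∀ {n} → IndepPred n → IndepPred n
dual {n} Ind X = ∃[ B ] (IsBasis Ind B × (∀ (x : Fin n) → x ∈ X → x ∉ B))

-- Minors.  The minor M / C \ D on the ground set E - (C ∪ D), where the
-- remaining elements are given by an injection e : Fin m → Fin n whose
-- image is disjoint from C (D is the complement of C ∪ image e).
-- I is independent in M/C\D iff I ∪ B_C is independent in M, where
-- B_C is a maximal independent subset of C.

minor : ∀ {n m} → IndepPred n → (Fin m → Fin n) → Subset n → IndepPred m
minor {n} {m} Ind e C X =
  ∃[ B ] (B ⊆ C × Ind B ×
          (∀ (Y : Subset n) → Y ⊆ C → Ind Y → B ⊆ Y → Y ⊆ B) ×
          ∃[ Z ] ((∀ (z : Fin n) → (z ∈ Z) ⇔ (z ∈ B ⊎ ∃[ y ] (y ∈ X × e y ≡ z)))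
                  × Ind Z))

Isomorphic : ∀ {n n'} → IndepPred n → IndepPred n' → Set
Isomorphic {n} {n'} Ind Ind' =
  Σ (Permutation n n') λ φ →
    ∀ (X : Subset n) (Y : Subset n') →
      (∀ (x : Fin n) → x ∈ X ⇔ (φ ⟨$⟩ʳ x) ∈ Y) → (Ind X ⇔ Ind' Y)

-- Lattice paths: a path with L steps is a Vec Bool L (true = N, false = E).

northsUpTo : ∀ {L} → Vec Bool L → ℕ → ℕ
northsUpTo v        zero    = 0
northsUpTo []       (suc t) = 0
northsUpTo (b ∷ v)  (suc t) = (if b then 1 else 0) + northsUpTo v t

IsLatticePath : (m r : ℕ) → Vec Bool (m + r) → Set
IsLatticePath m r v = northsUpTo v (m + r) ≡ r

NotAbove : ∀ {L} → Vec Bool L → Vec Bool L → Set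
NotAbove P Q = ∀ t → northsUpTo P t ≤ northsUpTo Q t

-- N_i (i = toℕ i' + 1): positions j (0-indexed) such that the j-th step of
-- some path in 𝒫 is its i-th North step.
Nset : (m r : ℕ) → Vec Bool (m + r) → Vec Bool (m + r) → SetSystem (m + r) r
Nset m r P Q i j =
  ∃[ R ] (IsLatticePath m r R × NotAbove P R × NotAbove R Q ×
          lookup R j ≡ true × northsUpTo R (suc (toℕ j)) ≡ suc (toℕ i))

M[_,_] : ∀ {m r} → Vec Bool (m + r) → Vec Bool (m + r) → IndepPred (m + r)
M[_,_] {m} {r} P Q = M[ Nset m r P Q ]

IsLatticePathMatroid : ∀ {n} → IndepPred n → Set
IsLatticePathMatroid {n} Ind =
  Σ ℕ λ m → Σ ℕ λ r → Σ (Vec Bool (m + r)) λ P → Σ (Vec Bool (m + r)) λ Q →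
    IsLatticePath m r P × IsLatticePath m r Q × NotAbove P Q ×
    Isomorphic Ind (M[_,_] {m} {r} P Q)

{-# OPTIONS --safe #-}
-- A subset of positions on a cycle of length n is recorded by the lattice
-- path that steps up at its elements, and the path is extended
-- periodically: h n = h 0 + r.  Listing the first and the last elements of
-- an antichain of r intervals in cyclic order gives two such paths q and p,
-- and a set is a partial transversal exactly when some path h with
-- p ≤ h ≤ q steps up at all its elements; only the value h 0 is free, and
-- p 0 = q 0 characterises lattice path matroids.  One direction counts the
-- representatives of the intervals and flattens the steps of height two or
-- more to a 1-Lipschitz path; the other matches an element at height v with
-- the interval whose first element has height v (modulo r) on q.
--
-- On bands [p , q] of paths, duality is h t ↦ t + q 0 − h t, and deleting or
-- contracting an element forces the step of h there.  Conversely the paths p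
-- and q of a band give an antichain once q is lowered to p (t + n − 2), which
-- loses no set because a path exceeding that bound can be shifted down.
--
-- The 3-whirl separates the classes: in a lattice path matroid a dependent
-- set L of rank size all of whose exchanges L − z + w are independent must be
-- an initial or a final segment, whereas the whirl has three such sets, so
-- that two of them would coincide.
module Submission where

open import Defs
open import Data.Bool using (Bool; true; false; if_then_else_; _∧_; _∨_; T)
open import Data.Bool.Properties using (T-∨; T-∧)
import Data.Empty as Empty
open import Data.Fin using (Fin; zero; suc; toℕ; fromℕ<; punchIn; punchOut)
open import Data.Fin.Patterns using (0F; 1F; 2F; 3F; 4F; 5F)
open import Data.Fin.Permutation using (Permutation; Permutation′; permutation; _⟨$⟩ʳ_; _⟨$⟩ˡ_; inverseˡ; inverseʳ; ↔⇒≡)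
import Data.Fin.Permutation as Perm
import Data.Fin.Properties as Fin
open import Data.Fin.Subset using (Subset; _∈_; _∉_; _⊆_; _∪_; _∩_; ∁; ⊥; ⁅_⁆; ∣_∣; _-_; inside; outside)
open import Data.Fin.Subset.Properties
open import Data.Nat
open import Data.Nat.DivMod using (m≡m%n+[m/n]*n; m%n<n)
open import Data.Nat.Properties
open import Data.Product using (Σ; ∃; ∃-syntax; _×_; _,_; proj₁; proj₂)
open import Data.Sum using (_⊎_; inj₁; inj₂)
open import Data.Vec as Vec using (Vec; []; _∷_; here; there; insertAt; lookup; tabulate)
open import Data.Vec.N-ary using (N-ary; _$ⁿ_)
open import Data.Vec.Properties using (insertAt-lookup; insertAt-punchIn; lookup∘tabulate; lookup⇒[]=; []=⇒lookup)
open import Data.Vec.Properties.WithK using ([]=-irrelevant)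
open import Function.Base using (_∘_)
open import Function.Bundles using (_⇔_; mk⇔; Equivalence)
open import Function.Definitions using (Injective)
open import Relation.Binary.Definitions using (tri<; tri≈; tri>)
open import Relation.Binary.PropositionalEquality
open import Relation.Nullary using (¬_; Dec; yes; no; does; contradiction)
open import Relation.Nullary.Decidable using (¬?; _×-dec_; _⊎-dec_; _→-dec_; dec-true; from-yes; map′)

-- `Model` presents a matroid by a band, and all operations act on models. A band asks for no
-- antichain, so deletion, contraction and duality need not preserve one; it is restored once, at
-- the end. Rotating the cycle reduces deletion and contraction to the last position. A minor is
-- defined through some basis of `C`, so a model of it needs one basis that serves every set. This
-- rests on augmentation, which is proved for matchings rather than for paths. Finding a basis
-- requires deciding independence, though `Ind` is an arbitrary predicate; the model supplies the
-- decision by repeated deletion and contraction. The 2 in `t + n − 2` is the smallest gap that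
-- keeps an interval from covering the whole cycle, and so from containing the others. A single
-- interval may cover it, so the gap is capped by the rank. Heights are natural numbers. Hence
-- constants are added to paths, differences are compared additively, and a position lifted by a
-- turn is counted once less instead of negatively.

open Equivalence using (to; from)

-- Linear inequalities between natural numbers are decided by adding up
-- hypotheses until the goal follows coefficient by coefficient.

infixl 6 _⊹_
infix 4 _≼_ _≐_
infixr 3 _⊢_ ∎_

data Expr (n : ℕ) : Set where
  ‵_  : Fin n → Expr n
  #_  : ℕ → Expr n
  𝕤   : Expr n → Expr n
  _⊹_ : Expr n → Expr n → Expr n

data Rel (n : ℕ) : Set where
  _≼_ _≐_ : Expr n → Expr n → Rel n

data Problem (n : ℕ) : Set where
  ∎_  : Rel n → Problem n
  _⊢_ : Rel n → Problem n → Problem n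

⟦_⟧ : ∀ {n} → Expr n → Vec ℕ n → ℕ
⟦ ‵ i ⟧ ρ = Vec.lookup ρ i
⟦ # c ⟧ ρ = c
⟦ 𝕤 e ⟧ ρ = suc (⟦ e ⟧ ρ)
⟦ e ⊹ f ⟧ ρ = ⟦ e ⟧ ρ + ⟦ f ⟧ ρ

⟦_⟧ʳ : ∀ {n} → Rel n → Vec ℕ n → Set
⟦ e ≼ f ⟧ʳ ρ = ⟦ e ⟧ ρ ≤ ⟦ f ⟧ ρ
⟦ e ≐ f ⟧ʳ ρ = ⟦ e ⟧ ρ ≡ ⟦ f ⟧ ρ

⟦_⟧ᵖ : ∀ {n} → Problem n → Vec ℕ n → Set
⟦ ∎ r ⟧ᵖ ρ = ⟦ r ⟧ʳ ρ
⟦ r ⊢ p ⟧ᵖ ρ = ⟦ r ⟧ʳ ρ → ⟦ p ⟧ᵖ ρ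

Form : ℕ → Set
Form n = ℕ × Vec ℕ n

dot : ∀ {n} → Vec ℕ n → Vec ℕ n → ℕ
dot []       []       = 0
dot (c ∷ cs) (x ∷ xs) = c * x + dot cs xs

value : ∀ {n} → Form n → Vec ℕ n → ℕ
value (c , cs) ρ = c + dot cs ρ

_⊞_ : ∀ {n} → Form n → Form n → Form n
(c , cs) ⊞ (d , ds) = c + d , Vec.zipWith _+_ cs ds

unit : ∀ {n} → Fin n → Vec ℕ n
unit zero    = 1 ∷ Vec.replicate _ 0
unit (suc i) = 0 ∷ unit i

form : ∀ {n} → Expr n → Form n
form (‵ i)   = 0 , unit i
form (# c)   = c , Vec.replicate _ 0
form (𝕤 e)   = (1 , Vec.replicate _ 0) ⊞ form e
form (e ⊹ f) = form e ⊞ form f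

dot-zeros : ∀ {n} (ρ : Vec ℕ n) → dot (Vec.replicate n 0) ρ ≡ 0
dot-zeros []      = refl
dot-zeros (x ∷ ρ) = dot-zeros ρ

dot-unit : ∀ {n} (i : Fin n) ρ → dot (unit i) ρ ≡ Vec.lookup ρ i
dot-unit zero    (x ∷ ρ) rewrite dot-zeros ρ | +-identityʳ x = +-identityʳ x
dot-unit (suc i) (x ∷ ρ) = dot-unit i ρ

+-interchange : ∀ a b c d → (a + b) + (c + d) ≡ (a + c) + (b + d)
+-interchange a b c d = begin
  (a + b) + (c + d)   ≡⟨ +-assoc a b (c + d) ⟩
  a + (b + (c + d))   ≡⟨ cong (a +_) (+-assoc b c d) ⟨
  a + (b + c + d)     ≡⟨ cong (λ z → a + (z + d)) (+-comm b c) ⟩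
  a + (c + b + d)     ≡⟨ cong (a +_) (+-assoc c b d) ⟩
  a + (c + (b + d))   ≡⟨ +-assoc a c (b + d) ⟨
  (a + c) + (b + d)   ∎
  where open ≡-Reasoning

dot-+ : ∀ {n} (cs ds ρ : Vec ℕ n) → dot (Vec.zipWith _+_ cs ds) ρ ≡ dot cs ρ + dot ds ρ
dot-+ []       []       []      = refl
dot-+ (c ∷ cs) (d ∷ ds) (x ∷ ρ)
  rewrite dot-+ cs ds ρ | *-distribʳ-+ x c d = +-interchange (c * x) (d * x) _ _

value-⊞ : ∀ {n} (f g : Form n) ρ → value (f ⊞ g) ρ ≡ value f ρ + value g ρ
value-⊞ (c , cs) (d , ds) ρ rewrite dot-+ cs ds ρ = +-interchange c d _ _

value-form : ∀ {n} (e : Expr n) ρ → value (form e) ρ ≡ ⟦ e ⟧ ρ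
value-form (‵ i)   ρ = dot-unit i ρ
value-form (# c)   ρ rewrite dot-zeros ρ = +-identityʳ c
value-form (𝕤 e)   ρ = trans (value-⊞ (1 , Vec.replicate _ 0) (form e) ρ)
  (cong₂ (λ a b → suc (a + b)) (dot-zeros ρ) (value-form e ρ))
value-form (e ⊹ f) ρ = trans (value-⊞ (form e) (form f) ρ) (cong₂ _+_ (value-form e ρ) (value-form f ρ))

_≤ᶜ_ : ∀ {n} → Vec ℕ n → Vec ℕ n → Bool
[]       ≤ᶜ []       = true
(c ∷ cs) ≤ᶜ (d ∷ ds) = (c ≤ᵇ d) ∧ (cs ≤ᶜ ds)

_≤ᶠ_ : ∀ {n} → Form n → Form n → Bool
(c , cs) ≤ᶠ (d , ds) = (c ≤ᵇ d) ∧ (cs ≤ᶜ ds)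

∧-split : ∀ a {b} → T (a ∧ b) → T a × T b
∧-split a = to (T-∧ {a})

≤ᶜ-sound : ∀ {n} (cs ds ρ : Vec ℕ n) → T (cs ≤ᶜ ds) → dot cs ρ ≤ dot ds ρ
≤ᶜ-sound []       []       []      _ = z≤n
≤ᶜ-sound (c ∷ cs) (d ∷ ds) (x ∷ ρ) t with ∧-split (c ≤ᵇ d) t
... | p , q = +-mono-≤ (*-monoˡ-≤ x (≤ᵇ⇒≤ c d p)) (≤ᶜ-sound cs ds ρ q)

≤ᶠ-sound : ∀ {n} (f g : Form n) ρ → T (f ≤ᶠ g) → value f ρ ≤ value g ρ
≤ᶠ-sound (c , cs) (d , ds) ρ t with ∧-split (c ≤ᵇ d) t
... | p , q = +-mono-≤ (≤ᵇ⇒≤ c d p) (≤ᶜ-sound cs ds ρ q)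

-- A goal that is an equality is proved as two inequalities, and the search for a certificate runs
-- once for each.
data Side : Set where
  ltr rtl : Side

weaken : ∀ {n} → Side → Rel n → Rel n
weaken ltr (e ≐ f) = e ≼ f
weaken rtl (e ≐ f) = f ≼ e
weaken _     (e ≼ f) = e ≼ f

-- The accumulated forms l and r stand for the known inequality l ≤ r.
decide : ∀ {n} (l r : Form n) → Side → Problem n → Bool
decide l r s (∎ q) with weaken s q
... | e ≼ f = (r ⊞ form e) ≤ᶠ (l ⊞ form f)
... | e ≐ f = false
decide l r s ((e ≼ f) ⊢ p) = decide (l ⊞ form e) (r ⊞ form f) s p ∨ decide l r s p
decide l r s ((e ≐ f) ⊢ p) =
  decide (l ⊞ form e) (r ⊞ form f) s p ∨ (decide (l ⊞ form f) (r ⊞ form e) s p ∨ decide l r s p)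

⟦_⟧ˢ : ∀ {n} → Problem n → Side → Vec ℕ n → Set
⟦ ∎ q ⟧ˢ   s ρ = ⟦ weaken s q ⟧ʳ ρ
⟦ q ⊢ p ⟧ˢ s ρ = ⟦ q ⟧ʳ ρ → ⟦ p ⟧ˢ s ρ

extend : ∀ {n} {l r : Form n} (e f : Expr n) ρ → value l ρ ≤ value r ρ → ⟦ e ⟧ ρ ≤ ⟦ f ⟧ ρ →
         value (l ⊞ form e) ρ ≤ value (r ⊞ form f) ρ
extend {l = l} {r} e f ρ l≤r e≤f
  rewrite value-⊞ l (form e) ρ | value-⊞ r (form f) ρ | value-form e ρ | value-form f ρ =
  +-mono-≤ l≤r e≤f

decide-sound : ∀ {n} (l r : Form n) s p ρ → T (decide l r s p) → value l ρ ≤ value r ρ → ⟦ p ⟧ˢ s ρ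
decide-sound l r s (∎ q) ρ t l≤r with weaken s q
... | e ≼ f = +-cancelˡ-≤ (value l ρ) _ _ (begin
  value l ρ + ⟦ e ⟧ ρ     ≤⟨ +-monoˡ-≤ _ l≤r ⟩
  value r ρ + ⟦ e ⟧ ρ     ≡⟨ trans (value-⊞ r (form e) ρ) (cong (value r ρ +_) (value-form e ρ)) ⟨
  value (r ⊞ form e) ρ    ≤⟨ ≤ᶠ-sound (r ⊞ form e) (l ⊞ form f) ρ t ⟩
  value (l ⊞ form f) ρ    ≡⟨ trans (value-⊞ l (form f) ρ) (cong (value l ρ +_) (value-form f ρ)) ⟩
  value l ρ + ⟦ f ⟧ ρ     ∎)
  where open ≤-Reasoning
decide-sound l r s ((e ≼ f) ⊢ p) ρ t l≤r h with to (T-∨ {decide (l ⊞ form e) (r ⊞ form f) s p}) t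
... | inj₁ t₁ = decide-sound _ _ s p ρ t₁ (extend {l = l} {r} e f ρ l≤r h)
... | inj₂ t₂ = decide-sound l r s p ρ t₂ l≤r
decide-sound l r s ((e ≐ f) ⊢ p) ρ t l≤r h with to (T-∨ {decide (l ⊞ form e) (r ⊞ form f) s p}) t
... | inj₁ t₁ = decide-sound _ _ s p ρ t₁ (extend {l = l} {r} e f ρ l≤r (≤-reflexive h))
... | inj₂ t₂ with to (T-∨ {decide (l ⊞ form f) (r ⊞ form e) s p}) t₂
...   | inj₁ t₃ = decide-sound _ _ s p ρ t₃ (extend {l = l} {r} f e ρ l≤r (≤-reflexive (sym h)))
...   | inj₂ t₄ = decide-sound l r s p ρ t₄ l≤r

combine : ∀ {n} (p : Problem n) ρ → ⟦ p ⟧ˢ ltr ρ → ⟦ p ⟧ˢ rtl ρ → ⟦ p ⟧ᵖ ρ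
combine (∎ (e ≼ f)) ρ u v   = u
combine (∎ (e ≐ f)) ρ u v   = ≤-antisym u v
combine (q ⊢ p)     ρ u v h = combine p ρ (u h) (v h)

valid : ∀ {n} → Problem n → Bool
valid p = decide zero′ zero′ ltr p ∧ decide zero′ zero′ rtl p
  where zero′ = 0 , Vec.replicate _ 0

valid-sound : ∀ {n} (p : Problem n) → T (valid p) → ∀ ρ → ⟦ p ⟧ᵖ ρ
valid-sound p t ρ with ∧-split (decide _ _ ltr p) t
... | u , v = combine p ρ (decide-sound _ _ ltr p ρ u ≤-refl) (decide-sound _ _ rtl p ρ v ≤-refl)

Curried : ∀ {n} m → (Vec ℕ m → Vec ℕ n) → Problem n → Set
Curried zero    k p = ⟦ p ⟧ᵖ (k [])
Curried (suc m) k p = (x : ℕ) → Curried m (λ xs → k (x ∷ xs)) p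

curried : ∀ {n} m (k : Vec ℕ m → Vec ℕ n) p → (∀ ρ → ⟦ p ⟧ᵖ ρ) → Curried m k p
curried zero    k p s = s (k [])
curried (suc m) k p s = λ x → curried m _ p s

problem : ∀ n → N-ary n (Expr n) (Problem n) → Problem n
problem n f = f $ⁿ Vec.tabulate {n = n} ‵_

-- The implicit argument is `T` of a closed boolean, so each use finds its certificate by
-- evaluation. Every hypothesis is taken once or left out, an equality in either direction; no other
-- multiples are tried.
lin : ∀ n (f : N-ary n (Expr n) (Problem n)) {_ : T (valid (problem n f))} →
      Curried n (λ ρ → ρ) (problem n f)
lin n f {t} = curried n _ (problem n f) (valid-sound (problem n f) t)

-- Lattice paths over one turn of the cycle, and bands of them

Rising Slow : ℕ → (ℕ → ℕ) → Set
Rising n h = ∀ t → t < n → h t ≤ h (suc t)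
Slow n h = ∀ t → t < n → h (suc t) ≤ suc (h t)

-- Only the values up to `n` matter. Beyond the turn the path is thought of as continued
-- periodically, and what the function returns there is ignored.
record Path (n r : ℕ) (h : ℕ → ℕ) : Set where
  field
    up   : Rising n h
    lip  : Slow n h
    turn : h n ≡ h 0 + r

open Path public

infix 4 _≤[_]_ _∈ᵇ_

_≤[_]_ : (ℕ → ℕ) → ℕ → (ℕ → ℕ) → Set
g ≤[ n ] h = ∀ t → t ≤ n → g t ≤ h t

Step : (ℕ → ℕ) → ℕ → Set
Step h t = h t < h (suc t)

up-≤ : ∀ {n h} → Rising n h → ∀ {s t} → s ≤ t → t ≤ n → h s ≤ h t
up-≤ u {s} {zero}  z≤n t≤n = ≤-refl
up-≤ u {s} {suc t} s≤t t≤n with m≤n⇒m<n∨m≡n s≤t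
... | inj₁ (s≤s s≤t′) = ≤-trans (up-≤ u s≤t′ (<⇒≤ t≤n)) (u t t≤n)
... | inj₂ refl       = ≤-refl

lip-≤ : ∀ {n h} → Slow n h → ∀ {s t} → s ≤ t → t ≤ n → h t + s ≤ h s + t
lip-≤ l {s} {zero}  z≤n t≤n = ≤-refl
lip-≤ {h = h} l {s} {suc t} s≤t t≤n with m≤n⇒m<n∨m≡n s≤t
... | inj₁ (s≤s s≤t′) =
  lin 5 (λ a b c s t → a ⊹ s ≼ c ⊹ t ⊢ b ≼ 𝕤 a ⊢ ∎ b ⊹ s ≼ c ⊹ 𝕤 t) (h t) (h (suc t)) (h s) s t
    (lip-≤ l s≤t′ (<⇒≤ t≤n)) (l t t≤n)
... | inj₂ refl       = ≤-refl

module _ {n r h} (P : Path n r h) where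
  mono : ∀ {s t} → s ≤ t → t ≤ n → h s ≤ h t
  mono = up-≤ (up P)

  lipschitz : ∀ {s t} → s ≤ t → t ≤ n → h t + s ≤ h s + t
  lipschitz = lip-≤ (lip P)

  r≤n : r ≤ n
  r≤n = lin 4 (λ hn h0 n r → hn ⊹ # 0 ≼ h0 ⊹ n ⊢ hn ≐ h0 ⊹ r ⊢ ∎ r ≼ n) (h n) (h 0) n r
    (lipschitz z≤n ≤-refl) (turn P)

record Band (n : ℕ) : Set where
  field
    rank       : ℕ
    low high   : ℕ → ℕ
    low-path   : Path n rank low
    high-path  : Path n rank high
    low≤high   : low ≤[ n ] high

open Band public

record _∈ᵇ_ {n : ℕ} (h : ℕ → ℕ) (B : Band n) : Set where
  field
    path  : Path n (rank B) h
    above : low B ≤[ n ] h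
    below : h ≤[ n ] high B

open _∈ᵇ_ public

low∈ : ∀ {n} (B : Band n) → low B ∈ᵇ B
low∈ B = record { path = low-path B ; above = λ _ _ → ≤-refl ; below = low≤high B }

suc-∸ : ∀ m k → suc m ∸ k ≤ suc (m ∸ k)
suc-∸ m k = m≤n+o⇒m∸n≤o (suc m) k (≤-trans (s≤s (m≤n+m∸n m k)) (≤-reflexive (sym (+-suc k _))))

-- A path over a shorter turn has an arbitrary value just past its end, so extending it by one
-- position means overwriting that value.
override : (ℕ → ℕ) → ℕ → ℕ → ℕ → ℕ
override h n v t with t ≟ n
... | yes _ = v
... | no  _ = h t

override-≡ : ∀ h n v → override h n v n ≡ v
override-≡ h n v with n ≟ n
... | yes _   = refl
... | no  n≢n = contradiction refl n≢n

override-< : ∀ h n v {t} → t < n → override h n v t ≡ h t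
override-< h n v {t} t<n with t ≟ n
... | yes refl = contradiction t<n (<-irrefl refl)
... | no  _    = refl

override-path : ∀ {n r h v} → Rising n h → Slow n h →
                h n ≤ v → v ≤ suc (h n) → v ≡ h 0 + r → Path (suc n) r (override h (suc n) v)
override-path {n} {r} {h} {v} u l n≤v v≤n v≡ = record { up = up′ ; lip = lip′ ; turn = turn′ }
  where
  up′ : Rising (suc n) (override h (suc n) v)
  up′ t (s≤s t≤n) rewrite override-< h (suc n) v (s≤s t≤n) with m≤n⇒m<n∨m≡n t≤n
  ... | inj₁ t<n rewrite override-< h (suc n) v (s≤s t<n) = u t t<n
  ... | inj₂ refl rewrite override-≡ h (suc n) v = n≤v
  lip′ : Slow (suc n) (override h (suc n) v)
  lip′ t (s≤s t≤n) rewrite override-< h (suc n) v (s≤s t≤n) with m≤n⇒m<n∨m≡n t≤n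
  ... | inj₁ t<n rewrite override-< h (suc n) v (s≤s t<n) = l t t<n
  ... | inj₂ refl rewrite override-≡ h (suc n) v = v≤n
  turn′ : override h (suc n) v (suc n) ≡ override h (suc n) v 0 + r
  turn′ rewrite override-≡ h (suc n) v | override-< h (suc n) v {0} z<s = v≡

module _ {n : ℕ} {p h : ℕ → ℕ} {v : ℕ} where
  override-≥ : p ≤[ n ] h → p (suc n) ≤ v → p ≤[ suc n ] override h (suc n) v
  override-≥ p≤h p≤v t t≤n with m≤n⇒m<n∨m≡n t≤n
  ... | inj₁ (s≤s t<n) rewrite override-< h (suc n) v (s≤s t<n) = p≤h t t<n
  ... | inj₂ refl rewrite override-≡ h (suc n) v = p≤v

  override-≤ : h ≤[ n ] p → v ≤ p (suc n) → override h (suc n) v ≤[ suc n ] p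
  override-≤ h≤p v≤p t t≤n with m≤n⇒m<n∨m≡n t≤n
  ... | inj₁ (s≤s t<n) rewrite override-< h (suc n) v (s≤s t<n) = h≤p t t<n
  ... | inj₂ refl rewrite override-≡ h (suc n) v = v≤p

override-step : ∀ {n h v t} → t < n → Step h t → Step (override h (suc n) v) t
override-step {n} {h} {v} t<n s
  rewrite override-< h (suc n) v (m<n⇒m<1+n t<n) | override-< h (suc n) v (s≤s t<n) = s

restrict : ∀ {n r r′ h} → Path (suc n) r h → h n ≡ h 0 + r′ → Path n r′ h
restrict P e = record { up = λ t t<n → up P t (m<n⇒m<1+n t<n) ; lip = λ t t<n → lip P t (m<n⇒m<1+n t<n) ; turn = e }

⊔-path : ∀ {n r g h} → Rising n g → Slow n g →
         Rising n h → Slow n h →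
         g n ⊔ h n ≡ (g 0 ⊔ h 0) + r → Path n r (λ t → g t ⊔ h t)
⊔-path u l u′ l′ e = record
  { up = λ t t<n → ⊔-mono-≤ (u t t<n) (u′ t t<n) ; lip = λ t t<n → ⊔-mono-≤ (l t t<n) (l′ t t<n) ; turn = e }

⊓-path : ∀ {n r g h} → Rising n g → Slow n g →
         Rising n h → Slow n h →
         g n ⊓ h n ≡ (g 0 ⊓ h 0) + r → Path n r (λ t → g t ⊓ h t)
⊓-path u l u′ l′ e = record
  { up = λ t t<n → ⊓-mono-≤ (u t t<n) (u′ t t<n) ; lip = λ t t<n → ⊓-mono-≤ (l t t<n) (l′ t t<n) ; turn = e }

const-rising : ∀ n c → Rising n (λ _ → c)
const-rising n c t _ = ≤-refl

const-slow : ∀ n c → Slow n (λ _ → c)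
const-slow n c t _ = n≤1+n c

ramp-rising : ∀ n c k → Rising n (λ t → (c + t) ∸ k)
ramp-rising n c k t _ = ∸-monoˡ-≤ k (+-monoʳ-≤ c (n≤1+n t))

ramp-slow : ∀ n c k → Slow n (λ t → (c + t) ∸ k)
ramp-slow n c k t _ rewrite +-suc c t = suc-∸ (c + t) k

override-last : ∀ {m h} (B : Band (suc m)) v {r} → Path m r h → low B ≤[ m ] h → h ≤[ m ] high B →
                h m ≤ v → v ≤ suc (h m) → v ≡ h 0 + rank B → low B (suc m) ≤ v → v ≤ high B (suc m) →
                override h (suc m) v ∈ᵇ B
override-last B v P lo hi m≤v v≤m v≡ l≤v v≤h = record
  { path  = override-path (up P) (lip P) m≤v v≤m v≡
  ; above = override-≥ lo l≤v
  ; below = override-≤ hi v≤h }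

-- A path without a step at m has height at least p (m + 1) at m, so it lies
-- above the line of slope one through that point; dually it starts at most
-- at q m ∸ r and lies below the line of slope one from there.
module NoLastStep {m} (B : Band (suc m)) (r≤m : rank B ≤ m) (free : low B (suc m) ≤ high B m) where
  private
    p = low B; q = high B; r = rank B; P = low-path B; Q = high-path B
    pN = p (suc m)

  lowest : ∀ {h} → h ∈ᵇ B → h (suc m) ≤ h m → ∀ t → t ≤ m → p t ⊔ ((pN + t) ∸ m) ≤ h t
  lowest {h} h∈ flat t t≤m = ⊔-lub (above h∈ t (m≤n⇒m≤1+n t≤m)) (m≤n+o⇒m∸n≤o (pN + t) m
    (lin 6 (λ a b c d m t → a ≼ b ⊢ b ≼ c ⊢ c ⊹ t ≼ d ⊹ m ⊢ ∎ a ⊹ t ≼ m ⊹ d) pN (h (suc m)) (h m) (h t) m t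
      (above h∈ _ ≤-refl) flat (lipschitz (path h∈) t≤m (n≤1+n m))))

  highest : ∀ {h} → h ∈ᵇ B → h (suc m) ≤ h m → ∀ t → t ≤ m → h t ≤ q t ⊓ ((q m + t) ∸ r)
  highest {h} h∈ flat t t≤m = ⊓-glb (below h∈ t (m≤n⇒m≤1+n t≤m)) (m+n≤o⇒m≤o∸n (h t)
    (lin 7 (λ ht h0 hN hm qm r t → ht ⊹ # 0 ≼ h0 ⊹ t ⊢ hN ≐ h0 ⊹ r ⊢ hN ≼ hm ⊢ hm ≼ qm ⊢ ∎ ht ⊹ r ≼ qm ⊹ t)
      (h t) (h 0) (h (suc m)) (h m) (q m) r t
      (lipschitz (path h∈) z≤n (m≤n⇒m≤1+n t≤m)) (turn (path h∈)) flat (below h∈ m (n≤1+n m))))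

  r≤qm : r ≤ q m
  r≤qm = lin 4 (λ pN p0 r qm → pN ≐ p0 ⊹ r ⊢ pN ≼ qm ⊢ ∎ r ≼ qm) pN (p 0) r (q m) (turn P) free

  band : Band m
  band = record
    { rank = r
    ; low = λ t → p t ⊔ ((pN + t) ∸ m)
    ; high = λ t → q t ⊓ ((q m + t) ∸ r)
    ; low-path = ⊔-path (λ t l → up P t (m<n⇒m<1+n l)) (λ t l → lip P t (m<n⇒m<1+n l))
        (ramp-rising m pN m) (ramp-slow m pN m) low-turn
    ; high-path = ⊓-path (λ t l → up Q t (m<n⇒m<1+n l)) (λ t l → lip Q t (m<n⇒m<1+n l))
        (ramp-rising m (q m) r) (ramp-slow m (q m) r) high-turn
    ; low≤high = λ t t≤m → ⊓-glb (⊔-lub (low≤high B t (m≤n⇒m≤1+n t≤m)) (c₁ t t≤m)) (⊔-lub (c₂ t t≤m) (c₃ t t≤m)) }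
    where
    open ≡-Reasoning
    pN∸m≤p0 : (pN + 0) ∸ m ≤ p 0
    pN∸m≤p0 = m≤n+o⇒m∸n≤o (pN + 0) m
      (lin 4 (λ pN p0 r m → pN ≐ p0 ⊹ r ⊢ r ≼ m ⊢ ∎ pN ⊹ # 0 ≼ m ⊹ p0) pN (p 0) r m (turn P) r≤m)
    low-turn : p m ⊔ ((pN + m) ∸ m) ≡ (p 0 ⊔ ((pN + 0) ∸ m)) + r
    low-turn = begin
      p m ⊔ ((pN + m) ∸ m)          ≡⟨ cong (p m ⊔_) (m+n∸n≡m pN m) ⟩
      p m ⊔ pN                      ≡⟨ m≤n⇒m⊔n≡n (mono P (n≤1+n m) ≤-refl) ⟩
      pN                            ≡⟨ turn P ⟩
      p 0 + r                       ≡⟨ cong (_+ r) (m≥n⇒m⊔n≡m pN∸m≤p0) ⟨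
      (p 0 ⊔ ((pN + 0) ∸ m)) + r    ∎
    qm≤q0+r : q m ≤ q 0 + r
    qm≤q0+r = ≤-trans (mono Q (n≤1+n m) ≤-refl) (≤-reflexive (turn Q))
    qm∸r≤q0 : (q m + 0) ∸ r ≤ q 0
    qm∸r≤q0 = m≤n+o⇒m∸n≤o (q m + 0) r
      (lin 3 (λ qm q0 r → qm ≼ q0 ⊹ r ⊢ ∎ qm ⊹ # 0 ≼ r ⊹ q0) (q m) (q 0) r qm≤q0+r)
    qm≤ramp : q m ≤ (q m + m) ∸ r
    qm≤ramp = m+n≤o⇒m≤o∸n (q m) (+-monoʳ-≤ (q m) r≤m)
    high-turn : q m ⊓ ((q m + m) ∸ r) ≡ (q 0 ⊓ ((q m + 0) ∸ r)) + r
    high-turn = begin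
      q m ⊓ ((q m + m) ∸ r)         ≡⟨ m≤n⇒m⊓n≡m qm≤ramp ⟩
      q m                           ≡⟨ m∸n+n≡m r≤qm ⟨
      (q m ∸ r) + r                 ≡⟨ cong (λ x → (x ∸ r) + r) (+-identityʳ (q m)) ⟨
      ((q m + 0) ∸ r) + r           ≡⟨ cong (_+ r) (m≥n⇒m⊓n≡n qm∸r≤q0) ⟨
      (q 0 ⊓ ((q m + 0) ∸ r)) + r   ∎
    c₁ : ∀ t → t ≤ m → (pN + t) ∸ m ≤ q t
    c₁ t t≤m = m≤n+o⇒m∸n≤o (pN + t) m
      (lin 5 (λ pN qm qt m t → pN ≼ qm ⊢ qm ⊹ t ≼ qt ⊹ m ⊢ ∎ pN ⊹ t ≼ m ⊹ qt) pN (q m) (q t) m t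
        free (lipschitz Q t≤m (n≤1+n m)))
    c₂ : ∀ t → t ≤ m → p t ≤ (q m + t) ∸ r
    c₂ t t≤m = m+n≤o⇒m≤o∸n (p t)
      (lin 6 (λ pN qm pt p0 r t → pN ≼ qm ⊢ pt ⊹ # 0 ≼ p0 ⊹ t ⊢ pN ≐ p0 ⊹ r ⊢ ∎ pt ⊹ r ≼ qm ⊹ t) pN (q m) (p t) (p 0) r t
        free (lipschitz P z≤n (m≤n⇒m≤1+n t≤m)) (turn P))
    c₃ : ∀ t → t ≤ m → (pN + t) ∸ m ≤ (q m + t) ∸ r
    c₃ t t≤m = ∸-mono (+-monoˡ-≤ t free) r≤m

  restrict∈ : ∀ {h} → h ∈ᵇ B → h (suc m) ≤ h m → h ∈ᵇ band
  restrict∈ {h} h∈ flat = record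
    { path  = restrict (path h∈) (trans (≤-antisym (up (path h∈) m ≤-refl) flat) (turn (path h∈)))
    ; above = lowest h∈ flat
    ; below = highest h∈ flat }

  extend∈ : ∀ {h} → h ∈ᵇ band → override h (suc m) (h m) ∈ᵇ B
  extend∈ {h} h∈ = override-last B (h m) (path h∈)
    (λ t t≤m → ≤-trans (m≤m⊔n _ _) (above h∈ t t≤m)) (λ t t≤m → ≤-trans (below h∈ t t≤m) (m⊓n≤m _ _))
    ≤-refl (n≤1+n _) (turn (path h∈))
    (≤-trans (≤-trans (≤-reflexive (sym (m+n∸n≡m pN m))) (m≤n⊔m (p m) _)) (above h∈ m ≤-refl))
    (≤-trans (≤-trans (below h∈ m ≤-refl) (m⊓n≤m (q m) _)) (up Q m ≤-refl))

  -- A path stepping last is raised along a line of slope one ending at its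
  -- final height when that fits under the band, and otherwise lowered along
  -- the line of slope one starting just below its initial height.
  avoid : ∀ {h} → h ∈ᵇ B → Σ (ℕ → ℕ) λ g → g ∈ᵇ B × g (suc m) ≤ g m × (∀ t → t < m → Step h t → Step g t)
  avoid {h} h∈ with h (suc m) ≤? h m
  ... | yes flat = h , h∈ , flat , λ _ _ s → s
  ... | no steep with h (suc m) ≤? q m
  ...   | yes fits = override g (suc m) (g m) , override-last B (g m) g-path
            (λ t t≤m → ≤-trans (above h∈ t (m≤n⇒m≤1+n t≤m)) (m≤m⊔n _ _))
            (λ t t≤m → ⊔-lub (below h∈ t (m≤n⇒m≤1+n t≤m)) (g-below t t≤m))
            ≤-refl (n≤1+n _) (turn g-path)
            (≤-trans (above h∈ _ ≤-refl) (≤-reflexive (sym gm)))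
            (≤-trans (≤-reflexive gm) (below h∈ _ ≤-refl))
          , ≤-reflexive (trans (override-≡ g (suc m) (g m)) (sym (override-< g (suc m) (g m) ≤-refl)))
          , λ t t<m s → override-step {h = g} t<m (g-step t t<m s)
    where
    hN = h (suc m)
    H = path h∈
    g : ℕ → ℕ
    g t = h t ⊔ ((hN + t) ∸ m)
    gm : g m ≡ hN
    gm = trans (cong (h m ⊔_) (m+n∸n≡m hN m)) (m≤n⇒m⊔n≡n (up H m ≤-refl))
    hN∸m≤h0 : (hN + 0) ∸ m ≤ h 0
    hN∸m≤h0 = m≤n+o⇒m∸n≤o (hN + 0) m
      (lin 4 (λ hN h0 r m → hN ≐ h0 ⊹ r ⊢ r ≼ m ⊢ ∎ hN ⊹ # 0 ≼ m ⊹ h0) hN (h 0) r m (turn H) r≤m)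
    g-path : Path m r g
    g-path = ⊔-path (λ t l → up H t (m<n⇒m<1+n l)) (λ t l → lip H t (m<n⇒m<1+n l))
      (ramp-rising m hN m) (ramp-slow m hN m)
      (trans gm (trans (turn H) (cong (_+ r) (sym (m≥n⇒m⊔n≡m hN∸m≤h0)))))
    g-below : ∀ t → t ≤ m → (hN + t) ∸ m ≤ q t
    g-below t t≤m = m≤n+o⇒m∸n≤o (hN + t) m
      (lin 5 (λ hN qm qt m t → hN ≼ qm ⊢ qm ⊹ t ≼ qt ⊹ m ⊢ ∎ hN ⊹ t ≼ m ⊹ qt) hN (q m) (q t) m t
        fits (lipschitz Q t≤m (n≤1+n m)))
    g-step : ∀ t → t < m → Step h t → Step g t
    g-step t t<m s = ⊔-lub (≤-trans s (m≤m⊔n _ _)) ramp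
      where
      ramp : suc ((hN + t) ∸ m) ≤ g (suc t)
      ramp with m ≤? hN + t
      ... | yes m≤ = ≤-trans (≤-reflexive (trans (sym (+-∸-assoc 1 m≤)) (cong (_∸ m) (sym (+-suc hN t))))) (m≤n⊔m _ _)
      -- Truncated subtraction makes the ramp flat at zero here; the step of `h` itself makes
      -- `g (suc t)` positive.
      ... | no  m≰ rewrite m≤n⇒m∸n≡0 (<⇒≤ (≰⇒> m≰)) = ≤-trans (s≤s z≤n) (≤-trans s (m≤m⊔n _ _))
  ...   | no tight = override g (suc m) (g m) , override-last B (g m) g-path
            (λ t t≤m → ⊓-glb (above h∈ t (m≤n⇒m≤1+n t≤m)) (g-above t t≤m))
            (λ t t≤m → ≤-trans (m⊓n≤m _ _) (below h∈ t (m≤n⇒m≤1+n t≤m)))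
            ≤-refl (n≤1+n _) (turn g-path)
            (≤-trans pN≤hm (≤-reflexive (sym gm)))
            (≤-trans (≤-reflexive gm) (≤-trans (up H m ≤-refl) (below h∈ _ ≤-refl)))
          , ≤-reflexive (trans (override-≡ g (suc m) (g m)) (sym (override-< g (suc m) (g m) ≤-refl)))
          , λ t t<m s → override-step {h = g} t<m (g-step t t<m s)
    where
    hN = h (suc m)
    H = path h∈
    g : ℕ → ℕ
    g t = h t ⊓ ((h 0 + t) ∸ 1)
    hN≡1+hm : hN ≡ suc (h m)
    hN≡1+hm = ≤-antisym (lip H m ≤-refl) (≰⇒> steep)
    -- The end of `h` exceeds `q m`, hence also `p (suc m)`: just when raising fails, there is room
    -- to lower.
    pN<hN : pN < hN
    pN<hN = ≤-<-trans free (≰⇒> tight)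
    pN≤hm : pN ≤ h m
    pN≤hm = ≤-pred (≤-trans pN<hN (≤-reflexive hN≡1+hm))
    1≤h0 : 1 ≤ h 0
    1≤h0 = lin 5 (λ pN hN p0 h0 r → 𝕤 pN ≼ hN ⊢ pN ≐ p0 ⊹ r ⊢ hN ≐ h0 ⊹ r ⊢ ∎ # 1 ≼ h0) pN hN (p 0) (h 0) r
      pN<hN (turn P) (turn H)
    gm : g m ≡ h m
    gm = m≤n⇒m⊓n≡m (m+n≤o⇒m≤o∸n (h m)
      (lin 5 (λ hN hm h0 r m → hN ≐ 𝕤 hm ⊢ hN ≐ h0 ⊹ r ⊢ r ≼ m ⊢ ∎ hm ⊹ # 1 ≼ h0 ⊹ m) hN (h m) (h 0) r m
        hN≡1+hm (turn H) r≤m))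
    g0 : suc (g 0) ≡ h 0
    g0 = trans (cong suc (m≥n⇒m⊓n≡n (≤-trans (m∸n≤m _ 1) (≤-reflexive (+-identityʳ (h 0))))))
      (trans (cong (λ x → suc (x ∸ 1)) (+-identityʳ (h 0))) (m+[n∸m]≡n 1≤h0))
    g-path : Path m r g
    g-path = ⊓-path (λ t l → up H t (m<n⇒m<1+n l)) (λ t l → lip H t (m<n⇒m<1+n l))
      (ramp-rising m (h 0) 1) (ramp-slow m (h 0) 1)
      (lin 6 (λ gm hm hN g0 h0 r → gm ≐ hm ⊢ hN ≐ 𝕤 hm ⊢ hN ≐ h0 ⊹ r ⊢ 𝕤 g0 ≐ h0 ⊢ ∎ gm ≐ g0 ⊹ r)
        (g m) (h m) hN (g 0) (h 0) r gm hN≡1+hm (turn H) g0)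
    g-above : ∀ t → t ≤ m → p t ≤ (h 0 + t) ∸ 1
    g-above t t≤m = m+n≤o⇒m≤o∸n (p t)
      (lin 7 (λ pN hN pt p0 h0 r t → 𝕤 pN ≼ hN ⊢ pN ≐ p0 ⊹ r ⊢ hN ≐ h0 ⊹ r ⊢ pt ⊹ # 0 ≼ p0 ⊹ t ⊢ ∎ pt ⊹ # 1 ≼ h0 ⊹ t)
        pN hN (p t) (p 0) (h 0) r t pN<hN (turn P) (turn H) (lipschitz P z≤n (m≤n⇒m≤1+n t≤m)))
    g-step : ∀ t → t < m → Step h t → Step g t
    g-step t t<m s = ⊓-mono-≤ s (≤-reflexive (trans (sym (+-∸-assoc 1 (≤-trans 1≤h0 (m≤m+n (h 0) t)))) (cong (_∸ 1) (sym (+-suc (h 0) t)))))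

-- A path stepping at m starts at height at least 1 + p m ∸ r and has height
-- at most q (m + 1) ∸ 1 at m.
module LastStep {m} (B : Band (suc m)) (1≤r : 1 ≤ rank B) (free : low B m < high B (suc m)) where
  private
    p = low B; q = high B; r = rank B; P = low-path B; Q = high-path B
    qN = q (suc m)
    c = suc (p m) ∸ r
    d = qN ∸ 1
    in′ : ∀ {t} → t ≤ m → t ≤ suc m
    in′ = m≤n⇒m≤1+n

  1≤qN : 1 ≤ qN
  1≤qN = ≤-trans (s≤s z≤n) free

  r′ : ℕ
  r′ = r ∸ 1

  r′+1 : suc r′ ≡ r
  r′+1 = m+[n∸m]≡n 1≤r

  d+1 : suc d ≡ qN
  d+1 = m+[n∸m]≡n 1≤qN

  r≤1+pm : r ≤ suc (p m)
  r≤1+pm = lin 4 (λ pN p0 r pm → pN ≐ p0 ⊹ r ⊢ pN ≼ 𝕤 pm ⊢ ∎ r ≼ 𝕤 pm) (p (suc m)) (p 0) r (p m) (turn P) (lip P m ≤-refl)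

  c+r : c + r ≡ suc (p m)
  c+r = m∸n+n≡m r≤1+pm

  band : Band m
  band = record
    { rank = r′
    ; low = λ t → p t ⊔ c
    ; high = λ t → q t ⊓ d
    ; low-path = ⊔-path (λ t l → up P t (m<n⇒m<1+n l)) (λ t l → lip P t (m<n⇒m<1+n l))
        (const-rising m c) (const-slow m c) low-turn
    ; high-path = ⊓-path (λ t l → up Q t (m<n⇒m<1+n l)) (λ t l → lip Q t (m<n⇒m<1+n l))
        (const-rising m d) (const-slow m d) high-turn
    ; low≤high = λ t t≤m → ⊓-glb (⊔-lub (low≤high B t (in′ t≤m)) (≤-trans c≤q0 (mono Q z≤n (in′ t≤m))))
                                 (⊔-lub (≤-trans (mono P t≤m (n≤1+n m)) pm≤d) (≤-trans c≤q0 q0≤d)) }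
    where
    p0≤c : p 0 ≤ c
    p0≤c = lin 5 (λ pN p0 r pm c → pN ≐ p0 ⊹ r ⊢ pN ≼ 𝕤 pm ⊢ c ⊹ r ≐ 𝕤 pm ⊢ ∎ p0 ≼ c) (p (suc m)) (p 0) r (p m) c
      (turn P) (lip P m ≤-refl) c+r
    c≤pm : c ≤ p m
    c≤pm = lin 3 (λ r pm c → c ⊹ r ≐ 𝕤 pm ⊢ # 1 ≼ r ⊢ ∎ c ≼ pm) r (p m) c c+r 1≤r
    low-turn : p m ⊔ c ≡ (p 0 ⊔ c) + r′
    low-turn rewrite m≥n⇒m⊔n≡m c≤pm | m≤n⇒m⊔n≡n p0≤c =
      lin 4 (λ c r pm s → c ⊹ r ≐ 𝕤 pm ⊢ 𝕤 s ≐ r ⊢ ∎ pm ≐ c ⊹ s) c r (p m) r′ c+r r′+1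
    c≤q0 : c ≤ q 0
    c≤q0 = lin 5 (λ c r pm qN q0 → c ⊹ r ≐ 𝕤 pm ⊢ 𝕤 pm ≼ qN ⊢ qN ≐ q0 ⊹ r ⊢ ∎ c ≼ q0) c r (p m) qN (q 0) c+r free (turn Q)
    q0≤d : q 0 ≤ d
    q0≤d = lin 4 (λ d qN q0 r → 𝕤 d ≐ qN ⊢ qN ≐ q0 ⊹ r ⊢ # 1 ≼ r ⊢ ∎ q0 ≼ d) d qN (q 0) r d+1 (turn Q) 1≤r
    d≤qm : d ≤ q m
    d≤qm = lin 3 (λ d qN qm → 𝕤 d ≐ qN ⊢ qN ≼ 𝕤 qm ⊢ ∎ d ≼ qm) d qN (q m) d+1 (lip Q m ≤-refl)
    pm≤d : p m ≤ d
    pm≤d = lin 3 (λ d qN pm → 𝕤 d ≐ qN ⊢ 𝕤 pm ≼ qN ⊢ ∎ pm ≼ d) d qN (p m) d+1 free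
    high-turn : q m ⊓ d ≡ (q 0 ⊓ d) + r′
    high-turn rewrite m≥n⇒m⊓n≡n d≤qm | m≤n⇒m⊓n≡m q0≤d =
      lin 5 (λ d qN q0 r s → 𝕤 d ≐ qN ⊢ qN ≐ q0 ⊹ r ⊢ 𝕤 s ≐ r ⊢ ∎ d ≐ q0 ⊹ s) d qN (q 0) r r′ d+1 (turn Q) r′+1

  restrict∈ : ∀ {h} → h ∈ᵇ B → h m < h (suc m) → h ∈ᵇ band
  restrict∈ {h} h∈ step = record
    { path  = restrict H
        (lin 5 (λ hm hN h0 r s → 𝕤 hm ≼ hN ⊢ hN ≼ 𝕤 hm ⊢ hN ≐ h0 ⊹ r ⊢ 𝕤 s ≐ r ⊢ ∎ hm ≐ h0 ⊹ s) (h m) hN (h 0) r r′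
          step (lip H m ≤-refl) (turn H) r′+1)
    ; above = λ t t≤m → ⊔-lub (above h∈ t (in′ t≤m)) (≤-trans c≤h0 (mono H z≤n (in′ t≤m)))
    ; below = λ t t≤m → ⊓-glb (below h∈ t (in′ t≤m)) (≤-trans (mono H t≤m (n≤1+n m)) hm≤d) }
    where
    H = path h∈
    hN = h (suc m)
    c≤h0 : c ≤ h 0
    c≤h0 = lin 6 (λ c r pm hm hN h0 → c ⊹ r ≐ 𝕤 pm ⊢ pm ≼ hm ⊢ 𝕤 hm ≼ hN ⊢ hN ≐ h0 ⊹ r ⊢ ∎ c ≼ h0) c r (p m) (h m) hN (h 0)
      c+r (above h∈ m (n≤1+n m)) step (turn H)
    hm≤d : h m ≤ d
    hm≤d = lin 4 (λ d qN hN hm → 𝕤 d ≐ qN ⊢ 𝕤 hm ≼ hN ⊢ hN ≼ qN ⊢ ∎ hm ≼ d) d qN hN (h m) d+1 step (below h∈ _ ≤-refl)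

  extend∈ : ∀ {h} → h ∈ᵇ band → override h (suc m) (suc (h m)) ∈ᵇ B
  extend∈ {h} h∈ = override-last B (suc (h m)) H
    (λ t t≤m → ≤-trans (m≤m⊔n _ _) (above h∈ t t≤m)) (λ t t≤m → ≤-trans (below h∈ t t≤m) (m⊓n≤m _ _))
    (n≤1+n _) ≤-refl
    (lin 4 (λ hm h0 r s → hm ≐ h0 ⊹ s ⊢ 𝕤 s ≐ r ⊢ ∎ 𝕤 hm ≐ h0 ⊹ r) (h m) (h 0) r r′ (turn H) r′+1)
    (≤-trans (lip P m ≤-refl) (s≤s (≤-trans (m≤m⊔n _ _) (above h∈ m ≤-refl))))
    (≤-trans (s≤s (≤-trans (below h∈ m ≤-refl) (m⊓n≤n (q m) d))) (≤-reflexive d+1))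
    where H = path h∈

  extend-step : ∀ {h} → Step (override h (suc m) (suc (h m))) m
  extend-step {h} rewrite override-≡ h (suc m) (suc (h m)) | override-< h (suc m) (suc (h m)) {m} ≤-refl = ≤-refl

-- Finite sets, and matroids presented by a band

injective⇒surjective : ∀ {n} (f : Fin n → Fin n) → Injective _≡_ _≡_ f → ∀ y → ∃ λ x → f x ≡ y
injective⇒surjective {suc n} f inj y with Fin.any? (λ x → f x Fin.≟ y)
... | yes found = found
... | no  none  = contradiction (Fin.injective⇒≤ {f = g} g-inj) 1+n≰n
  where
  y≢ : ∀ x → y ≢ f x
  y≢ x eq = none (x , sym eq)
  g : Fin (suc n) → Fin n
  g x = punchOut (y≢ x)
  g-inj : Injective _≡_ _≡_ g
  g-inj eq = inj (Fin.punchOut-injective (y≢ _) (y≢ _) eq)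

label-onto : ∀ {n} (ℓ : Fin n → ℕ) (ℓ< : ∀ x → ℓ x < n) → Injective _≡_ _≡_ ℓ → ∀ {t} → t < n → ∃ λ x → ℓ x ≡ t
label-onto {n} ℓ ℓ< inj t<n with injective⇒surjective position position-inj (fromℕ< t<n)
  where
  position : Fin n → Fin n
  position x = fromℕ< (ℓ< x)
  position-inj : Injective _≡_ _≡_ position
  position-inj eq = inj (trans (sym (Fin.toℕ-fromℕ< (ℓ< _))) (trans (cong toℕ eq) (Fin.toℕ-fromℕ< (ℓ< _))))
... | x , eq = x , trans (sym (Fin.toℕ-fromℕ< (ℓ< x))) (trans (cong toℕ eq) (Fin.toℕ-fromℕ< t<n))

⟪_⟫ : ∀ {n} {P : Fin n → Set} → (∀ x → Dec (P x)) → Subset n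
⟪ P? ⟫ = tabulate (λ x → does (P? x))

module _ {n} {P : Fin n → Set} (P? : ∀ x → Dec (P x)) where
  ∈⟪⟫⁺ : ∀ {x} → P x → x ∈ ⟪ P? ⟫
  ∈⟪⟫⁺ {x} px = lookup⇒[]= x _ (trans (lookup∘tabulate _ x) (dec-true (P? x) px))

  ∈⟪⟫⁻ : ∀ {x} → x ∈ ⟪ P? ⟫ → P x
  ∈⟪⟫⁻ {x} x∈ with P? x | trans (sym (lookup∘tabulate (λ x → does (P? x)) x)) ([]=⇒lookup x∈)
  ... | yes px | _ = px

abstract
  -- Abstract, so that `does (Step? h t)` does not reduce to a boolean comparison and a `with` on
  -- `increase?` still finds it inside `bits`.
  increase? : ∀ a b → Dec (a < b)
  increase? = _<?_

Step? : ∀ h t → Dec (Step h t)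
Step? h t = increase? (h t) (h (suc t))

Spanned : ∀ {n} → Band n → (Fin n → ℕ) → Subset n → Set
Spanned B ℓ X = ∃ λ h → h ∈ᵇ B × (∀ x → x ∈ X → Step h (ℓ x))

-- The element `x` is the step between the positions `label x` and `suc (label x)` of the cycle.
-- Labels are kept apart from the elements, so that the cycle can be rotated and elements removed
-- without renaming the ground set at the same time.
record Model {n} (Ind : IndepPred n) : Set where
  field
    band      : Band n
    label     : Fin n → ℕ
    label<    : ∀ x → label x < n
    label-inj : Injective _≡_ _≡_ label
    spec      : ∀ X → Ind X ⇔ Spanned band label X

  labelled : ∀ {t} → t < n → ∃ λ x → label x ≡ t
  labelled = label-onto label label< label-inj

open Model public

model-resp : ∀ {n} {I J : IndepPred n} → (∀ X → I X ⇔ J X) → Model I → Model J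
model-resp I⇔J M = record
  { band = band M ; label = label M ; label< = label< M ; label-inj = label-inj M
  ; spec = λ X → mk⇔ (to (spec M X) ∘ from (I⇔J X)) (to (I⇔J X) ∘ from (spec M X)) }

-- Rotation of the cycle

rotate : ℕ → ℕ → (ℕ → ℕ) → ℕ → ℕ
rotate m r h zero    = h m
rotate m r h (suc t) = r + h t

module _ {m r h} (H : Path (suc m) r h) where
  last≡ : r + h 0 ≡ h (suc m)
  last≡ = trans (+-comm r (h 0)) (sym (turn H))

  rotate-path : Path (suc m) r (rotate m r h)
  rotate-path = record
    { up   = λ { zero _ → ≤-trans (up H m ≤-refl) (≤-reflexive (sym last≡))
               ; (suc t) (s≤s l) → +-monoʳ-≤ r (up H t (m<n⇒m<1+n l)) }
    ; lip  = λ { zero _ → ≤-trans (≤-reflexive last≡) (lip H m ≤-refl)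
               ; (suc t) (s≤s l) → ≤-trans (+-monoʳ-≤ r (lip H t (m<n⇒m<1+n l))) (≤-reflexive (+-suc r (h t))) }
    ; turn = +-comm r (h m) }

rotate-≤ : ∀ {m r g h} → g ≤[ suc m ] h → rotate m r g ≤[ suc m ] rotate m r h
rotate-≤ {m}     g≤h zero    _ = g≤h m (n≤1+n m)
rotate-≤ {r = r} g≤h (suc t) (s≤s l) = +-monoʳ-≤ r (g≤h t (m≤n⇒m≤1+n l))

rotate-band : ∀ {m} → Band (suc m) → Band (suc m)
rotate-band {m} B = record
  { rank = rank B ; low = rotate m (rank B) (low B) ; high = rotate m (rank B) (high B)
  ; low-path = rotate-path (low-path B) ; high-path = rotate-path (high-path B)
  ; low≤high = rotate-≤ (low≤high B) }

rotate∈ : ∀ {m h} (B : Band (suc m)) → h ∈ᵇ B → rotate m (rank B) h ∈ᵇ rotate-band B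
rotate∈ {m} {h} B h∈ = record
  { path = rotate-path (path h∈) ; above = rotate-≤ (above h∈) ; below = rotate-≤ (below h∈) }

-- `rotate` reads the periodic extension one position earlier and raised by `r`, so that it starts
-- at `h m`, which is `h (-1) + r`. The inverse needs a value past the end of the turn; lowered by
-- `r`, it is `h 1`.
unrotate : ℕ → ℕ → (ℕ → ℕ) → ℕ → ℕ
unrotate m r h = override (λ t → h (suc t) ∸ r) (suc m) (h 1)

module _ {m} (B : Band (suc m)) {h} (h∈ : h ∈ᵇ rotate-band B) where
  private
    r = rank B; H = path h∈
    g : ℕ → ℕ
    g t = h (suc t) ∸ r
    r≤ : ∀ t → t < suc m → r ≤ h (suc t)
    r≤ t l = ≤-trans (m≤m+n r _) (above h∈ (suc t) l)
    g+r : ∀ t → t < suc m → g t + r ≡ h (suc t)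
    g+r t l = m∸n+n≡m (r≤ t l)
    gm : g m ≡ h 0
    gm = trans (cong (_∸ r) (turn H)) (m+n∸n≡m (h 0) r)

  unrotate∈ : unrotate m r h ∈ᵇ B
  unrotate∈ = record
    { path  = override-path
        (λ t l → ∸-monoˡ-≤ r (up H (suc t) (s≤s l)))
        (λ t l → ≤-trans (∸-monoˡ-≤ r (lip H (suc t) (s≤s l))) (suc-∸ (h (suc t)) r))
        (≤-trans (≤-reflexive gm) (up H 0 z<s))
        (≤-trans (lip H 0 z<s) (s≤s (≤-reflexive (sym gm))))
        (sym (g+r 0 z<s))
    ; above = override-≥ (λ t l → m+n≤o⇒m≤o∸n _ (≤-trans (≤-reflexive (+-comm _ r)) (above h∈ (suc t) (s≤s l))))
                (≤-trans (≤-reflexive (sym (last≡ (low-path B)))) (above h∈ 1 (s≤s z≤n)))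
    ; below = override-≤ (λ t l → m≤n+o⇒m∸n≤o _ r (below h∈ (suc t) (s≤s l)))
                (≤-trans (below h∈ 1 (s≤s z≤n)) (≤-reflexive (last≡ (high-path B)))) }

  unrotate-step : ∀ t → t < m → Step h (suc t) → Step (unrotate m r h) t
  unrotate-step t t<m s = override-step {h = g} t<m
    (≤-trans (≤-reflexive (sym (+-∸-assoc 1 (r≤ t (m<n⇒m<1+n t<m))))) (∸-monoˡ-≤ r s))

  unrotate-last : Step h 0 → Step (unrotate m r h) m
  unrotate-last s rewrite override-≡ g (suc m) (h 1) | override-< g (suc m) (h 1) {m} ≤-refl | gm = s

next : ℕ → ℕ → ℕ
next m z with z ≟ m
... | yes _ = 0
... | no  _ = suc z

next< : ∀ {m z} → z < suc m → next m z < suc m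
next< {m} {z} z<n with z ≟ m
... | yes _   = z<s
... | no  z≢m = s≤s (≤∧≢⇒< (≤-pred z<n) z≢m)

next-inj : ∀ m {y z} → next m y ≡ next m z → y ≡ z
next-inj m {y} {z} eq with y ≟ m | z ≟ m
next-inj m eq | yes y≡m | yes z≡m = trans y≡m (sym z≡m)
next-inj m eq | no  _   | no  _   = suc-injective eq

rotate-model : ∀ {m} {Ind : IndepPred (suc m)} → Model Ind → Model Ind
rotate-model {m} M = record
  { band = rotate-band B ; label = next m ∘ label M ; label< = λ x → next< (label< M x)
  ; label-inj = label-inj M ∘ next-inj m
  ; spec = λ X → mk⇔
      (λ ind → let h , h∈ , s = to (spec M X) ind in
        rotate m (rank B) h , rotate∈ B h∈ , λ x x∈ → forth h∈ (s x x∈) (label< M x))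
      (λ (h , h∈ , s) → from (spec M X) (unrotate m (rank B) h , unrotate∈ B h∈ , λ x x∈ → back h∈ (label< M x) (s x x∈))) }
  where
  B = band M
  forth : ∀ {h z} → h ∈ᵇ B → Step h z → z < suc m → Step (rotate m (rank B) h) (next m z)
  forth {h} {z} h∈ s z<n with z ≟ m
  ... | yes refl = ≤-trans s (≤-reflexive (sym (last≡ (path h∈))))
  ... | no  z≢m  = ≤-trans (≤-reflexive (sym (+-suc _ _))) (+-monoʳ-≤ (rank B) s)
  back : ∀ {h z} → (h∈ : h ∈ᵇ rotate-band B) → z < suc m → Step h (next m z) → Step (unrotate m (rank B) h) z
  back {h} {z} h∈ z<n s with z ≟ m
  ... | yes refl = unrotate-last B h∈ s
  ... | no  z≢m  = unrotate-step B h∈ z (≤∧≢⇒< (≤-pred z<n) z≢m) s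

next-label : ∀ m z {d} → z + suc d ≡ m → next m z + d ≡ m
next-label m z {d} eq with z ≟ m
... | yes refl = contradiction (trans eq (sym (+-identityʳ z))) λ e → 1+n≢0 (+-cancelˡ-≡ z _ _ e)
... | no  _    = trans (sym (+-suc z d)) eq

bring-last : ∀ {m} {Ind : IndepPred (suc m)} (M : Model Ind) x d → label M x + d ≡ m → Σ (Model Ind) λ M′ → label M′ x ≡ m
bring-last M x zero    eq = M , trans (sym (+-identityʳ _)) eq
bring-last {m} M x (suc d) eq = bring-last (rotate-model M) x d (next-label m (label M x) eq)

-- The starting point of the cycle is arbitrary, so deletion and contraction have to be understood
-- only at the last position.
last-model : ∀ {m} {Ind : IndepPred (suc m)} (M : Model Ind) x → Σ (Model Ind) λ M′ → label M′ x ≡ m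
last-model {m} M x = bring-last M x (m ∸ label M x) (m+[n∸m]≡n (≤-pred (label< M x)))

-- Deletion and contraction of one element

insertAt-∈ : ∀ {n} {X : Subset n} x b {y} → y ∈ X → punchIn x y ∈ insertAt X x b
insertAt-∈ {X = X} x b {y} y∈ = lookup⇒[]= _ _ (trans (insertAt-punchIn X x b y) ([]=⇒lookup y∈))

insertAt-∈⁻ : ∀ {n} {X : Subset n} x b {y} → punchIn x y ∈ insertAt X x b → y ∈ X
insertAt-∈⁻ {X = X} x b {y} y∈ = lookup⇒[]= _ _ (trans (sym (insertAt-punchIn X x b y)) ([]=⇒lookup y∈))

∈-inserted : ∀ {n} {X : Subset n} x → x ∈ insertAt X x inside
∈-inserted {X = X} x = lookup⇒[]= _ _ (insertAt-lookup X x inside)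

data PunchView {n} (x : Fin (suc n)) : Fin (suc n) → Set where
  pivot   : PunchView x x
  punched : ∀ y → PunchView x (punchIn x y)

punchView : ∀ {n} (x z : Fin (suc n)) → PunchView x z
punchView x z with x Fin.≟ z
... | yes refl = pivot
... | no  x≢z  = subst (PunchView x) (Fin.punchIn-punchOut x≢z) (punched _)

module _ {m} {Ind : IndepPred (suc m)} (M : Model Ind) (x : Fin (suc m)) (x-last : label M x ≡ m) where
  private
    B = band M
    ℓ : Fin m → ℕ
    ℓ = label M ∘ punchIn x
    ℓ< : ∀ y → ℓ y < m
    ℓ< y = ≤∧≢⇒< (≤-pred (label< M _)) λ eq → Fin.punchInᵢ≢i x y (label-inj M (trans eq (sym x-last)))

  drop-model : ∀ b (B′ : Band m) →
    (∀ {X} → Ind (insertAt X x b) → Spanned B′ ℓ X) →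
    (∀ {X} → Spanned B′ ℓ X → Ind (insertAt X x b)) →
    Model (λ X → Ind (insertAt X x b))
  drop-model b B′ f g = record
    { band = B′ ; label = ℓ ; label< = ℓ<
    ; label-inj = Fin.punchIn-injective x _ _ ∘ label-inj M
    ; spec = λ X → mk⇔ f g }

  span-inserted : ∀ {X h} b → h ∈ᵇ B → (∀ y → y ∈ X → Step h (ℓ y)) → (b ≡ inside → Step h m) → Ind (insertAt X x b)
  span-inserted {X} {h} b h∈ s last = from (spec M _) (h , h∈ , λ z → steps z (punchView x z))
    where
    steps : ∀ z → PunchView x z → z ∈ insertAt X x b → Step h (label M z)
    steps z pivot       z∈ rewrite x-last = last (trans (sym (insertAt-lookup X x b)) ([]=⇒lookup z∈))
    steps z (punched y) z∈ = s y (insertAt-∈⁻ x b z∈)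

  module _ (1≤r : 1 ≤ rank B) (free : low B m < high B (suc m)) where
    open LastStep B 1≤r free renaming (band to B₁)

    stepping-model : ∀ b → (∀ {X} → Ind (insertAt X x b) → ∃ λ h → h ∈ᵇ B × Step h m × (∀ y → y ∈ X → Step h (ℓ y))) →
                     Model (λ X → Ind (insertAt X x b))
    stepping-model b choose = drop-model b B₁
      (λ ind → let h , h∈ , last , s = choose ind in h , restrict∈ h∈ last , s)
      (λ (h , h∈ , s) → span-inserted b (extend∈ h∈) (λ y y∈ → override-step {h = h} (ℓ< y) (s y y∈)) λ _ → extend-step {h})

  -- Either every path can be traded for one that is flat at the last position, or every path steps
  -- there: because the rank is `suc m`, or because the upper path at `m` is still below the end of
  -- the lower one. In the latter cases `x` is a coloop, and deletion agrees with contraction.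
  drop-deleted : Model (λ X → Ind (insertAt X x outside))
  drop-deleted with rank B ≤? m | low B (suc m) ≤? high B m
  ... | yes r≤m | yes free = drop-model outside B₀
      (λ ind → let h , h∈ , s = to (spec M _) ind
                   g , g∈ , flat , keep = avoid h∈
               in g , restrict∈ g∈ flat , λ y y∈ → keep _ (ℓ< y) (s _ (insertAt-∈ x outside y∈)))
      (λ (h , h∈ , s) → span-inserted outside (extend∈ h∈) (λ y y∈ → override-step {h = h} (ℓ< y) (s y y∈)) λ ())
    where open NoLastStep B r≤m free renaming (band to B₀)
  ... | yes r≤m | no tight = stepping-model 1≤r free outside
      (λ ind → let h , h∈ , s = to (spec M _) ind in
        h , h∈ , ≤-trans (s≤s (below h∈ m (n≤1+n m))) (≤-trans (≰⇒> tight) (above h∈ _ ≤-refl)) , λ y y∈ → s _ (insertAt-∈ x outside y∈))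
    where
    p-step : low B m < low B (suc m)
    p-step = ≤-<-trans (low≤high B m (n≤1+n m)) (≰⇒> tight)
    free : low B m < high B (suc m)
    free = ≤-trans p-step (low≤high B _ ≤-refl)
    1≤r : 1 ≤ rank B
    1≤r = lin 4 (λ pN pm p0 r → 𝕤 pm ≼ pN ⊢ p0 ≼ pm ⊢ pN ≐ p0 ⊹ r ⊢ ∎ # 1 ≼ r) _ _ _ _
      p-step (mono (low-path B) z≤n (n≤1+n m)) (turn (low-path B))
  ... | no r≰m  | _ = stepping-model (≤-trans (s≤s z≤n) (≰⇒> r≰m)) (≤-trans (always (low∈ B)) (low≤high B _ ≤-refl)) outside
      (λ ind → let h , h∈ , s = to (spec M _) ind in h , h∈ , always h∈ , λ y y∈ → s _ (insertAt-∈ x outside y∈))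
    where
    always : ∀ {h} → h ∈ᵇ B → Step h m
    always {h} h∈ = lin 5 (λ hN hm h0 r m → hN ≐ h0 ⊹ r ⊢ hm ⊹ # 0 ≼ h0 ⊹ m ⊢ 𝕤 m ≼ r ⊢ ∎ 𝕤 hm ≼ hN) (h (suc m)) (h m) (h 0) (rank B) m
      (turn (path h∈)) (lipschitz (path h∈) z≤n (n≤1+n m)) (≰⇒> r≰m)

  last-step : ∀ {X} h → (∀ y → y ∈ insertAt X x inside → Step h (label M y)) → Step h m
  last-step {X} h s = subst (Step h) x-last (s x (∈-inserted x))

  -- One independent set containing `x` provides a path that steps at `m`, and with it both
  -- conditions under which `LastStep` applies.
  needs : ∀ {X₀} → Ind (insertAt X₀ x inside) → 1 ≤ rank B × low B m < high B (suc m)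
  needs ind with to (spec M _) ind
  ... | h , h∈ , s =
      lin 4 (λ hN hm h0 r → 𝕤 hm ≼ hN ⊢ h0 ≼ hm ⊢ hN ≐ h0 ⊹ r ⊢ ∎ # 1 ≼ r) _ _ _ _
        (last-step h s) (mono (path h∈) z≤n (n≤1+n m)) (turn (path h∈))
    , ≤-trans (s≤s (above h∈ m (n≤1+n m))) (≤-trans (last-step h s) (below h∈ _ ≤-refl))

  drop-contracted : ∀ {X₀} → Ind (insertAt X₀ x inside) → Model (λ X → Ind (insertAt X x inside))
  drop-contracted ind₀ = stepping-model (proj₁ (needs ind₀)) (proj₂ (needs ind₀)) inside
    (λ ind → let h , h∈ , s = to (spec M _) ind in h , h∈ , last-step h s , λ y y∈ → s _ (insertAt-∈ x inside y∈))

module _ {m} {Ind : IndepPred (suc m)} (M : Model Ind) (x : Fin (suc m)) where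
  delete : Model (λ X → Ind (insertAt X x outside))
  delete = let M′ , eq = last-model M x in drop-deleted M′ x eq

  contract : ∀ {X₀} → Ind (insertAt X₀ x inside) → Model (λ X → Ind (insertAt X x inside))
  contract = let M′ , eq = last-model M x in drop-contracted M′ x eq

-- Step sets as bases, and duality

Dominates : ℕ → (ℕ → ℕ) → (ℕ → ℕ) → Set
Dominates n h g = ∀ t → t < n → Step g t → Step h t

-- The difference of `h` and `g` never decreases, because wherever `g` rises, by at most one, `h`
-- rises too.
gap-≤ : ∀ {n r r′ g h} → Path n r g → Path n r′ h → Dominates n h g →
        ∀ {s t} → s ≤ t → t ≤ n → g t + h s ≤ h t + g s
gap-≤ {g = g} {h} G H dom {s} {zero} z≤n _ = ≤-reflexive (+-comm (g 0) (h 0))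
gap-≤ {g = g} {h} G H dom {s} {suc t} s≤t t<n with m≤n⇒m<n∨m≡n s≤t
... | inj₂ refl = ≤-reflexive (+-comm (g (suc t)) (h (suc t)))
... | inj₁ (s≤s s≤t′) with Step? g t
...   | yes st = lin 6 (λ gt gt′ hs ht ht′ gs → gt ⊹ hs ≼ ht ⊹ gs ⊢ gt′ ≼ 𝕤 gt ⊢ 𝕤 ht ≼ ht′ ⊢ ∎ gt′ ⊹ hs ≼ ht′ ⊹ gs)
                 (g t) (g (suc t)) (h s) (h t) (h (suc t)) (g s)
                 (gap-≤ G H dom s≤t′ (<⇒≤ t<n)) (lip G t t<n) (dom t t<n st)
...   | no ¬st = lin 6 (λ gt gt′ hs ht ht′ gs → gt ⊹ hs ≼ ht ⊹ gs ⊢ gt′ ≼ gt ⊢ ht ≼ ht′ ⊢ ∎ gt′ ⊹ hs ≼ ht′ ⊹ gs)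
                 (g t) (g (suc t)) (h s) (h t) (h (suc t)) (g s)
                 (gap-≤ G H dom s≤t′ (<⇒≤ t<n)) (≮⇒≥ ¬st) (up H t t<n)

-- Both paths gain `r` in a turn, so a step of `h` where `g` is flat would make the total gain of
-- `h` too large.
same-steps : ∀ {n r g h} → Path n r g → Path n r h → Dominates n h g → Dominates n g h
same-steps {n} {r} {g} {h} G H dom t t<n st with Step? g t
... | yes st′ = st′
... | no ¬st  = contradiction
  (lin 9 (λ g0 gt gt′ gn h0 ht ht′ hn r →
      gt ⊹ h0 ≼ ht ⊹ g0 ⊢ gn ⊹ ht′ ≼ hn ⊹ gt′ ⊢ gt′ ≼ gt ⊢ 𝕤 ht ≼ ht′ ⊢ gn ≐ g0 ⊹ r ⊢ hn ≐ h0 ⊹ r ⊢ ∎ # 1 ≼ # 0)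
    (g 0) (g t) (g (suc t)) (g n) (h 0) (h t) (h (suc t)) (h n) r
    (gap-≤ G H dom z≤n (<⇒≤ t<n)) (gap-≤ G H dom t<n ≤-refl) (≮⇒≥ ¬st) st (turn G) (turn H))
  λ ()

module _ {n} {Ind : IndepPred n} (M : Model Ind) where
  private
    B = band M

  steps : (ℕ → ℕ) → Subset n
  steps h = ⟪ (λ x → Step? h (label M x)) ⟫

  steps⁺ : ∀ h {x} → Step h (label M x) → x ∈ steps h
  steps⁺ h = ∈⟪⟫⁺ (λ x → Step? h (label M x))

  steps⁻ : ∀ h {x} → x ∈ steps h → Step h (label M x)
  steps⁻ h = ∈⟪⟫⁻ (λ x → Step? h (label M x))

  steps-basis : ∀ {h} → h ∈ᵇ B → IsBasis Ind (steps h)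
  steps-basis {h} h∈ = from (spec M _) (h , h∈ , λ x → steps⁻ h) , maximal
    where
    maximal : ∀ Y → Ind Y → steps h ⊆ Y → Y ⊆ steps h
    maximal Y indY h⊆Y {y} y∈ with to (spec M Y) indY
    ... | g , g∈ , s = steps⁺ h (same-steps (path h∈) (path g∈) dom (label M y) (label< M y) (s y y∈))
      where
      dom : Dominates n g h
      dom t t<n st with labelled M t<n
      ... | x , refl = s x (h⊆Y (steps⁺ h st))

  -- Bases are the step sets of paths in the band: a basis lies in the step set of a path spanning
  -- it, and its maximality gives equality. Avoiding a basis is thus being flat along a path.
  dual⇔ : ∀ X → dual Ind X ⇔ (∃ λ h → h ∈ᵇ B × (∀ x → x ∈ X → ¬ Step h (label M x)))
  dual⇔ X = mk⇔ forth (λ (h , h∈ , s) → steps h , steps-basis h∈ , λ x x∈ x∈h → s x x∈ (steps⁻ h x∈h))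
    where
    forth : dual Ind X → _
    forth (A , (indA , max) , disj) with to (spec M A) indA
    ... | h , h∈ , s = h , h∈ , λ x x∈ st →
      disj x x∈ (max (steps h) (proj₁ (steps-basis h∈)) (λ {y} y∈ → steps⁺ h (s y y∈)) (steps⁺ h st))

-- The path of the complementary set, shifted up by c to stay non-negative.
complement : ℕ → (ℕ → ℕ) → ℕ → ℕ
complement c h t = (c + t) ∸ h t

module _ {n r c h} (H : Path n r h) (h0≤c : h 0 ≤ c) where
  complement≡ : ∀ t → t ≤ n → complement c h t + h t ≡ c + t
  complement≡ t t≤n = m∸n+n≡m
    (lin 4 (λ ht h0 c t → ht ⊹ # 0 ≼ h0 ⊹ t ⊢ h0 ≼ c ⊢ ∎ ht ≼ c ⊹ t) (h t) (h 0) c t (lipschitz H z≤n t≤n) h0≤c)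

  complement-path : Path n (n ∸ r) (complement c h)
  complement-path = record
    { up   = λ t l → lin 6 (λ k k′ h h′ c t → k ⊹ h ≐ c ⊹ t ⊢ k′ ⊹ h′ ≐ c ⊹ 𝕤 t ⊢ h′ ≼ 𝕤 h ⊢ ∎ k ≼ k′)
        _ _ (h t) (h (suc t)) c t (complement≡ t (<⇒≤ l)) (complement≡ (suc t) l) (lip H t l)
    ; lip  = λ t l → lin 6 (λ k k′ h h′ c t → k ⊹ h ≐ c ⊹ t ⊢ k′ ⊹ h′ ≐ c ⊹ 𝕤 t ⊢ h ≼ h′ ⊢ ∎ k′ ≼ 𝕤 k)
        _ _ (h t) (h (suc t)) c t (complement≡ t (<⇒≤ l)) (complement≡ (suc t) l) (up H t l)
    ; turn = lin 8 (λ k k′ h h′ c n r s → k ⊹ h ≐ c ⊹ # 0 ⊢ k′ ⊹ h′ ≐ c ⊹ n ⊢ h′ ≐ h ⊹ r ⊢ s ⊹ r ≐ n ⊢ ∎ k′ ≐ k ⊹ s)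
        _ _ (h 0) (h n) c n r (n ∸ r) (complement≡ 0 z≤n) (complement≡ n ≤-refl) (turn H) (m∸n+n≡m (r≤n H)) }

  complement-step : ∀ t → t < n → ¬ Step h t → Step (complement c h) t
  complement-step t l ¬s = lin 6 (λ k k′ h h′ c t → k ⊹ h ≐ c ⊹ t ⊢ k′ ⊹ h′ ≐ c ⊹ 𝕤 t ⊢ h′ ≼ h ⊢ ∎ 𝕤 k ≼ k′)
        _ _ (h t) (h (suc t)) c t (complement≡ t (<⇒≤ l)) (complement≡ (suc t) l) (≮⇒≥ ¬s)

  complement-step⁻ : ∀ t → t < n → Step h t → ¬ Step (complement c h) t
  complement-step⁻ t l s s′ = contradiction
    (lin 6 (λ k k′ h h′ c t → k ⊹ h ≐ c ⊹ t ⊢ k′ ⊹ h′ ≐ c ⊹ 𝕤 t ⊢ 𝕤 h ≼ h′ ⊢ 𝕤 k ≼ k′ ⊢ ∎ # 1 ≼ # 0)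
        _ _ (h t) (h (suc t)) c t (complement≡ t (<⇒≤ l)) (complement≡ (suc t) l) s s′) λ ()

complement-≤ : ∀ {n c g h} → g ≤[ n ] h → complement c h ≤[ n ] complement c g
complement-≤ {c = c} g≤h t t≤n = ∸-monoʳ-≤ (c + t) (g≤h t t≤n)

module _ {n} (B : Band n) where
  private
    c = high B 0
    start : ∀ {h} → h ≤[ n ] high B → h 0 ≤ c
    start h≤ = h≤ 0 z≤n

  dual-band : Band n
  dual-band = record
    { rank = n ∸ rank B ; low = complement c (high B) ; high = complement c (low B)
    ; low-path = complement-path (high-path B) ≤-refl
    ; high-path = complement-path (low-path B) (start (low≤high B))
    ; low≤high = complement-≤ {h = high B} (low≤high B) }

  complement∈ : ∀ {h} → h ∈ᵇ B → complement c h ∈ᵇ dual-band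
  complement∈ {h} h∈ = record
    { path = complement-path (path h∈) (start (below h∈))
    ; above = complement-≤ {h = high B} (below h∈) ; below = complement-≤ {h = h} (above h∈) }

  module _ {h} (h∈ : h ∈ᵇ dual-band) where
    private
      h0≤c : h 0 ≤ c
      h0≤c = ≤-trans (below h∈ 0 z≤n) (≤-trans (m∸n≤m _ (low B 0)) (≤-reflexive (+-identityʳ c)))

    dual-start : h 0 ≤ c
    dual-start = h0≤c

    -- The same `c` undoes complementation, since paths of the dual band also start at height at
    -- most `c`.
    complement∈⁻ : complement c h ∈ᵇ B
    complement∈⁻ = record
      { path  = subst (λ s → Path n s (complement c h)) (m∸[m∸n]≡n (r≤n (low-path B))) (complement-path (path h∈) h0≤c)
      ; above = λ t l → lin 5 (λ k h c t p → k ⊹ h ≐ c ⊹ t ⊢ h ⊹ p ≼ c ⊹ t ⊢ ∎ p ≼ k) _ (h t) c t (low B t)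
          (complement≡ (path h∈) h0≤c t l)
          (≤-trans (+-monoˡ-≤ (low B t) (below h∈ t l)) (≤-reflexive (complement≡ (low-path B) (start (low≤high B)) t l)))
      ; below = λ t l → lin 5 (λ k h c t q → k ⊹ h ≐ c ⊹ t ⊢ c ⊹ t ≼ h ⊹ q ⊢ ∎ k ≼ q) _ (h t) c t (high B t)
          (complement≡ (path h∈) h0≤c t l)
          (≤-trans (≤-reflexive (sym (complement≡ (high-path B) ≤-refl t l))) (+-monoˡ-≤ (high B t) (above h∈ t l))) }

dual-model : ∀ {n} {Ind : IndepPred n} → Model Ind → Model (dual Ind)
dual-model {n} M = record
  { band = dual-band B ; label = label M ; label< = label< M ; label-inj = label-inj M
  ; spec = λ X → mk⇔
      (λ ind → let h , h∈ , s = to (dual⇔ M X) ind in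
        complement c h , complement∈ B h∈ ,
        λ x x∈ → complement-step (path h∈) (below h∈ 0 z≤n) _ (label< M x) (s x x∈))
      (λ (h , h∈ , s) → from (dual⇔ M X) (complement c h , complement∈⁻ B h∈ ,
        λ x x∈ → complement-step⁻ (path h∈) (dual-start B h∈) _ (label< M x) (s x x∈))) }
  where
  B = band M
  c = high B 0

-- Decidability of independence

module _ {n} {Ind : IndepPred n} (M : Model Ind) where
  ⊆-indep : ∀ {X Y} → X ⊆ Y → Ind Y → Ind X
  ⊆-indep X⊆Y indY = let h , h∈ , s = to (spec M _) indY in from (spec M _) (h , h∈ , λ x x∈ → s x (X⊆Y x∈))

  ∅-indep : Ind ⊥
  ∅-indep = from (spec M _) (low (band M) , low∈ (band M) , λ x x∈ → contradiction x∈ ∉⊥)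

insertAt-⊆ : ∀ {n} {X : Subset n} {Y : Subset (suc n)} x b →
             (∀ {y} → y ∈ X → punchIn x y ∈ Y) → (b ≡ inside → x ∈ Y) → insertAt X x b ⊆ Y
insertAt-⊆ {X = X} x b f g {z} z∈ with punchView x z
... | pivot     = g (trans (sym (insertAt-lookup X x b)) ([]=⇒lookup z∈))
... | punched y = f (insertAt-∈⁻ x b z∈)

module _ {m} {Ind : IndepPred (suc m)} (M : Model Ind) where
  singleton? : ∀ x → Dec (Ind (insertAt ⊥ x inside))
  singleton? x with last-model M x
  ... | M′ , x-last with 1 ≤? rank (band M′) | suc (low (band M′) m) ≤? high (band M′) (suc m)
  ...   | yes 1≤r | yes free = yes (span-inserted M′ x x-last inside
            (extend∈ (low∈ B₁)) (λ y y∈ → contradiction y∈ ∉⊥) λ _ → extend-step {low B₁})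
    where open LastStep (band M′) 1≤r free renaming (band to B₁)
  ...   | yes 1≤r | no tight = no λ ind → tight (proj₂ (needs M′ x x-last ind))
  ...   | no r<1  | _        = no λ ind → r<1 (proj₁ (needs M′ x x-last ind))

-- There are infinitely many functions to try as paths, so independence is decided element by
-- element: one outside the set is deleted, one inside is contracted unless it is a loop.
indep? : ∀ {n} {Ind : IndepPred n} → Model Ind → ∀ X → Dec (Ind X)
indep? M []            = yes (∅-indep M)
indep? M (outside ∷ X) = indep? (delete M zero) X
indep? M (inside ∷ X) with singleton? M zero
... | yes ind = indep? (contract M zero ind) X
... | no ¬ind = no λ ind → ¬ind (⊆-indep M (insertAt-⊆ zero inside (λ y∈ → contradiction y∈ ∉⊥) λ _ → ∈-inserted zero) ind)

⊆∧∣≥∣⇒⊇ : ∀ {n} {X Y : Subset n} → X ⊆ Y → ∣ Y ∣ ≤ ∣ X ∣ → Y ⊆ X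
⊆∧∣≥∣⇒⊇ {X = X} X⊆Y ∣Y∣≤∣X∣ {y} y∈Y with y ∈? X
... | yes y∈X = y∈X
... | no  y∉X = contradiction (p⊂q⇒∣p∣<∣q∣ (X⊆Y , y , y∈Y , y∉X)) (≤⇒≯ ∣Y∣≤∣X∣)

∣∣-split : ∀ {n} (X C : Subset n) → ∣ X ∣ ≡ ∣ X ∩ C ∣ + ∣ X ∩ ∁ C ∣
∣∣-split []            []            = refl
∣∣-split (outside ∷ X) (c ∷ C)       = ∣∣-split X C
∣∣-split (inside ∷ X)  (outside ∷ C) = trans (cong suc (∣∣-split X C)) (sym (+-suc _ _))
∣∣-split (inside ∷ X)  (inside ∷ C)  = cong suc (∣∣-split X C)

injection⇒∣∣≤ : ∀ {m n} (Y : Subset m) (X : Subset n) (f : ∀ y → y ∈ Y → Fin n) →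
                (∀ y y∈ → f y y∈ ∈ X) → (∀ y z y∈ z∈ → f y y∈ ≡ f z z∈ → y ≡ z) → ∣ Y ∣ ≤ ∣ X ∣
injection⇒∣∣≤ []            X f f∈ inj = z≤n
injection⇒∣∣≤ (outside ∷ Y) X f f∈ inj =
  injection⇒∣∣≤ Y X (λ y y∈ → f (suc y) (there y∈)) (λ y y∈ → f∈ _ _) λ y z y∈ z∈ eq → Fin.suc-injective (inj _ _ _ _ eq)
injection⇒∣∣≤ (inside ∷ Y)  X f f∈ inj = ≤-trans
  (s≤s (injection⇒∣∣≤ Y (X - f zero here) (λ y y∈ → f (suc y) (there y∈))
    (λ y y∈ → x∈p∧x≢y⇒x∈p-y (f∈ _ _) λ eq → Fin.0≢1+n (sym (inj _ _ _ _ eq)))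
    λ y z y∈ z∈ eq → Fin.suc-injective (inj _ _ _ _ eq)))
  (x∈p⇒∣p-x∣<∣p∣ (f∈ zero here))

-- Augmentation in transversal matroids

_[_↦_] : ∀ {n k} → (Fin n → Fin k) → Fin n → Fin k → Fin n → Fin k
(f [ y ↦ v ]) x with x Fin.≟ y
... | yes _ = v
... | no  _ = f x

record Matching {n k} (A : SetSystem n k) (I : Subset n) (f : Fin n → Fin k) : Set where
  field
    injective : ∀ {x y} → x ∈ I → y ∈ I → f x ≡ f y → x ≡ y
    matched   : ∀ {x} → x ∈ I → A (f x) x

open Matching

module _ {n k} {A : SetSystem n k} where
  transversal : ∀ {I f} → Matching A I f → M[ A ] I
  transversal {I} {f} m = (λ x _ → f x) , (λ x y x∈ y∈ → injective m x∈ y∈) , λ x x∈ → matched m x∈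

  -- A total function, unlike one depending on membership proofs, can be updated at a point; its
  -- values outside `I` are arbitrary.
  matching : Fin k → ∀ {I} → M[ A ] I → ∃ (Matching A I)
  matching default {I} (f , inj , mem) = total , record { injective = inj′ ; matched = mem′ }
    where
    total : Fin n → Fin k
    total x with x ∈? I
    ... | yes x∈ = f x x∈
    ... | no  _  = default
    inj′ : ∀ {x y} → x ∈ I → y ∈ I → total x ≡ total y → x ≡ y
    inj′ {x} {y} x∈ y∈ eq with x ∈? I | y ∈? I
    ... | yes p | yes q = inj x y p q eq
    ... | no ¬p | _     = contradiction x∈ ¬p
    ... | yes _ | no ¬q = contradiction y∈ ¬q
    mem′ : ∀ {x} → x ∈ I → A (total x) x
    mem′ {x} x∈ with x ∈? I
    ... | yes p = mem x p
    ... | no ¬p = contradiction x∈ ¬p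

  -- Serves both moves of augmentation: `I′` is `I ∪ ⁅ y ⁆` when `y` is added, and `I` itself when
  -- `y` only changes its partner.
  rematch : ∀ {I I′ f} y v → Matching A I f → (∀ {x} → x ∈ I′ → x ≢ y → x ∈ I) →
            (∀ x → x ∈ I → f x ≢ v) → A v y → Matching A I′ (f [ y ↦ v ])
  rematch {I} {I′} {f} y v m old fresh vy = record { injective = inj ; matched = mem }
    where
    inj : ∀ {x z} → x ∈ I′ → z ∈ I′ → (f [ y ↦ v ]) x ≡ (f [ y ↦ v ]) z → x ≡ z
    inj {x} {z} x∈ z∈ eq with x Fin.≟ y | z Fin.≟ y
    ... | yes x≡y | yes z≡y = trans x≡y (sym z≡y)
    ... | yes _   | no z≢y  = contradiction (sym eq) (fresh z (old z∈ z≢y))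
    ... | no x≢y  | yes _   = contradiction eq (fresh x (old x∈ x≢y))
    ... | no x≢y  | no z≢y  = injective m (old x∈ x≢y) (old z∈ z≢y) eq
    mem : ∀ {x} → x ∈ I′ → A ((f [ y ↦ v ]) x) x
    mem {x} x∈ with x Fin.≟ y
    ... | yes refl = vy
    ... | no x≢y   = matched m (old x∈ x≢y)

  module _ {I J : Subset n} (∣I∣<∣J∣ : ∣ I ∣ < ∣ J ∣) {g} (mJ : Matching A J g) where
    Augmented : Set
    Augmented = ∃ λ y → y ∈ J × y ∉ I × M[ A ] (I ∪ ⁅ y ⁆)

    fresh : ∀ {f} → Matching A I f → ∃ λ y → y ∈ J × (∀ x → x ∈ I → f x ≢ g y)
    fresh {f} mI with Fin.any? (λ y → (y ∈? J) ×-dec Fin.all? (λ x → (x ∈? I) →-dec ¬? (f x Fin.≟ g y)))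
    ... | yes found = found
    ... | no none = contradiction
            (injection⇒∣∣≤ J I (λ y y∈ → proj₁ (hit y y∈)) (λ y y∈ → proj₁ (proj₂ (hit y y∈)))
              λ y z y∈ z∈ eq → injective mJ y∈ z∈
                (trans (sym (proj₂ (proj₂ (hit y y∈)))) (trans (cong f eq) (proj₂ (proj₂ (hit z z∈))))))
            (<⇒≱ ∣I∣<∣J∣)
      where
      hit : ∀ y → y ∈ J → ∃ λ x → x ∈ I × f x ≡ g y
      hit y y∈ with Fin.any? (λ x → (x ∈? I) ×-dec (f x Fin.≟ g y))
      ... | yes found = found
      ... | no none′ = contradiction (y , y∈ , λ x x∈ eq → none′ (x , x∈ , eq)) none

    -- Giving an element of I the partner it has in J makes the two
    -- matchings agree in one more place.
    augment-matching : ∀ d {f} → Matching A I f → ∣ ⟪ (λ x → ¬? (f x Fin.≟ g x)) ⟫ ∣ ≤ d → Augmented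
    augment-matching d {f} mI ≤d with fresh mI
    ... | y , y∈J , new with y ∈? I
    ...   | no y∉I = y , y∈J , y∉I , transversal (rematch y (g y) mI old new (matched mJ y∈J))
      where
      old : ∀ {x} → x ∈ I ∪ ⁅ y ⁆ → x ≢ y → x ∈ I
      old x∈ x≢y with x∈p∪q⁻ I ⁅ y ⁆ x∈
      ... | inj₁ x∈I = x∈I
      ... | inj₂ x∈y = contradiction (x∈⁅y⁆⇒x≡y y x∈y) x≢y
    augment-matching d {f} mI ≤d | y , y∈J , new | yes y∈I =
      go d (<-≤-trans (p⊂q⇒∣p∣<∣q∣ (sub , y , ∈⟪⟫⁺ D? (new y y∈I) , y∉)) ≤d)
      where
      f′ = f [ y ↦ g y ]
      D? : ∀ x → Dec (f x ≢ g x)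
      D? x = ¬? (f x Fin.≟ g x)
      D′? : ∀ x → Dec (f′ x ≢ g x)
      D′? x = ¬? (f′ x Fin.≟ g x)
      moved : ∀ {x} → f′ x ≢ g x → f x ≢ g x
      moved {x} f′x≢ with x Fin.≟ y
      ... | yes refl = contradiction refl f′x≢
      ... | no  _    = f′x≢
      sub : ⟪ D′? ⟫ ⊆ ⟪ D? ⟫
      sub x∈ = ∈⟪⟫⁺ D? (moved (∈⟪⟫⁻ D′? x∈))
      y∉ : y ∉ ⟪ D′? ⟫
      y∉ y∈ = ∈⟪⟫⁻ D′? y∈ f′y
        where
        f′y : f′ y ≡ g y
        f′y with y Fin.≟ y
        ... | yes _  = refl
        ... | no y≢y = contradiction refl y≢y
      go : ∀ d → ∣ ⟪ D′? ⟫ ∣ < d → Augmented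
      go (suc d) (s≤s ≤d) = augment-matching d (rematch y (g y) mI (λ x∈ _ → x∈) new (matched mJ y∈J)) ≤d

  augment : ∀ {I J} → M[ A ] I → M[ A ] J → ∣ I ∣ < ∣ J ∣ → ∃ λ y → y ∈ J × y ∉ I × M[ A ] (I ∪ ⁅ y ⁆)
  augment {I} {J} tI tJ ∣I∣<∣J∣ with nonempty? J
  -- Any index serves as default value of the two matchings; the nonempty `J` provides one.
  ... | yes (y , y∈) = augment-matching ∣I∣<∣J∣ (proj₂ (matching v tJ)) _ (proj₂ (matching v tI)) ≤-refl
    where v = proj₁ tJ y y∈
  ... | no empty with refl ← Empty-unique empty = contradiction ∣I∣<∣J∣ (≤⇒≯ (≤-trans (≤-reflexive (∣⊥∣≡0 n)) z≤n))

IsBasisOf : ∀ {n} → IndepPred n → Subset n → Subset n → Set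
IsBasisOf Ind C B = B ⊆ C × Ind B × (∀ Y → Y ⊆ C → Ind Y → B ⊆ Y → Y ⊆ B)

module _ {n} {Ind : IndepPred n} (M : Model Ind) (C : Subset n) where
  -- `B` is replaced by any larger independent subset of `C`, which need not contain it: one of
  -- largest size is also maximal for inclusion. The fuel `d` counts the elements still missing from
  -- the size `n`.
  grow-basis : ∀ d B → B ⊆ C → Ind B → n ≤ ∣ B ∣ + d → ∃ (IsBasisOf Ind C)
  grow-basis d B B⊆C indB n≤ with anySubset? (λ Y → (Y ⊆? C) ×-dec (indep? M Y ×-dec (suc ∣ B ∣ ≤? ∣ Y ∣)))
  ... | no none = B , B⊆C , indB , λ Y Y⊆C indY B⊆Y →
          ⊆∧∣≥∣⇒⊇ B⊆Y (≮⇒≥ λ B<Y → none (Y , Y⊆C , indY , B<Y))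
  grow-basis zero B B⊆C indB n≤ | yes (Y , Y⊆C , indY , B<Y) = contradiction (∣p∣≤n Y) (<⇒≱ (≤-<-trans n≤ (≤-<-trans (≤-reflexive (+-identityʳ _)) B<Y)))
  grow-basis (suc d) B B⊆C indB n≤ | yes (Y , Y⊆C , indY , B<Y) =
    grow-basis d Y Y⊆C indY (≤-trans n≤ (≤-trans (≤-reflexive (+-suc _ d)) (+-monoˡ-≤ d B<Y)))

  basis-of : ∃ (IsBasisOf Ind C)
  basis-of = grow-basis n ⊥ (λ x∈ → contradiction x∈ ∉⊥) (∅-indep M) (m≤n+m n _)

∪⁅⁆-⊆ : ∀ {n} {X Y : Subset n} {y} → X ⊆ Y → y ∈ Y → X ∪ ⁅ y ⁆ ⊆ Y
∪⁅⁆-⊆ {X = X} {y = y} X⊆Y y∈Y z∈ with x∈p∪q⁻ X ⁅ y ⁆ z∈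
... | inj₁ z∈X = X⊆Y z∈X
... | inj₂ z∈y with refl ← x∈⁅y⁆⇒x≡y y z∈y = y∈Y

module _ {n} {Ind : IndepPred n} (M : Model Ind)
         {k} {A : SetSystem n k} (present : ∀ X → Ind X ⇔ M[ A ] X) where

  augment-indep : ∀ {I J} → Ind I → Ind J → ∣ I ∣ < ∣ J ∣ → ∃ λ y → y ∈ J × y ∉ I × Ind (I ∪ ⁅ y ⁆)
  augment-indep indI indJ I<J =
    let y , y∈ , y∉ , ind = augment {A = A} (to (present _) indI) (to (present _) indJ) I<J in y , y∈ , y∉ , from (present _) ind

  module _ {C B : Subset n} (basis : IsBasisOf Ind C B) where
    private
      B⊆C = proj₁ basis
      indB = proj₁ (proj₂ basis)
      max = proj₂ (proj₂ basis)

    no-augment : ∀ {y} → y ∈ C → y ∉ B → ¬ Ind (B ∪ ⁅ y ⁆)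
    no-augment {y} y∈C y∉B ind = y∉B (max (B ∪ ⁅ y ⁆) (∪⁅⁆-⊆ B⊆C y∈C) ind (p⊆p∪q ⁅ y ⁆) (x∈p∪q⁺ (inj₂ (x∈⁅x⁆ y))))

    basis-largest : ∀ {Y} → Y ⊆ C → Ind Y → ∣ Y ∣ ≤ ∣ B ∣
    basis-largest Y⊆C indY = ≮⇒≥ λ B<Y →
      let y , y∈ , y∉ , ind = augment-indep indB indY B<Y in no-augment (Y⊆C y∈) y∉ ind

  -- Augmenting B′ from Z never picks up an element of C, so it ends with
  -- the whole of Z outside C.
  module _ {C B B′ : Subset n} (basis : IsBasisOf Ind C B) (basis′ : IsBasisOf Ind C B′)
           {Z : Subset n} (indZ : Ind Z) (Z∩C⊆B : ∀ {z} → z ∈ Z → z ∈ C → z ∈ B) (B⊆Z : B ⊆ Z) where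

    exchange-from : ∀ d I → B′ ⊆ I → Ind I → (∀ {y} → y ∈ I → y ∈ C → y ∈ B′) → (∀ {y} → y ∈ I → y ∉ C → y ∈ Z) →
                    ∣ Z ∣ ≤ ∣ I ∣ + d → ∃ λ I → Ind I × B′ ⊆ I × (∀ {y} → y ∈ Z → y ∉ C → y ∈ I)
    exchange-from d I B′⊆I indI inC outC ≤d with ∣ Z ∣ ≤? ∣ I ∣
    ... | yes Z≤I = I , indI , B′⊆I , λ y∈ y∉ → proj₁ (x∈p∩q⁻ I (∁ C) (all (x∈p∩q⁺ (y∈ , x∉p⇒x∈∁p y∉))))
      where
      I∩C≤ : ∣ I ∩ C ∣ ≤ ∣ B ∣
      I∩C≤ = ≤-trans (p⊆q⇒∣p∣≤∣q∣ (λ x∈ → let x∈I , x∈C = x∈p∩q⁻ I C x∈ in inC x∈I x∈C))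
                     (basis-largest basis (proj₁ basis′) (proj₁ (proj₂ basis′)))
      sub : I ∩ ∁ C ⊆ Z ∩ ∁ C
      sub x∈ = let x∈I , x∈∁ = x∈p∩q⁻ I (∁ C) x∈ in x∈p∩q⁺ (outC x∈I (x∈∁p⇒x∉p x∈∁) , x∈∁)
      all : Z ∩ ∁ C ⊆ I ∩ ∁ C
      all = ⊆∧∣≥∣⇒⊇ sub
        (lin 7 (λ z i zc ic zo io b → z ≐ zc ⊹ zo ⊢ i ≐ ic ⊹ io ⊢ z ≼ i ⊢ ic ≼ b ⊢ b ≼ zc ⊢ ∎ zo ≼ io)
          (∣ Z ∣) (∣ I ∣) (∣ Z ∩ C ∣) (∣ I ∩ C ∣) (∣ Z ∩ ∁ C ∣) (∣ I ∩ ∁ C ∣) (∣ B ∣)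
          (∣∣-split Z C) (∣∣-split I C) Z≤I I∩C≤ (p⊆q⇒∣p∣≤∣q∣ (λ x∈ → x∈p∩q⁺ (B⊆Z x∈ , proj₁ basis x∈))))
    ... | no Z≰I with augment-indep indI indZ (≰⇒> Z≰I)
    ...   | y , y∈Z , y∉I , ind with y ∈? C
    ...     | yes y∈C = contradiction (⊆-indep M sub ind) (no-augment basis′ y∈C (y∉I ∘ B′⊆I))
      where
      sub : B′ ∪ ⁅ y ⁆ ⊆ I ∪ ⁅ y ⁆
      sub = ∪⁅⁆-⊆ (p⊆p∪q ⁅ y ⁆ ∘ B′⊆I) (x∈p∪q⁺ (inj₂ (x∈⁅x⁆ y)))
    exchange-from zero I _ _ _ _ ≤d | no Z≰I | _ | no _ = contradiction (≤-trans ≤d (≤-reflexive (+-identityʳ _))) Z≰I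
    exchange-from (suc d) I B′⊆I indI inC outC ≤d | no Z≰I | y , y∈Z , y∉I , ind | no y∉C =
      exchange-from d (I ∪ ⁅ y ⁆) (p⊆p∪q ⁅ y ⁆ ∘ B′⊆I) ind
        (λ z∈ z∈C → pick z∈ (λ z∈I → inC z∈I z∈C) λ { refl → contradiction z∈C y∉C })
        (λ z∈ z∉C → pick z∈ (λ z∈I → outC z∈I z∉C) λ { refl → y∈Z })
        (≤-trans ≤d (≤-trans (≤-reflexive (+-suc _ d)) (+-monoˡ-≤ d
          (p⊂q⇒∣p∣<∣q∣ (p⊆p∪q ⁅ y ⁆ , y , x∈p∪q⁺ (inj₂ (x∈⁅x⁆ y)) , y∉I)))))
      where
      pick : ∀ {z} {P : Set} → z ∈ I ∪ ⁅ y ⁆ → (z ∈ I → P) → (z ≡ y → P) → P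
      pick z∈ f g with x∈p∪q⁻ I ⁅ y ⁆ z∈
      ... | inj₁ z∈I = f z∈I
      ... | inj₂ z∈y = g (x∈⁅y⁆⇒x≡y y z∈y)

    exchange-bases : ∃ λ I → Ind I × B′ ⊆ I × (∀ {y} → y ∈ Z → y ∉ C → y ∈ I)
    exchange-bases = exchange-from (∣ Z ∣) B′ (λ x∈ → x∈) (proj₁ (proj₂ basis′)) (λ y∈ _ → y∈)
      (λ y∈ y∉ → contradiction (proj₁ basis′ y∈) y∉) (m≤n+m _ _)

-- Minors with respect to a fixed basis of the contracted set

Extends : ∀ {n m} → (Fin m → Fin n) → Subset n → Subset m → Subset n → Set
Extends e B X Z = ∀ z → (z ∈ Z) ⇔ (z ∈ B ⊎ ∃[ y ] (y ∈ X × e y ≡ z))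

Over : ∀ {n m} → IndepPred n → (Fin m → Fin n) → Subset n → IndepPred m
Over Ind e B X = ∃[ Z ] (Extends e B X Z × Ind Z)

module _ {n m} (e : Fin m → Fin n) (B : Subset n) (X : Subset m) where
  extension? : ∀ z → Dec (z ∈ B ⊎ ∃[ y ] (y ∈ X × e y ≡ z))
  extension? z = (z ∈? B) ⊎-dec Fin.any? (λ y → (y ∈? X) ×-dec (e y Fin.≟ z))

  extension : Subset n
  extension = ⟪ extension? ⟫

  extension-extends : Extends e B X extension
  extension-extends z = mk⇔ (∈⟪⟫⁻ extension?) (∈⟪⟫⁺ extension?)

over-bijection : ∀ {n m} {Ind : IndepPred n} → Model Ind → (e : Fin m → Fin n) → Injective _≡_ _≡_ e →
                 (∀ z → ∃ λ y → e y ≡ z) → (B : Subset n) → (∀ y → e y ∉ B) → m ≡ n → Model (Over Ind e B)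
over-bijection {Ind = Ind} M e inj onto B disj refl = record
  { band = band M ; label = label M ∘ e ; label< = label< M ∘ e ; label-inj = inj ∘ label-inj M
  ; spec = λ X → mk⇔
      (λ (Z , ext , ind) → let h , h∈ , s = to (spec M Z) ind in
        h , h∈ , λ y y∈ → s (e y) (from (ext _) (inj₂ (y , y∈ , refl))))
      (λ (h , h∈ , s) → extension e B X , extension-extends e B X ,
        from (spec M _) (h , h∈ , λ z z∈ → step X h s (to (extension-extends e B X z) z∈))) }
  where
  step : ∀ X h → (∀ y → y ∈ X → Step h (label M (e y))) → ∀ {z} → (z ∈ B ⊎ ∃[ y ] (y ∈ X × e y ≡ z)) → Step h (label M z)
  step X h s {z} (inj₁ z∈B) with onto z
  ... | y , refl = contradiction z∈B (disj y)
  step X h s (inj₂ (y , y∈ , refl)) = s y y∈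

away : ∀ {n} → Fin (suc n) → Subset (suc n) → Subset n
away x Z = tabulate (lookup Z ∘ punchIn x)

∈-away : ∀ {n} x (Z : Subset (suc n)) {y} → y ∈ away x Z ⇔ punchIn x y ∈ Z
∈-away x Z {y} = mk⇔
  (λ y∈ → lookup⇒[]= _ Z (trans (sym (lookup∘tabulate _ y)) ([]=⇒lookup y∈)))
  (λ y∈ → lookup⇒[]= y _ (trans (lookup∘tabulate _ y) ([]=⇒lookup y∈)))

-- An element outside the image of `e` is contracted if it belongs to `B` and deleted otherwise,
-- until `e` is a bijection. The elements of the contracted set outside its basis are thereby
-- deleted, being loops once the basis is contracted.
over-model : ∀ n {m} {Ind : IndepPred n} → Model Ind → (e : Fin m → Fin n) → Injective _≡_ _≡_ e →
             (B : Subset n) → (∀ y → e y ∉ B) → Ind B → Model (Over Ind e B)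
over-model n {m} M e inj B disj indB with Fin.all? (λ z → Fin.any? (λ y → e y Fin.≟ z))
... | yes onto = over-bijection M e inj onto B disj
      (≤-antisym (Fin.injective⇒≤ inj) (Fin.injective⇒≤ {f = λ z → proj₁ (onto z)}
        λ {z} {z′} eq → trans (sym (proj₂ (onto z))) (trans (cong e eq) (proj₂ (onto z′)))))
over-model zero    M e inj B disj indB | no missed = contradiction (λ ()) missed
over-model (suc n) {m} {Ind} M e inj B disj indB | no missed with Fin.¬∀⟶∃¬ _ _ (λ z → Fin.any? (λ y → e y Fin.≟ z)) missed
... | x , x∉e = model-resp over⇔ (over-model n M′ e′ inj′ B′ disj′ (⊆-indep M B′⊆ indB))
  where
  x≢ : ∀ y → x ≢ e y
  x≢ y eq = x∉e (y , sym eq)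
  e′ : Fin m → Fin n
  e′ y = punchOut (x≢ y)
  e′≡ : ∀ y → punchIn x (e′ y) ≡ e y
  e′≡ y = Fin.punchIn-punchOut (x≢ y)
  inj′ : Injective _≡_ _≡_ e′
  inj′ eq = inj (Fin.punchOut-injective (x≢ _) (x≢ _) eq)
  B′ = away x B
  b = lookup B x
  disj′ : ∀ y → e′ y ∉ B′
  disj′ y y∈ = disj y (subst (_∈ B) (e′≡ y) (to (∈-away x B) y∈))
  B′⊆ : insertAt B′ x b ⊆ B
  B′⊆ = insertAt-⊆ x b (to (∈-away x B)) (lookup⇒[]= x B)
  M′ : Model (λ X → Ind (insertAt X x b))
  M′ with b | ⊆-indep M B′⊆ indB
  ... | outside | _   = delete M x
  ... | inside  | ind = contract M x ind
  over⇔ : ∀ X → Over (λ X → Ind (insertAt X x b)) e′ B′ X ⇔ Over Ind e B X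
  over⇔ X = mk⇔
    (λ (Z , ext , ind) → insertAt Z x b , (λ z → mk⇔ (forth ext (punchView x z)) (back ext (punchView x z))) , ind)
    (λ (Z , ext , ind) → away x Z , (λ z → mk⇔ (forth′ ext z) (back′ ext z)) ,
      ⊆-indep M (insertAt-⊆ x b (to (∈-away x Z)) (λ eq → from (ext x) (inj₁ (lookup⇒[]= x B eq)))) ind)
    where
    forth : ∀ {Z} → Extends e′ B′ X Z → ∀ {z} → PunchView x z → z ∈ insertAt Z x b → z ∈ B ⊎ ∃[ y ] (y ∈ X × e y ≡ z)
    forth {Z} ext pivot z∈ = inj₁ (lookup⇒[]= x B (trans (sym (insertAt-lookup Z x b)) ([]=⇒lookup z∈)))
    forth ext (punched w) z∈ with to (ext w) (insertAt-∈⁻ x b z∈)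
    ... | inj₁ w∈             = inj₁ (to (∈-away x B) w∈)
    ... | inj₂ (y , y∈ , eq)  = inj₂ (y , y∈ , trans (sym (e′≡ y)) (cong (punchIn x) eq))
    back : ∀ {Z} → Extends e′ B′ X Z → ∀ {z} → PunchView x z → z ∈ B ⊎ ∃[ y ] (y ∈ X × e y ≡ z) → z ∈ insertAt Z x b
    back {Z} ext pivot (inj₁ z∈B) = lookup⇒[]= x _ (trans (insertAt-lookup Z x b) ([]=⇒lookup z∈B))
    back ext pivot (inj₂ (y , _ , eq)) = contradiction (sym eq) (x≢ y)
    back ext (punched w) (inj₁ z∈B) = insertAt-∈ x b (from (ext w) (inj₁ (from (∈-away x B) z∈B)))
    back ext (punched w) (inj₂ (y , y∈ , eq)) = insertAt-∈ x b (from (ext w) (inj₂ (y , y∈ , Fin.punchIn-injective x _ _ (trans (e′≡ y) eq))))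
    forth′ : ∀ {Z} → Extends e B X Z → ∀ w → w ∈ away x Z → w ∈ B′ ⊎ ∃[ y ] (y ∈ X × e′ y ≡ w)
    forth′ {Z} ext w w∈ with to (ext _) (to (∈-away x Z) w∈)
    ... | inj₁ w∈B           = inj₁ (from (∈-away x B) w∈B)
    ... | inj₂ (y , y∈ , eq) = inj₂ (y , y∈ , Fin.punchIn-injective x _ _ (trans (e′≡ y) eq))
    back′ : ∀ {Z} → Extends e B X Z → ∀ w → w ∈ B′ ⊎ ∃[ y ] (y ∈ X × e′ y ≡ w) → w ∈ away x Z
    back′ {Z} ext w (inj₁ w∈)             = from (∈-away x Z) (from (ext _) (inj₁ (to (∈-away x B) w∈)))
    back′ {Z} ext w (inj₂ (y , y∈ , eq)) = from (∈-away x Z) (from (ext _) (inj₂ (y , y∈ , trans (sym (e′≡ y)) (cong (punchIn x) eq))))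

-- The definition lets the basis of `C` vary with the set tested; exchange replaces it by one fixed
-- basis, and for that one `over-model` applies.
minor-model : ∀ {n m} {Ind : IndepPred n} → Model Ind → ∀ {k} {A : SetSystem n k} → (∀ X → Ind X ⇔ M[ A ] X) →
              (e : Fin m → Fin n) (C : Subset n) → Injective _≡_ _≡_ e → (∀ y → e y ∉ C) → Model (minor Ind e C)
minor-model {n} {m} {Ind} M {A = A} present e C inj disj with basis-of M C
... | B , basis@(B⊆C , indB , max) =
  model-resp (λ X → mk⇔ (λ over → B , (λ {z} → B⊆C {z}) , indB , max , over) (λ (B′ , B′⊆C , indB′ , max′ , over) → move X ((λ {z} → B′⊆C {z}) , indB′ , max′) over))
    (over-model n M e inj B (λ y → disj y ∘ B⊆C) indB)
  where
  move : ∀ X {B′} → IsBasisOf Ind C B′ → Over Ind e B′ X → Over Ind e B X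
  move X {B′} basis′ (Z , ext , indZ) = extension e B X , extension-extends e B X , ⊆-indep M (λ {z} z∈ → sub (to (extension-extends e B X z) z∈)) indI
    where
    Z∩C⊆B′ : ∀ {z} → z ∈ Z → z ∈ C → z ∈ B′
    Z∩C⊆B′ {z} z∈Z z∈C with to (ext z) z∈Z
    ... | inj₁ z∈ = z∈
    ... | inj₂ (y , _ , refl) = contradiction z∈C (disj y)
    exchanged = exchange-bases M {A = A} present basis′ basis indZ Z∩C⊆B′ (λ {z} z∈ → from (ext z) (inj₁ z∈))
    indI = proj₁ (proj₂ exchanged)
    sub : ∀ {z} → z ∈ B ⊎ ∃[ y ] (y ∈ X × e y ≡ z) → z ∈ proj₁ exchanged
    sub (inj₁ z∈B) = proj₁ (proj₂ (proj₂ exchanged)) z∈B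
    sub (inj₂ (y , y∈ , refl)) = proj₂ (proj₂ (proj₂ exchanged)) (from (ext _) (inj₂ (y , y∈ , refl))) (disj y)

-- Sums, unit steps and the paths that count positions

sum : ∀ {k} → (Fin k → ℕ) → ℕ
sum {zero}  u = 0
sum {suc k} u = u zero + sum (u ∘ suc)

sum-mono : ∀ {k} {u v : Fin k → ℕ} → (∀ j → u j ≤ v j) → sum u ≤ sum v
sum-mono {zero}  u≤v = z≤n
sum-mono {suc k} u≤v = +-mono-≤ (u≤v zero) (sum-mono (u≤v ∘ suc))

sum-cong : ∀ {k} {u v : Fin k → ℕ} → (∀ j → u j ≡ v j) → sum u ≡ sum v
sum-cong {zero}  eq = refl
sum-cong {suc k} eq = cong₂ _+_ (eq zero) (sum-cong (eq ∘ suc))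

sum-strict : ∀ {k} {u v : Fin k → ℕ} → (∀ j → u j ≤ v j) → ∀ j → u j < v j → sum u < sum v
sum-strict u≤v zero    u<v = +-mono-<-≤ u<v (sum-mono (u≤v ∘ suc))
sum-strict u≤v (suc j) u<v = +-mono-≤-< (u≤v zero) (sum-strict (u≤v ∘ suc) j u<v)

sum-<⇒∃ : ∀ {k} {u v : Fin k → ℕ} → sum u < sum v → ∃ λ j → u j < v j
sum-<⇒∃ {suc k} {u} {v} lt with v zero ≤? u zero
... | no v≰u = zero , ≰⇒> v≰u
... | yes v≤u = let j , lt′ = sum-<⇒∃ {k} (+-cancelˡ-< (u zero) _ _ (<-≤-trans lt (+-monoˡ-≤ _ v≤u))) in suc j , lt′

sum-suc : ∀ {k} (u : Fin k → ℕ) → sum (suc ∘ u) ≡ sum u + k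
sum-suc {zero}  u = refl
sum-suc {suc k} u = lin 4 (λ a b c d → b ≐ c ⊹ d ⊢ ∎ 𝕤 (a ⊹ b) ≐ a ⊹ c ⊹ 𝕤 d)
  (u zero) _ (sum (u ∘ suc)) k (sum-suc (u ∘ suc))

sum-slow : ∀ {k} {u v : Fin k → ℕ} → (∀ j → v j ≤ suc (u j)) →
           (∀ i j → u i < v i → u j < v j → i ≡ j) → sum v ≤ suc (sum u)
sum-slow {zero}  v≤ one = z≤n
sum-slow {suc k} {u} {v} v≤ one with v zero ≤? u zero
... | yes v≤u = ≤-trans (+-mono-≤ v≤u (sum-slow (v≤ ∘ suc) λ i j p q → Fin.suc-injective (one _ _ p q))) (≤-reflexive (+-suc _ _))
... | no  v≰u = +-mono-≤ (v≤ zero) (sum-mono λ j → ≮⇒≥ λ lt → Fin.0≢1+n (one zero (suc j) (≰⇒> v≰u) lt))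

sum-+ : ∀ {k} (u v : Fin k → ℕ) → sum (λ j → u j + v j) ≡ sum u + sum v
sum-+ {zero}  u v = refl
sum-+ {suc k} u v = trans (cong ((u zero + v zero) +_) (sum-+ (u ∘ suc) (v ∘ suc))) (+-interchange (u zero) (v zero) _ _)

abstract
  -- The unit step: the path that rises only in passing position `x`.
  χ : ℕ → ℕ → ℕ
  χ x t with x <? t
  ... | yes _ = 1
  ... | no  _ = 0

  χ-< : ∀ {x t} → x < t → χ x t ≡ 1
  χ-< {x} {t} lt with x <? t
  ... | yes _  = refl
  ... | no x≮t = contradiction lt x≮t

  χ-≥ : ∀ {x t} → t ≤ x → χ x t ≡ 0
  χ-≥ {x} {t} ge with x <? t
  ... | yes x<t = contradiction ge (<⇒≱ x<t)
  ... | no _    = refl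

  χ≤1 : ∀ x t → χ x t ≤ 1
  χ≤1 x t with x <? t
  ... | yes _ = ≤-refl
  ... | no  _ = z≤n

  χ-imp : ∀ {x y s t} → (x < s → y < t) → χ x s ≤ χ y t
  χ-imp {x} {y} {s} {t} imp with x <? s
  ... | yes x<s = ≤-reflexive (sym (χ-< (imp x<s)))
  ... | no  _   = z≤n

  χ-up : ∀ x t → χ x t ≤ χ x (suc t)
  χ-up x t = χ-imp {x} {x} {t} m<n⇒m<1+n

  χ-anti : ∀ {x y} → x ≤ y → ∀ t → χ y t ≤ χ x t
  χ-anti {x} {y} x≤y t = χ-imp {y} {x} {t} {t} (≤-<-trans x≤y)

  χ-jump : ∀ {x t} → χ x t < χ x (suc t) → x ≡ t
  χ-jump {x} {t} lt with x <? t | x <? suc t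
  χ-jump (s≤s ()) | yes _ | yes _
  χ-jump ()       | yes _ | no _
  χ-jump ()       | no _  | no _
  ... | no x≮t | yes x<t+1 = ≤-antisym (≤-pred x<t+1) (≮⇒≥ x≮t)

module Count (n : ℕ) where
  cnt : ∀ {k} → (Fin k → ℕ) → ℕ → ℕ
  cnt x t = sum (λ j → χ (x j) t)

  -- How many of the positions x and x − n lie before t.
  winding : ℕ → ℕ → ℕ
  winding x t = χ x t + χ x (t + n)

  -- Over one turn this rises at the positions `x j` reduced modulo `n`. A position lifted by `n`
  -- counts once less throughout the turn, so the path of the last elements stays below that of the
  -- first ones even if an interval passes the end of the turn.
  height : ∀ {k} → (Fin k → ℕ) → ℕ → ℕ
  height x t = sum (λ j → winding (x j) t)

  height≡ : ∀ {k} (x : Fin k → ℕ) t → height x t ≡ cnt x t + cnt x (t + n)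
  height≡ x t = sum-+ (λ j → χ (x j) t) (λ j → χ (x j) (t + n))

  winding-up : ∀ x t → winding x t ≤ winding x (suc t)
  winding-up x t = +-mono-≤ (χ-up x t) (χ-up x (t + n))

  winding-mono : ∀ {x y} → x ≤ y → ∀ t → winding y t ≤ winding x t
  winding-mono x≤y t = +-mono-≤ (χ-anti x≤y t) (χ-anti x≤y (t + n))

  winding-jump : ∀ {x t} → winding x t < winding x (suc t) → x ≡ t ⊎ x ≡ t + n
  winding-jump {x} {t} lt with χ x (suc t) ≤? χ x t
  ... | no jump = inj₁ (χ-jump (≰⇒> jump))
  ... | yes flat = inj₂ (χ-jump (+-cancelˡ-< (χ x t) _ _ (<-≤-trans lt (+-monoˡ-≤ _ flat))))

  jump-winding : ∀ {x t} → x ≡ t ⊎ x ≡ t + n → winding x t < winding x (suc t)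
  jump-winding {x} (inj₁ refl) = +-mono-<-≤ (subst₂ _<_ (sym (χ-≥ {x} ≤-refl)) (sym (χ-< {x} ≤-refl)) (s≤s z≤n)) (χ-up x (x + n))
  jump-winding {x} {t} (inj₂ refl) = +-mono-≤-< (χ-up x t) (subst₂ _<_ (sym (χ-≥ {x} ≤-refl)) (sym (χ-< {x} ≤-refl)) (s≤s z≤n))

  winding-slow : ∀ {t} x → t < n → winding x (suc t) ≤ suc (winding x t)
  winding-slow {t} x t<n with χ x (suc t) ≤? χ x t | χ x (suc (t + n)) ≤? χ x (t + n)
  ... | yes p | _ = ≤-trans (+-mono-≤ p (≤-trans (χ≤1 x _) (s≤s z≤n))) (≤-reflexive (+-suc (χ x t) (χ x (t + n))))
  ... | no p | yes q = +-mono-≤ (≤-trans (χ≤1 x _) (s≤s z≤n)) q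
  ... | no p | no q with χ-jump (≰⇒> p) | χ-jump (≰⇒> q)
  ...   | refl | e = contradiction (≤-trans (s≤s z≤n) t<n) (<⇒≱ (≤-reflexive (cong suc (+-cancelˡ-≡ t n 0 (trans (sym e) (sym (+-identityʳ t)))))))

  winding-turn : ∀ {x} → x < n + n → winding x n ≡ suc (winding x 0)
  winding-turn {x} lt rewrite χ-< lt | χ-≥ {x} {0} z≤n = +-comm (χ x n) 1

  height-rising : ∀ {k} (x : Fin k → ℕ) → Rising n (height x)
  height-rising x t _ = sum-mono λ j → winding-up (x j) t

  height-turn : ∀ {k} (x : Fin k → ℕ) → (∀ j → x j < n + n) → height x n ≡ height x 0 + k
  height-turn {k} x x< = trans (sum-cong λ j → winding-turn (x< j))
    (sum-suc (λ j → winding (x j) 0))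

  height-path : ∀ {k} (x : Fin k → ℕ) → (∀ j → x j < n + n) → (∀ i j → x i ≡ x j → i ≡ j) → (∀ i j → x i ≢ x j + n) →
                Path n k (height x)
  height-path x x< inj apart = record
    { up = height-rising x
    ; lip = λ t t<n → sum-slow (λ j → winding-slow (x j) t<n) λ i j p q → same i j (winding-jump {x i} p) (winding-jump {x j} q)
    ; turn = height-turn x x< }
    where
    same : ∀ i j {t} → x i ≡ t ⊎ x i ≡ t + n → x j ≡ t ⊎ x j ≡ t + n → i ≡ j
    same i j (inj₁ p) (inj₁ q) = inj i j (trans p (sym q))
    same i j (inj₂ p) (inj₂ q) = inj i j (trans p (sym q))
    same i j (inj₁ p) (inj₂ q) = contradiction (trans q (cong (_+ n) (sym p))) (apart j i)
    same i j (inj₂ p) (inj₁ q) = contradiction (trans p (cong (_+ n) (sym q))) (apart i j)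

crossing : ∀ (h : ℕ → ℕ) {v} n → h 0 ≤ v → v < h n → ∃ λ t → t < n × h t ≤ v × v < h (suc t)
crossing h zero    lo hi = contradiction lo (<⇒≱ hi)
crossing h {v} (suc n) lo hi with h n ≤? v
... | yes hn≤v = n , ≤-refl , hn≤v , hi
... | no  hn≰v = let t , t<n , p , q = crossing h n lo (≰⇒> hn≰v) in t , m<n⇒m<1+n t<n , p , q

-- Non-crossing intervals and the band between their ends

-- An interval that passes position n − 1 has its last element lifted by n.
record Intervals (n k : ℕ) : Set where
  field
    first last : Fin k → ℕ
    first<     : ∀ j → first j < n
    first≤last : ∀ j → first j ≤ last j
    last<      : ∀ j → last j < first j + n
    ordered    : ∀ {i j} → i ≢ j → first i ≤ first j → last i < last j
    unwound    : ∀ i j → last i < last j + n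

open Intervals public

Covers : ∀ {n k} → Intervals n k → (Fin n → ℕ) → SetSystem n k
Covers {n} I ℓ j x = ∃ λ s → first I j ≤ s × s ≤ last I j × (s ≡ ℓ x ⊎ s ≡ ℓ x + n)

module _ {n k} (I : Intervals n k) where
  open Count n
  private
    a = first I
    b = last I

  first-injective : ∀ i j → a i ≡ a j → i ≡ j
  first-injective i j eq with i Fin.≟ j
  ... | yes i≡j = i≡j
  ... | no  i≢j = contradiction (ordered I i≢j (≤-reflexive eq)) (<⇒≯ (ordered I (i≢j ∘ sym) (≤-reflexive (sym eq))))

  last-injective : ∀ i j → b i ≡ b j → i ≡ j
  last-injective i j eq with i Fin.≟ j | ≤-total (a i) (a j)
  ... | yes i≡j | _       = i≡j
  ... | no i≢j  | inj₁ le = contradiction (ordered I i≢j le) (<-irrefl eq)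
  ... | no i≢j  | inj₂ le = contradiction (ordered I (i≢j ∘ sym) le) (<-irrefl (sym eq))

  last<n+n : ∀ j → b j < n + n
  last<n+n j = <-≤-trans (last< I j) (+-monoˡ-≤ n (<⇒≤ (first< I j)))

  interval-band : Band n
  interval-band = record
    { rank = k ; low = height b ; high = height a
    ; low-path = height-path b last<n+n last-injective λ i j eq → <-irrefl eq (unwound I i j)
    ; high-path = height-path a (λ j → <-≤-trans (first< I j) (m≤m+n n n)) first-injective
        λ i j eq → <⇒≱ (first< I i) (≤-trans (m≤n+m n (a j)) (≤-reflexive (sym eq)))
    ; low≤high = λ t _ → sum-mono λ j → winding-mono (first≤last I j) t }

-- The largest slow function below h with the given initial value.
regularise : (ℕ → ℕ) → ℕ → ℕ → ℕ
regularise h v zero    = v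
regularise h v (suc t) = h (suc t) ⊓ suc (regularise h v t)

module _ {n : ℕ} {h : ℕ → ℕ} where
  regularise-≤ : ∀ {v} → v ≤ h 0 → ∀ t → regularise h v t ≤ h t
  regularise-≤ v≤ zero    = v≤
  regularise-≤ v≤ (suc t) = m⊓n≤m _ _

  regularise-≥ : ∀ {p v} → Slow n p → p 0 ≤ v → p ≤[ n ] h → p ≤[ n ] regularise h v
  regularise-≥ slow p≤v p≤h zero    _   = p≤v
  regularise-≥ slow p≤v p≤h (suc t) t<n = ⊓-glb (p≤h (suc t) t<n)
    (≤-trans (slow t t<n) (s≤s (regularise-≥ slow p≤v p≤h t (<⇒≤ t<n))))

  regularise-rising : ∀ {v} → v ≤ h 0 → Rising n h → Rising n (regularise h v)
  regularise-rising v≤ rising t t<n = ⊓-glb (≤-trans (regularise-≤ v≤ t) (rising t t<n)) (n≤1+n _)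

  -- A lower start only adds the line of slope one from it as a further bound. If that line lies
  -- above the height already reached at `n`, the restarted function ends at the same height; this
  -- is what makes it periodic.
  regularise-start : ∀ {v} → v ≤ h 0 → ∀ t → regularise h v t ≡ regularise h (h 0) t ⊓ (v + t)
  regularise-start {v} v≤ zero    = trans (sym (m≥n⇒m⊓n≡n v≤)) (cong (h 0 ⊓_) (sym (+-identityʳ v)))
  regularise-start {v} v≤ (suc t) rewrite regularise-start v≤ t | +-suc v t =
    sym (⊓-assoc (h (suc t)) (suc (regularise h (h 0) t)) (suc (v + t)))

-- Starting where the largest slow function below h ends makes the
-- regularisation periodic.
regular : ∀ {n} (B : Band n) {h} → Rising n h → h n ≡ h 0 + rank B → low B ≤[ n ] h → h ≤[ n ] high B →
          Σ (ℕ → ℕ) λ g → g ∈ᵇ B × (∀ t → t < n → Step h t → Step g t)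
regular {n} B {h} rising hn lo hi = g , record
    { path = record
        { up = regularise-rising v≤h0 rising
        ; lip = λ t _ → m⊓n≤n (h (suc t)) _
        ; turn = trans (regularise-start {n} {h} v≤h0 n) (trans (m≤n⇒m⊓n≡m w≤v+n) (sym v+k)) }
    ; above = regularise-≥ (lip P) p0≤v lo
    ; below = λ t t≤n → ≤-trans (regularise-≤ {n} v≤h0 t) (hi t t≤n) }
  , λ t t<n s → ⊓-glb (≤-trans (s≤s (regularise-≤ {n} v≤h0 t)) s) ≤-refl
  where
  P = low-path B
  k = rank B
  w = regularise h (h 0) n
  v = w ∸ k
  g = regularise h v
  pn≤w : low B n ≤ w
  pn≤w = regularise-≥ (lip P) (lo 0 z≤n) lo n ≤-refl
  v+k : v + k ≡ w
  v+k = m∸n+n≡m (≤-trans (m≤n+m k (low B 0)) (≤-trans (≤-reflexive (sym (turn P))) pn≤w))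
  v≤h0 : v ≤ h 0
  v≤h0 = lin 5 (λ v k w hn h0 → v ⊹ k ≐ w ⊢ w ≼ hn ⊢ hn ≐ h0 ⊹ k ⊢ ∎ v ≼ h0) v k w (h n) (h 0) v+k (regularise-≤ {n} ≤-refl n) hn
  p0≤v : low B 0 ≤ v
  p0≤v = lin 5 (λ v k w pn p0 → v ⊹ k ≐ w ⊢ pn ≼ w ⊢ pn ≐ p0 ⊹ k ⊢ ∎ p0 ≼ v) v k w (low B n) (low B 0) v+k pn≤w (turn P)
  w≤v+n : w ≤ v + n
  w≤v+n = ≤-trans (≤-reflexive (sym v+k)) (+-monoʳ-≤ v (r≤n P))

-- Partial transversals as sets spanned by the band

module Transversals {n k} (I : Intervals n k) (ℓ : Fin n → ℕ) (ℓ< : ∀ x → ℓ x < n) (ℓ-inj : Injective _≡_ _≡_ ℓ) where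
  open Count n
  private
    a = first I
    b = last I
    B = interval-band I

  module _ {X} (tX : M[ Covers I ℓ ] X) where
    private
      f = proj₁ tX
      inj = proj₁ (proj₂ tX)
      mem = proj₂ (proj₂ tX)

    Preimage : Fin k → Fin n → Set
    Preimage j x = Σ (x ∈ X) λ p → f x p ≡ j

    preimage? : ∀ j x → Dec (Preimage j x)
    preimage? j x with x ∈? X
    ... | no x∉ = no (x∉ ∘ proj₁)
    ... | yes p with f x p Fin.≟ j
    ...   | yes eq = yes (p , eq)
    ...   | no neq = no λ (p′ , eq) → neq (trans (cong (f x) ([]=-irrelevant p p′)) eq)

    -- An unmatched interval is represented by its first element.
    representative : ∀ j → ∃ λ s → a j ≤ s × s ≤ b j × (∀ x → Preimage j x → s ≡ ℓ x ⊎ s ≡ ℓ x + n)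
    representative j with Fin.any? (preimage? j)
    ... | no none = a j , ≤-refl , first≤last I j , λ x pre → contradiction (x , pre) none
    ... | yes (x , p , refl) with mem x p
    ...   | s , a≤s , s≤b , at = s , a≤s , s≤b , λ { y (q , eq) → subst (λ z → s ≡ ℓ z ⊎ s ≡ ℓ z + n) (inj x y p q (sym eq)) at }

    rep : Fin k → ℕ
    rep j = proj₁ (representative j)

    ≤rep : ∀ j → a j ≤ rep j
    ≤rep j = proj₁ (proj₂ (representative j))

    rep≤ : ∀ j → rep j ≤ b j
    rep≤ j = proj₁ (proj₂ (proj₂ (representative j)))

    rep-step : ∀ x → x ∈ X → Step (height rep) (ℓ x)
    rep-step x p = sum-strict (λ j → winding-up (rep j) (ℓ x)) (f x p)
      (jump-winding (proj₂ (proj₂ (proj₂ (representative (f x p)))) x (p , refl)))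

    -- A representative lies between the ends of its interval, so the total height lies in the band.
    -- An unmatched interval may jump at a position already in use; `regular` flattens such jumps
    -- without losing a step.
    spanned : Spanned B ℓ X
    spanned =
      let g , g∈ , keep = regular B {height rep} (height-rising rep)
                   (height-turn rep λ j → ≤-<-trans (rep≤ j) (last<n+n I j))
                   (λ t _ → sum-mono λ j → winding-mono (rep≤ j) t) (λ t _ → sum-mono λ j → winding-mono (≤rep j) t)
      in g , g∈ , λ x p → keep (ℓ x) (ℓ< x) (rep-step x p)

  module _ {h} (h∈ : h ∈ᵇ B) where
    private
      H = path h∈

    place : Fin k → ℕ
    place j = cnt a (a j)

    -- The upper path starts at height `k` and passes the first element of interval `j` at height
    -- `place j + k`. A height below `k` is matched one turn later, at `t + n` and `k` higher.
    Fits : ℕ → Fin k → Set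
    Fits t j = (h t ≡ place j + k × a j ≤ t × t ≤ b j) ⊎ (h t ≡ place j × a j ≤ t + n × t + n ≤ b j)

    cnt-full : ∀ t → cnt a (t + n) ≡ k
    cnt-full t = trans (sum-cong λ j → χ-< (<-≤-trans (first< I j) (m≤n+m n t)))
      (ones k)
      where
      ones : ∀ k → sum {k} (λ _ → 1) ≡ k
      ones zero    = refl
      ones (suc k) = cong suc (ones k)

    high≡ : ∀ t → height a t ≡ cnt a t + k
    high≡ t = trans (height≡ a t) (cong (cnt a t +_) (cnt-full t))

    cnt-0 : cnt a 0 ≡ 0
    cnt-0 = trans (sum-cong λ j → χ-≥ {a j} {0} z≤n) (zeros k)
      where
      zeros : ∀ k → sum {k} (λ _ → 0) ≡ 0
      zeros zero    = refl
      zeros (suc k) = zeros k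

    high-0 : height a 0 ≡ k
    high-0 = trans (high≡ 0) (cong (_+ k) cnt-0)

    at-height : ∀ v → k ≤ v → v < k + k → ∃ λ j → v ≡ place j + k
    at-height v k≤v v<k+k with crossing (height a) {v} n (≤-trans (≤-reflexive high-0) k≤v)
                                 (<-≤-trans v<k+k (≤-reflexive (sym (trans (turn (high-path B)) (cong (_+ k) high-0)))))
    ... | t , t<n , ≤v , v< with sum-<⇒∃ {k} (≤-<-trans ≤v v<)
    ...   | j , jump with winding-jump {a j} {t} jump
    ...     | inj₁ refl = j , trans (≤-antisym (≤-pred (<-≤-trans v< (lip (high-path B) t t<n))) ≤v) (high≡ t)
    ...     | inj₂ e    = contradiction (first< I j) (≤⇒≯ (≤-trans (m≤n+m n t) (≤-reflexive (sym e))))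

    -- Intervals starting no later than `j` also end no later, and besides the `place j` earlier
    -- ones `j` itself is among them.
    past-last : ∀ j → suc (place j) ≤ cnt b (suc (b j))
    past-last j = ≤-trans
      (sum-strict (λ i → χ-up (a i) (a j)) j (subst₂ _<_ (sym (χ-≥ {a j} ≤-refl)) (sym (χ-< {a j} ≤-refl)) (s≤s z≤n)))
      (sum-mono λ i → χ-imp {a i} {b i} {suc (a j)} {suc (b j)} λ le → s≤s (below-last i (≤-pred le)))
      where
      below-last : ∀ i → a i ≤ a j → b i ≤ b j
      below-last i le with i Fin.≟ j
      ... | yes refl = ≤-refl
      ... | no  i≢j  = <⇒≤ (ordered I i≢j le)

    cnt-mono : ∀ {s t} → s ≤ t → cnt b s ≤ cnt b t
    cnt-mono {s} {t} s≤t = sum-mono λ i → χ-imp {b i} {b i} {s} {t} λ lt → <-≤-trans lt s≤t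

    -- The interval is read off the height of `h` at `t`. Were `t` before its first element, the
    -- step would lift `h` above the upper path; were `t` after its last element, `past-last` would
    -- put the lower path above `h`.
    fit : ∀ t → t < n → Step h t → ∃ (Fits t)
    fit t t<n st with k ≤? h t
    ... | yes k≤v with at-height (h t) k≤v (<-≤-trans st (≤-trans (below h∈ (suc t) t<n)
                         (≤-trans (mono (high-path B) t<n ≤-refl) (≤-reflexive (trans (turn (high-path B)) (cong (_+ k) high-0))))))
    ...   | j , v≡ = j , inj₁ (v≡ , after , before)
      where
      after : a j ≤ t
      after = ≮⇒≥ λ t<a → contradiction
        (<-≤-trans st (≤-trans (below h∈ (suc t) t<n) (mono (high-path B) t<a (<⇒≤ (first< I j)))))
        (≤⇒≯ (≤-reflexive (trans (high≡ (a j)) (sym v≡))))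
      all-before : b j < t → k ≤ cnt b (t + n)
      all-before b<t = ≤-trans (≤-reflexive (sym (cnt-full t))) (sum-mono λ i → χ-imp {a i} {b i} {t + n} {t + n}
        λ _ → <-trans (unwound I i j) (+-monoˡ-< n b<t))
      before : t ≤ b j
      before = ≮⇒≥ λ b<t → contradiction
        (≤-trans (+-mono-≤ (≤-trans (past-last j) (cnt-mono b<t)) (all-before b<t)) (≤-reflexive (sym (height≡ b t))))
        (<⇒≱ (≤-<-trans (above h∈ t (<⇒≤ t<n)) (≤-reflexive (cong suc v≡))))
    fit t t<n st | no k≰v with at-height (h t + k) (m≤n+m k (h t)) (+-monoˡ-< k (≰⇒> k≰v))
    ...   | j , v+k≡ = j , inj₂ (v≡ , ≤-trans (<⇒≤ (first< I j)) (m≤n+m n t) , before)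
      where
      v≡ : h t ≡ place j
      v≡ = +-cancelʳ-≡ k (h t) (place j) v+k≡
      before : t + n ≤ b j
      before = ≮⇒≥ λ b<t → contradiction
        (≤-trans (≤-trans (past-last j) (cnt-mono b<t)) (≤-trans (m≤n+m _ (cnt b t)) (≤-reflexive (sym (height≡ b t)))))
        (<⇒≱ (≤-<-trans (above h∈ t (<⇒≤ t<n)) (≤-reflexive (cong suc v≡))))

    same-height : ∀ {s t} → s < n → t < n → Step h s → Step h t → h s ≡ h t → s ≡ t
    same-height {s} {t} s<n t<n ss st eq with <-cmp s t
    ... | tri≈ _ s≡t _ = s≡t
    ... | tri< s<t _ _ = contradiction (<-≤-trans ss (mono H s<t (<⇒≤ t<n))) (<-irrefl eq)
    ... | tri> _ _ t<s = contradiction (<-≤-trans st (mono H t<s (<⇒≤ s<n))) (<-irrefl (sym eq))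

    within-turn : ∀ {s t} → s < n → t < n → Step h s → h s ≢ h t + k
    within-turn {s} {t} s<n t<n ss eq = contradiction
      (<-≤-trans ss (≤-trans (mono H s<n ≤-refl) (≤-trans (≤-reflexive (turn H)) (+-monoˡ-≤ k (mono H z≤n (<⇒≤ t<n))))))
      (<-irrefl eq)

    -- A path gains exactly `k` in a turn, so the heights at which it steps are distinct modulo `k`.
    fit-injective : ∀ {s t j} → s < n → t < n → Step h s → Step h t → Fits s j → Fits t j → s ≡ t
    fit-injective s<n t<n ss st (inj₁ (p , _)) (inj₁ (q , _)) = same-height s<n t<n ss st (trans p (sym q))
    fit-injective s<n t<n ss st (inj₂ (p , _)) (inj₂ (q , _)) = same-height s<n t<n ss st (trans p (sym q))
    fit-injective s<n t<n ss st (inj₁ (p , _)) (inj₂ (q , _)) = contradiction (trans p (cong (_+ k) (sym q))) (within-turn s<n t<n ss)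
    fit-injective s<n t<n ss st (inj₂ (p , _)) (inj₁ (q , _)) = contradiction (trans q (cong (_+ k) (sym p))) (within-turn t<n s<n st)

    covered : ∀ {x j} → Fits (ℓ x) j → Covers I ℓ j x
    covered (inj₁ (_ , lo , hi)) = _ , lo , hi , inj₁ refl
    covered (inj₂ (_ , lo , hi)) = _ , lo , hi , inj₂ refl

    transversal-of : ∀ {X} → (∀ x → x ∈ X → Step h (ℓ x)) → M[ Covers I ℓ ] X
    transversal-of {X} s = (λ x p → proj₁ (fitted x p))
      , (λ x y p q eq → ℓ-inj (fit-injective (ℓ< x) (ℓ< y) (s x p) (s y q) (proj₂ (fitted x p)) (subst (Fits (ℓ y)) (sym eq) (proj₂ (fitted y q)))))
      , λ x p → covered (proj₂ (fitted x p))
      where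
      fitted : ∀ x → x ∈ X → ∃ (Fits (ℓ x))
      fitted x p = fit (ℓ x) (ℓ< x) (s x p)

  interval-model : Model (M[ Covers I ℓ ])
  interval-model = record
    { band = B ; label = ℓ ; label< = ℓ< ; label-inj = ℓ-inj
    ; spec = λ X → mk⇔ spanned λ (h , h∈ , s) → transversal-of h∈ s }

M-resp : ∀ {n k} {A A′ : SetSystem n k} → (∀ j x → A j x → A′ j x) → ∀ {X} → M[ A ] X → M[ A′ ] X
M-resp A⇒A′ (f , inj , mem) = f , inj , λ x p → A⇒A′ _ x (mem x p)

-- From a cyclic permutation to positions on the cycle

module Orbit {m} (σ : Permutation′ (suc m)) where
  private
    n = suc m

  L : ℕ → Fin n
  L t = iter σ t zero

  iter-+ : ∀ i j x → iter σ (i + j) x ≡ iter σ i (iter σ j x)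
  iter-+ zero    j x = refl
  iter-+ (suc i) j x = cong (σ ⟨$⟩ʳ_) (iter-+ i j x)

  iter-injective : ∀ i {x y} → iter σ i x ≡ iter σ i y → x ≡ y
  iter-injective zero    eq = eq
  iter-injective (suc i) eq = iter-injective i (trans (sym (inverseˡ σ)) (trans (cong (σ ⟨$⟩ˡ_) eq) (inverseˡ σ)))

  return : ∃ λ d → suc d ≤ n × L (suc d) ≡ zero
  return with Fin.pigeonhole (n<1+n n) (λ (i : Fin (suc n)) → L (toℕ i))
  ... | i , j , i<j , eq with m≤n⇒∃[o]m+o≡n i<j
  ...   | d , i+1+d≡j = d , ≤-pred (≤-trans (s≤s (m+n≤o⇒n≤o (toℕ i) (≤-reflexive i+1+d≡j′))) (Fin.toℕ<n j)) ,
            iter-injective (toℕ i) (trans (sym (iter-+ (toℕ i) (suc d) zero)) (trans (cong L i+1+d≡j′) (sym eq)))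
    where
    i+1+d≡j′ : toℕ i + suc d ≡ toℕ j
    i+1+d≡j′ = trans (+-suc (toℕ i) d) i+1+d≡j

module Cycle {m} (σ : Permutation′ (suc m)) (cyclic : IsCyclic σ) (d : ℕ) (d<n : suc d ≤ suc m)
             (returned : iter σ (suc d) zero ≡ zero) where
  open Orbit σ
  private
    n = suc m

  L-wrap : ∀ t q → L (t + q * suc d) ≡ L t
  L-wrap t zero    = cong L (+-identityʳ t)
  L-wrap t (suc q) = trans (cong L (trans (cong (t +_) (+-comm (suc d) (q * suc d))) (sym (+-assoc t (q * suc d) (suc d)))))
    (trans (iter-+ (t + q * suc d) (suc d) zero) (trans (cong (iter σ (t + q * suc d)) returned) (L-wrap t q)))

  ℓ : Fin n → ℕ
  ℓ x = proj₁ (cyclic zero x) % suc d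

  L-ℓ : ∀ x → L (ℓ x) ≡ x
  L-ℓ x = trans (sym (L-wrap (ℓ x) (i / suc d))) (trans (cong L (sym (m≡m%n+[m/n]*n i (suc d)))) (proj₂ (cyclic zero x)))
    where i = proj₁ (cyclic zero x)

  ℓ<d : ∀ x → ℓ x < suc d
  ℓ<d x = m%n<n (proj₁ (cyclic zero x)) (suc d)

  ℓ-inj : Injective _≡_ _≡_ ℓ
  ℓ-inj {x} {y} eq = trans (sym (L-ℓ x)) (trans (cong L eq) (L-ℓ y))

  -- The pigeonhole bounds the return time by `n`. Conversely, transitivity gives all `n` elements
  -- distinct labels below the return time.
  order : suc d ≡ n
  order = ≤-antisym d<n (Fin.injective⇒≤ {f = λ x → fromℕ< (ℓ<d x)}
    λ eq → ℓ-inj (trans (sym (Fin.toℕ-fromℕ< (ℓ<d _))) (trans (cong toℕ eq) (Fin.toℕ-fromℕ< (ℓ<d _)))))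

  ℓ< : ∀ x → ℓ x < n
  ℓ< x = subst (ℓ x <_) order (ℓ<d x)

  L-+n : ∀ t → L (t + n) ≡ L t
  L-+n t = subst (λ e → L (t + e) ≡ L t) order (trans (cong (λ e → L (t + e)) (sym (+-identityʳ (suc d)))) (L-wrap t 1))

  ℓ-L : ∀ {t} → t < n → ℓ (L t) ≡ t
  ℓ-L t<n = let y , eq = label-onto ℓ ℓ< ℓ-inj t<n in
    trans (cong (λ z → ℓ (L z)) (sym eq)) (trans (cong ℓ (L-ℓ y)) eq)

  L-lift : ∀ {s x} → s ≡ ℓ x ⊎ s ≡ ℓ x + n → L s ≡ x
  L-lift {x = x} (inj₁ refl) = L-ℓ x
  L-lift {x = x} (inj₂ refl) = trans (L-+n (ℓ x)) (L-ℓ x)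

  lift-L : ∀ {s} → s < n + n → s ≡ ℓ (L s) ⊎ s ≡ ℓ (L s) + n
  lift-L {s} s< with s <? n
  ... | yes s<n = inj₁ (sym (ℓ-L s<n))
  ... | no  s≮n = inj₂ (trans (sym t+n) (cong (_+ n) (sym (trans (cong ℓ (trans (cong L (sym t+n)) (L-+n t))) (ℓ-L t<n)))))
    where
    t = s ∸ n
    t+n : t + n ≡ s
    t+n = m∸n+n≡m (≮⇒≥ s≮n)
    t<n : t < n
    t<n = +-cancelʳ-< n t n (≤-<-trans (≤-reflexive t+n) s<)

  lift-above : ∀ {a} → a < n → ∀ x → ∃ λ s → a ≤ s × s ≤ a + m × (s ≡ ℓ x ⊎ s ≡ ℓ x + n)
  lift-above {a} a<n x with a ≤? ℓ x
  ... | yes a≤ = ℓ x , a≤ , ≤-trans (≤-pred (ℓ< x)) (m≤n+m m a) , inj₁ refl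
  ... | no  a≰ = ℓ x + n , ≤-trans (<⇒≤ a<n) (m≤n+m n (ℓ x)) ,
                 ≤-trans (≤-reflexive (+-suc (ℓ x) m)) (+-monoˡ-≤ m (≰⇒> a≰)) , inj₂ refl

  module _ {k} {A : SetSystem n k} (intervals : ∀ j → IsInterval σ (A j)) (antichain : IsAntichain A) where
    private
      start : Fin k → Fin n
      start j = proj₁ (intervals j)
      len : Fin k → ℕ
      len j = proj₁ (proj₂ (intervals j))
      a b : Fin k → ℕ
      a j = ℓ (start j)
      -- The given length may exceed a whole turn; cut at `m`, the interval is the same set and
      -- meets each element once.
      b j = a j + (len j ⊓ m)

      iter-start : ∀ i j → iter σ i (start j) ≡ L (i + a j)
      iter-start i j = sym (trans (iter-+ i (a j) zero) (cong (iter σ i) (L-ℓ (start j))))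

      b< : ∀ j → b j < a j + n
      b< j = +-monoʳ-< (a j) (s≤s (m⊓n≤n (len j) m))

    Lifted : Fin k → Fin n → Set
    Lifted j x = ∃ λ s → a j ≤ s × s ≤ b j × (s ≡ ℓ x ⊎ s ≡ ℓ x + n)

    lifted : ∀ j x → A j x → Lifted j x
    lifted j x Ax with to (proj₂ (proj₂ (intervals j)) x) Ax
    ... | i , i≤ , eq with i ≤? m
    ...   | yes i≤m = i + a j , m≤n+m (a j) i , ≤-trans (≤-reflexive (+-comm i (a j))) (+-monoʳ-≤ (a j) (⊓-glb i≤ i≤m)) ,
              subst (λ y → i + a j ≡ ℓ y ⊎ i + a j ≡ ℓ y + n) (trans (sym (iter-start i j)) eq)
                (lift-L (≤-<-trans (+-monoˡ-≤ (a j) i≤m) (+-mono-< (n<1+n m) (ℓ< (start j)))))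
    ...   | no  i≰m = let s , a≤s , s≤ , at = lift-above (ℓ< (start j)) x in
              s , a≤s , ≤-trans s≤ (+-monoʳ-≤ (a j) (≤-reflexive (sym (m≥n⇒m⊓n≡n (≤-trans (<⇒≤ (≰⇒> i≰m)) i≤))))) , at

    unlifted : ∀ j x → Lifted j x → A j x
    unlifted j x (s , a≤s , s≤b , at) = from (proj₂ (proj₂ (intervals j)) x)
      (s ∸ a j , ≤-trans (m≤n+o⇒m∸n≤o s (a j) s≤b) (m⊓n≤m (len j) m) ,
       trans (iter-start (s ∸ a j) j) (trans (cong L (m∸n+n≡m a≤s)) (L-lift at)))

    ⊆-lifted : ∀ {i j} → i ≢ j → ¬ (∀ x → Lifted i x → Lifted j x)
    ⊆-lifted i≢j sub = antichain _ _ i≢j λ {x} Ax → unlifted _ x (sub x (lifted _ x Ax))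

    -- Ends out of order would make one lifted interval contain another, directly for `ordered` and
    -- after a shift by a turn for `unwound`. The antichain condition excludes both.
    lifted-intervals : Intervals n k
    lifted-intervals = record
      { first = a ; last = b ; first< = λ j → ℓ< (start j) ; first≤last = λ j → m≤m+n (a j) _ ; last< = b<
      ; ordered = λ {i} {j} i≢j a≤ → ≰⇒> λ b≤ → ⊆-lifted (i≢j ∘ sym)
          λ x (s , lo , hi , at) → s , ≤-trans a≤ lo , ≤-trans hi b≤ , at
      ; unwound = unwound′ }
      where
      unwound′ : ∀ i j → b i < b j + n
      unwound′ i j with i Fin.≟ j
      ... | yes refl = m<m+n (b i) z<s
      ... | no  i≢j  = ≰⇒> λ b≤ → ⊆-lifted (i≢j ∘ sym) λ where
          x (s , lo , hi , inj₁ eq) → s + n , ≤-trans (<⇒≤ (ℓ< (start i))) (m≤n+m n s) , ≤-trans (+-monoˡ-≤ n hi) b≤ , inj₂ (cong (_+ n) eq)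
          x (s , lo , hi , inj₂ refl) → contradiction (+-monoˡ-≤ n (ℓ< (start i)))
            (<⇒≱ (s≤s (≤-trans (+-monoˡ-≤ n (m≤n+m n (ℓ x))) (≤-trans (≤-trans (+-monoˡ-≤ n hi) b≤) (<⇒≤ (b< i))))))

from-multi-path : ∀ {n} {Ind : IndepPred n} → IsMultiPath Ind → Model Ind
from-multi-path {zero} {Ind} (_ , _ , _ , A , _ , _ , spec) = record
  { band = record { rank = 0 ; low = λ _ → 0 ; high = λ _ → 0 ; low-path = flat ; high-path = flat ; low≤high = λ _ _ → z≤n }
  ; label = λ () ; label< = λ () ; label-inj = λ { {()} }
  ; spec = λ { [] → mk⇔
      (λ _ → (λ _ → 0) , record { path = flat ; above = λ _ _ → z≤n ; below = λ _ _ → z≤n } , λ ())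
      (λ _ → from (spec []) ((λ ()) , (λ ()) , (λ ()))) } }
  where
  flat : Path 0 0 (λ _ → 0)
  flat = record { up = λ _ _ → z≤n ; lip = λ _ _ → z≤n ; turn = refl }
from-multi-path {suc m} {Ind} (σ , cyclic , k , A , intervals , antichain , spec) =
  model-resp (λ X → mk⇔ (λ t → from (spec X) (M-resp (unlifted intervals antichain) t)) (λ ind → M-resp (lifted intervals antichain) (to (spec X) ind)))
    (Transversals.interval-model (lifted-intervals intervals antichain) ℓ ℓ< ℓ-inj)
  where
  ret = Orbit.return σ
  open Cycle σ cyclic (proj₁ ret) (proj₁ (proj₂ ret)) (proj₂ (proj₂ ret))

abstract
  -- Two turns of the periodic extension. They suffice because an interval beginning in the first
  -- turn ends before the second is over.
  twice : ℕ → ℕ → (ℕ → ℕ) → ℕ → ℕ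
  twice n r h t with t ≤? n
  ... | yes _ = h t
  ... | no  _ = h (t ∸ n) + r

  twice-first : ∀ {n r h t} → t ≤ n → twice n r h t ≡ h t
  twice-first {n} {t = t} t≤n with t ≤? n
  ... | yes _   = refl
  ... | no  t≰n = contradiction t≤n t≰n

  twice-second : ∀ {n r h} → Path n r h → ∀ t → twice n r h (t + n) ≡ h t + r
  twice-second {n} {r} {h} H t with t + n ≤? n
  ... | no  _    = cong (λ s → h s + r) (m+n∸n≡m t n)
  ... | yes t+n≤ with n≤0⇒n≡0 (+-cancelʳ-≤ n t 0 t+n≤)
  ...   | refl = turn H

split-turn : ∀ {n t} → t < n + n → t < n ⊎ ∃ λ s → s < n × t ≡ s + n
split-turn {n} {t} t< with t <? n
... | yes t<n = inj₁ t<n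
... | no  t≮n = inj₂ (t ∸ n , +-cancelʳ-< n _ n (≤-<-trans (≤-reflexive (m∸n+n≡m (≮⇒≥ t≮n))) t<) , sym (m∸n+n≡m (≮⇒≥ t≮n)))

module _ {n r h} (H : Path n r h) where
  private
    ĥ = twice n r h

  twice-path : Path (n + n) (r + r) ĥ
  twice-path = record { up = up′ ; lip = lip′ ; turn = turn′ }
    where
    up′ : Rising (n + n) ĥ
    up′ t t< with split-turn {n} t<
    ... | inj₁ t<n rewrite twice-first {n} {r} {h} (<⇒≤ t<n) | twice-first {n} {r} {h} t<n = up H t t<n
    ... | inj₂ (s , s<n , refl) rewrite twice-second H s | twice-second H (suc s) = +-monoˡ-≤ r (up H s s<n)
    lip′ : Slow (n + n) ĥ
    lip′ t t< with split-turn {n} t<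
    ... | inj₁ t<n rewrite twice-first {n} {r} {h} (<⇒≤ t<n) | twice-first {n} {r} {h} t<n = lip H t t<n
    ... | inj₂ (s , s<n , refl) rewrite twice-second H s | twice-second H (suc s) = +-monoˡ-≤ r (lip H s s<n)
    turn′ : ĥ (n + n) ≡ ĥ 0 + (r + r)
    turn′ rewrite twice-second H n | twice-first {n} {r} {h} {0} z≤n | turn H = +-assoc (h 0) r r

-- Normalisation of the upper path

-- The last element of an interval is to come at least `d` positions before its first element
-- recurs. For the paths this means that the upper one is bounded by the lower one read `n − d`
-- positions later.
module Normalise {n} (B : Band n) (d : ℕ) (d≤r : d ≤ rank B) where
  private
    p = low B; q = high B; r = rank B; P = low-path B; Q = high-path B
    p̂ = twice n r p
    P̂ = twice-path P
    w = n ∸ d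
    w+d : w + d ≡ n
    w+d = m∸n+n≡m (≤-trans d≤r (r≤n P))
    w≤n : w ≤ n
    w≤n = m∸n≤m n d
    cap : ℕ → ℕ
    cap t = p̂ (t + w)
    bound : ∀ {t} → t ≤ n → t + w ≤ n + n
    bound t≤n = +-mono-≤ t≤n w≤n

  normal : Band n
  normal = record
    { rank = r ; low = p ; high = λ t → q t ⊓ cap t ; low-path = P
    ; high-path = ⊓-path (up Q) (lip Q) (λ t l → up P̂ (t + w) (bound l)) (λ t l → lip P̂ (t + w) (bound l))
        (trans (cong₂ _⊓_ (turn Q) (trans (cong p̂ (+-comm n w)) (trans (twice-second P w) (cong (_+ r) (sym (twice-first w≤n))))))
               (sym (+-distribʳ-⊓ r (q 0) (cap 0))))
    ; low≤high = λ t t≤n → ⊓-glb (low≤high B t t≤n)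
        (≤-trans (≤-reflexive (sym (twice-first t≤n))) (mono P̂ (m≤m+n t w) (bound t≤n))) }

  normal-high : ∀ t → t ≤ n → high normal t ≤ p̂ (t + w)
  normal-high t _ = m⊓n≤n (q t) (cap t)

  -- Where h exceeds the cap it has stayed strictly above p for a whole turn.
  module _ {h} (h∈ : h ∈ᵇ B) {t} (t≤n : t ≤ n) (over : cap t < h t) where
    private
      H = path h∈
      ĥ = twice n r h
      Ĥ = twice-path H

    ahead : ∀ s → t ≤ s → s ≤ t + n → p̂ s < ĥ s
    ahead s t≤s s≤ with s ≤? t + w
    ... | yes s≤u = ≤-<-trans (mono P̂ s≤u (bound t≤n))
            (<-≤-trans over (≤-trans (≤-reflexive (sym (twice-first t≤n))) (mono Ĥ t≤s (≤-trans s≤ (+-monoˡ-≤ n t≤n)))))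
    -- From `t + w` to `s` the lower path gains at most `s − t − w`, and `h` gains at most
    -- `t + n − s` after `s`. Together these are `d`, which the gain `r` of `h` over the turn
    -- absorbs.
    ... | no  s≰u = lin 9 (λ ps pu hs ht hw s u r d →
            ps ⊹ u ≼ pu ⊹ s ⊢ hw ⊹ s ≼ hs ⊹ (u ⊹ d) ⊢ hw ≐ ht ⊹ r ⊢ 𝕤 pu ≼ ht ⊢ d ≼ r ⊢ ∎ 𝕤 ps ≼ hs)
            (p̂ s) (p̂ (t + w)) (ĥ s) (h t) (ĥ (t + n)) s (t + w) r d
            (lipschitz P̂ (<⇒≤ (≰⇒> s≰u)) (≤-trans s≤ (+-monoˡ-≤ n t≤n)))
            (≤-trans (lipschitz Ĥ s≤ (+-monoˡ-≤ n t≤n)) (≤-reflexive (cong (ĥ s +_) (trans (cong (t +_) (sym w+d)) (sym (+-assoc t w d))))))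
            (twice-second H t) over d≤r

    clearance : ∀ s → s ≤ n → p s < h s
    clearance s s≤n with t ≤? s
    ... | yes t≤s = subst₂ _<_ (twice-first s≤n) (twice-first s≤n) (ahead s t≤s (≤-trans s≤n (m≤n+m n t)))
    ... | no t≰s  = +-cancelʳ-< r _ _ (subst₂ _<_ (twice-second P s) (twice-second H s)
                      (ahead (s + n) (≤-trans t≤n (m≤n+m n s)) (+-monoˡ-≤ n (<⇒≤ (≰⇒> t≰s)))))

  module _ {h} (h∈ : h ∈ᵇ B) (clear : ∀ s → s ≤ n → p s < h s) where
    private
      h⁻ : ∀ s → s ≤ n → suc (pred (h s)) ≡ h s
      h⁻ s s≤n = suc-pred (h s) {{>-nonZero (≤-<-trans z≤n (clear s s≤n))}}

    lower∈ : pred ∘ h ∈ᵇ B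
    lower∈ = record
      { path = record
          { up = λ t l → pred-mono-≤ (up (path h∈) t l)
          ; lip = λ t l → ≤-trans (pred-mono-≤ (lip (path h∈) t l)) (≤-reflexive (sym (h⁻ t (<⇒≤ l))))
          ; turn = suc-injective (trans (h⁻ n ≤-refl) (trans (turn (path h∈)) (cong (_+ r) (sym (h⁻ 0 z≤n))))) }
      ; above = λ t l → pred-mono-≤ (clear t l)
      ; below = λ t l → ≤-trans pred[n]≤n (below h∈ t l) }

    lower-step : ∀ t → t < n → Step h t → Step (pred ∘ h) t
    lower-step t l s = ≤-pred (subst₂ (λ a b → suc a ≤ b) (sym (h⁻ t (<⇒≤ l))) (sym (h⁻ (suc t) l)) s)

    lower-start : suc (pred (h 0)) ≡ h 0
    lower-start = h⁻ 0 z≤n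

  -- While `h` exceeds the cap somewhere it is clear of the lower path everywhere, so all of it can
  -- be lowered by one with its steps unchanged. The starting height bounds the number of rounds.
  normalise∈ : ∀ c {h} → h 0 ≤ c → h ∈ᵇ B → Σ (ℕ → ℕ) λ g → g ∈ᵇ normal × (∀ t → t < n → Step h t → Step g t)
  normalise∈ c {h} h0≤c h∈ with anyUpTo? (λ t → suc (cap t) ≤? h t) (suc n)
  ... | no none = h , record { path = path h∈ ; above = above h∈
                             ; below = λ t l → ⊓-glb (below h∈ t l) (≮⇒≥ λ over → none (t , s≤s l , over)) } , λ _ _ s → s
  normalise∈ zero    {h} h0≤c h∈ | yes (t , s≤s t≤n , over) =
    contradiction (≤-trans (clearance h∈ t≤n over 0 z≤n) h0≤c) λ ()
  normalise∈ (suc c) {h} h0≤c h∈ | yes (t , s≤s t≤n , over) =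
    let clear = clearance h∈ t≤n over
        g , g∈ , keep = normalise∈ c (≤-pred (≤-trans (≤-reflexive (lower-start h∈ clear)) h0≤c)) (lower∈ h∈ clear)
    in g , g∈ , λ t l s → keep t l (lower-step h∈ clear t l s)

  normal-model : ∀ {Ind : IndepPred n} (ℓ : Fin n → ℕ) → (∀ x → ℓ x < n) → (∀ X → Ind X ⇔ Spanned B ℓ X) → ∀ X → Ind X ⇔ Spanned normal ℓ X
  normal-model ℓ ℓ< spec X = mk⇔
    (λ ind → let h , h∈ , s = to (spec X) ind
                 g , g∈ , keep = normalise∈ _ ≤-refl h∈
             in g , g∈ , λ x x∈ → keep (ℓ x) (ℓ< x) (s x x∈))
    (λ (h , h∈ , s) → from (spec X) (h , record { path = path h∈ ; above = above h∈ ; below = λ t l → ≤-trans (below h∈ t l) (m⊓n≤m _ _) } , s))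

-- Reading intervals off a band

module _ {n} {B₁ B₂ : Band n} {c d : ℕ} (same-rank : rank B₁ ≡ rank B₂)
         (lows  : ∀ t → t ≤ n → low B₁ t + c ≡ low B₂ t + d)
         (highs : ∀ t → t ≤ n → high B₁ t + c ≡ high B₂ t + d) where
  private
    shift : (ℕ → ℕ) → ℕ → ℕ
    shift h t = (h t + c) ∸ d

  module _ {h} (h∈ : h ∈ᵇ B₁) where
    private
      H = path h∈
      shift≡ : ∀ t → t ≤ n → shift h t + d ≡ h t + c
      shift≡ t t≤n = m∸n+n≡m (lin 5 (λ l₁ l₂ h c d → l₁ ≼ h ⊢ l₁ ⊹ c ≐ l₂ ⊹ d ⊢ ∎ d ≼ h ⊹ c)
        (low B₁ t) (low B₂ t) (h t) c d (above h∈ t t≤n) (lows t t≤n))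

    shift∈ : shift h ∈ᵇ B₂
    shift∈ = record
      { path = record
          { up   = λ t l → ∸-monoˡ-≤ d (+-monoˡ-≤ c (up H t l))
          ; lip  = λ t l → ≤-trans (∸-monoˡ-≤ d (+-monoˡ-≤ c (lip H t l))) (suc-∸ (h t + c) d)
          ; turn = lin 7 (λ s s₀ h h₀ c d r → s ⊹ d ≐ h ⊹ c ⊢ s₀ ⊹ d ≐ h₀ ⊹ c ⊢ h ≐ h₀ ⊹ r ⊢ ∎ s ≐ s₀ ⊹ r)
              (shift h n) (shift h 0) (h n) (h 0) c d _ (shift≡ n ≤-refl) (shift≡ 0 z≤n) (trans (turn H) (cong (h 0 +_) same-rank)) }
      ; above = λ t l → lin 6 (λ s l₁ l₂ h c d → s ⊹ d ≐ h ⊹ c ⊢ l₁ ≼ h ⊢ l₁ ⊹ c ≐ l₂ ⊹ d ⊢ ∎ l₂ ≼ s)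
          (shift h t) (low B₁ t) (low B₂ t) (h t) c d (shift≡ t l) (above h∈ t l) (lows t l)
      ; below = λ t l → lin 6 (λ s l₁ l₂ h c d → s ⊹ d ≐ h ⊹ c ⊢ h ≼ l₁ ⊢ l₁ ⊹ c ≐ l₂ ⊹ d ⊢ ∎ s ≼ l₂)
          (shift h t) (high B₁ t) (high B₂ t) (h t) c d (shift≡ t l) (below h∈ t l) (highs t l) }

    shift-step : ∀ t → t < n → Step h t → Step (shift h) t
    shift-step t l s = lin 6 (λ s s′ h h′ c d → s ⊹ d ≐ h ⊹ c ⊢ s′ ⊹ d ≐ h′ ⊹ c ⊢ 𝕤 h ≼ h′ ⊢ ∎ 𝕤 s ≼ s′)
      (shift h t) (shift h (suc t)) (h t) (h (suc t)) c d (shift≡ t (<⇒≤ l)) (shift≡ (suc t) l) s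

  -- Only differences of heights matter. The two constants `c` and `d` express a shift that may go
  -- either way.
  shift-spanned : ∀ {ℓ X} → (∀ x → ℓ x < n) → Spanned B₁ ℓ X → Spanned B₂ ℓ X
  shift-spanned {ℓ} ℓ< (h , h∈ , s) = shift h , shift∈ h∈ , λ x x∈ → shift-step h∈ (ℓ x) (ℓ< x) (s x x∈)

-- The number of integers in `[c , c + r)` below `v`, that is, `v − c` clamped between 0 and `r`.
count-from : ℕ → ℕ → ℕ → ℕ
count-from r c v = sum {r} (λ j → χ (c + toℕ j) v)

count-from-suc : ∀ r c v → count-from (suc r) c v ≡ χ c v + count-from r (suc c) v
count-from-suc r c v = cong₂ _+_ (cong (λ x → χ x v) (+-identityʳ c))
  (sum-cong {r} λ j → cong (λ x → χ x v) (+-suc c (toℕ j)))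

count-none : ∀ r {c v} → v ≤ c → count-from r c v ≡ 0
count-none zero    v≤c = refl
count-none (suc r) {c} {v} v≤c rewrite count-from-suc r c v | χ-≥ v≤c = count-none r (m≤n⇒m≤1+n v≤c)

count-some : ∀ r {c v} → c ≤ v → v ≤ c + r → count-from r c v + c ≡ v
count-some zero    {c} c≤v v≤ = ≤-antisym c≤v (≤-trans v≤ (≤-reflexive (+-identityʳ c)))
count-some (suc r) {c} {v} c≤v v≤ with m≤n⇒m<n∨m≡n c≤v
... | inj₁ c<v rewrite count-from-suc r c v | χ-< c<v =
  trans (sym (+-suc _ c)) (count-some r c<v (≤-trans v≤ (≤-reflexive (+-suc c r))))
... | inj₂ refl rewrite count-none (suc r) {c} {c} ≤-refl = refl

count-all : ∀ r {c v} → c + r ≤ v → count-from r c v ≡ r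
count-all zero    _ = refl
count-all (suc r) {c} {v} le rewrite count-from-suc r c v | χ-< {c} {v} (≤-trans (≤-trans (≤-reflexive (+-comm 1 c)) (+-monoʳ-≤ c (s≤s z≤n))) le) =
  cong suc (count-all r (≤-trans (≤-reflexive (sym (+-suc c r))) le))

χ-cong : ∀ {x y s t} → (x < s → y < t) → (y < t → x < s) → χ x s ≡ χ y t
χ-cong {x} {y} {s} {t} f g = ≤-antisym (χ-imp {x} {y} {s} {t} f) (χ-imp {y} {x} {t} {s} g)

module _ {n r h} (H : Path n r h) where
  below-height : ∀ {s t} → s ≤ n → h s < h t → s < t
  below-height s≤n lt = ≰⇒> λ t≤s → contradiction (mono H t≤s s≤n) (<⇒≱ lt)

  level : ∀ {v} → h 0 ≤ v → v < h n → ∃ λ t → t < n × h t ≡ v × h (suc t) ≡ suc v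
  level {v} lo hi with crossing h n lo hi
  ... | t , t<n , ht≤v , v<ht′ = t , t<n ,
    ≤-antisym ht≤v (≤-pred (≤-trans v<ht′ (lip H t t<n))) ,
    ≤-antisym (≤-trans (lip H t t<n) (s≤s ht≤v)) v<ht′

-- Interval `j` runs from the step of the upper path at height `q 0 + j` to the step of the lower
-- path at the same height, which may fall in the second turn; the cap keeps it from falling later.
-- The bound `1 ≤ d` is asked only in the presence of an interval, as `d` is 0 in rank zero.
module Ends {n} (B : Band n) (d : ℕ) (d≤n : d ≤ n) (1≤d : ∀ (j : Fin (rank B)) → 1 ≤ d)
            (capped : ∀ t → t ≤ n → high B t ≤ twice n (rank B) (low B) (t + (n ∸ d))) where
  private
    p = low B; q = high B; r = rank B; P = low-path B; Q = high-path B
    p̂ = twice n r p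
    P̂ = twice-path P
    w = n ∸ d
    w+d : w + d ≡ n
    w+d = m∸n+n≡m d≤n
    p̂0 : p̂ 0 ≡ p 0
    p̂0 = twice-first z≤n
    p̂n : p̂ n ≡ p 0 + r
    p̂n = twice-second P 0
    q0≤ : q 0 ≤ p 0 + r
    q0≤ = ≤-trans (capped 0 z≤n) (≤-trans (mono P̂ (m∸n≤m n d) (m≤m+n n n)) (≤-reflexive p̂n))
    v : Fin r → ℕ
    v j = q 0 + toℕ j
    v< : ∀ j → v j < q 0 + r
    v< j = +-monoʳ-< (q 0) (Fin.toℕ<n j)
    q-level : ∀ j → ∃ λ t → t < n × q t ≡ v j × q (suc t) ≡ suc (v j)
    q-level j = level Q (m≤m+n (q 0) (toℕ j)) (<-≤-trans (v< j) (≤-reflexive (sym (turn Q))))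
    p-level : ∀ j → ∃ λ t → t < n + n × p̂ t ≡ v j × p̂ (suc t) ≡ suc (v j)
    p-level j = level P̂ (≤-trans (≤-reflexive p̂0) (≤-trans (low≤high B 0 z≤n) (m≤m+n (q 0) (toℕ j))))
      (lin 5 (λ v q₀ p₀ r p₂ → 𝕤 v ≼ q₀ ⊹ r ⊢ q₀ ≼ p₀ ⊹ r ⊢ p₂ ≐ p₀ ⊹ (r ⊹ r) ⊢ ∎ 𝕤 v ≼ p₂) (v j) (q 0) (p 0) r (p̂ (n + n))
        (v< j) q0≤ (trans (turn P̂) (cong (_+ (r + r)) p̂0)))
    a b : Fin r → ℕ
    a j = proj₁ (q-level j)
    b j = proj₁ (p-level j)
    a< : ∀ j → a j < n
    a< j = proj₁ (proj₂ (q-level j))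
    b< : ∀ j → b j < n + n
    b< j = proj₁ (proj₂ (p-level j))
    qa : ∀ j → q (a j) ≡ v j
    qa j = proj₁ (proj₂ (proj₂ (q-level j)))
    qa′ : ∀ j → q (suc (a j)) ≡ suc (v j)
    qa′ j = proj₂ (proj₂ (proj₂ (q-level j)))
    pb : ∀ j → p̂ (b j) ≡ v j
    pb j = proj₁ (proj₂ (proj₂ (p-level j)))
    pb′ : ∀ j → p̂ (suc (b j)) ≡ suc (v j)
    pb′ j = proj₂ (proj₂ (proj₂ (p-level j)))

    b<⇔ : ∀ j {t} → t ≤ n + n → (b j < t → v j < p̂ t) × (v j < p̂ t → b j < t)
    b<⇔ j t≤ = (λ lt → ≤-trans (≤-reflexive (sym (pb′ j))) (mono P̂ lt t≤)) ,
                λ lt → below-height P̂ (<⇒≤ (b< j)) (≤-<-trans (≤-reflexive (pb j)) lt)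

    a<⇔ : ∀ j {t} → t ≤ n → (a j < t → v j < q t) × (v j < q t → a j < t)
    a<⇔ j t≤ = (λ lt → ≤-trans (≤-reflexive (sym (qa′ j))) (mono Q lt t≤)) ,
                λ lt → below-height Q (<⇒≤ (a< j)) (≤-<-trans (≤-reflexive (qa j)) lt)

  last-capped : ∀ j → b j + d ≤ a j + n
  last-capped j = ≤-trans (+-monoˡ-≤ d (≤-pred (proj₂ (b<⇔ j (+-mono-≤ (a< j) (m∸n≤m n d)))
      (≤-trans (≤-reflexive (sym (qa′ j))) (capped (suc (a j)) (a< j))))))
    (≤-reflexive (trans (+-assoc (a j) w d) (cong (a j +_) w+d)))

  intervals : Intervals n r
  intervals = record
    { first = a ; last = b ; first< = a<
    ; first≤last = λ j → ≤-pred (below-height P̂ (≤-trans (<⇒≤ (a< j)) (m≤m+n n n))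
        (subst₂ _<_ (sym (twice-first (<⇒≤ (a< j)))) (sym (pb′ j)) (s≤s (≤-trans (low≤high B _ (<⇒≤ (a< j))) (≤-reflexive (qa j))))))
    ; last< = λ j → lin 4 (λ b a d n → b ⊹ d ≼ a ⊹ n ⊢ # 1 ≼ d ⊢ ∎ 𝕤 b ≼ a ⊹ n) (b j) (a j) d n (last-capped j) (1≤d j)
    ; ordered = λ {i} {j} i≢j a≤ → ≤-pred (below-height P̂ (b< i) (subst₂ _<_ (sym (pb′ i)) (sym (pb′ j))
        (s≤s (≤∧≢⇒< (subst₂ _≤_ (qa i) (qa j) (mono Q a≤ (<⇒≤ (a< j)))) λ eq → i≢j (Fin.toℕ-injective (+-cancelˡ-≡ (q 0) _ _ eq))))))
    ; unwound = unwound′ }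
    where
    unwound′ : ∀ i j → b i < b j + n
    unwound′ i j with b j ≤? n
    ... | yes b≤n = proj₂ (b<⇔ i (+-monoˡ-≤ n b≤n)) (<-≤-trans (v< i) (≤-trans (+-monoˡ-≤ r (m≤m+n (q 0) (toℕ j)))
                      (≤-reflexive (sym (trans (twice-second P (b j)) (cong (_+ r) (trans (sym (twice-first b≤n)) (pb j))))))))
    ... | no  b≰n = <-trans (b< i) (+-monoˡ-< n (≰⇒> b≰n))

  open Count n

  -- A first element lies before `t` exactly when its level lies below `q t`. Counting ends is then
  -- counting levels, which gives back the path up to a constant.
  high-heights : ∀ t → t ≤ n → q t + r ≡ height a t + q 0
  high-heights t t≤n = sym (trans (cong (_+ q 0) (trans (height≡ a t) (cong₂ _+_ (eq₁) eq₂)))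
    (lin 4 (λ c q₀ r qt → c ⊹ q₀ ≐ qt ⊢ ∎ c ⊹ r ⊹ q₀ ≐ qt ⊹ r) (count-from r (q 0) (q t)) (q 0) r (q t)
      (count-some r (mono Q z≤n t≤n) (≤-trans (mono Q t≤n ≤-refl) (≤-reflexive (turn Q))))))
    where
    eq₁ : cnt a t ≡ count-from r (q 0) (q t)
    eq₁ = sum-cong λ j → χ-cong {a j} (proj₁ (a<⇔ j t≤n)) (proj₂ (a<⇔ j t≤n))
    eq₂ : cnt a (t + n) ≡ r
    eq₂ = trans (sum-cong λ j → χ-cong {a j} {toℕ j} {t + n} {r} (λ _ → Fin.toℕ<n j) λ _ → <-≤-trans (a< j) (m≤n+m n t))
                (count-all r {0} ≤-refl)

  low-heights : ∀ t → t ≤ n → p t + r ≡ height b t + q 0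
  low-heights t t≤n = sym (trans (cong (_+ q 0) (trans (height≡ b t) (cong₂ _+_ eq₁ eq₂))) total)
    where
    eq₁ : cnt b t ≡ count-from r (q 0) (p t)
    eq₁ = sum-cong λ j → let f , g = b<⇔ j (≤-trans t≤n (m≤m+n n n)) in
      χ-cong {b j} {v j} {t} {p t} (λ lt → <-≤-trans (f lt) (≤-reflexive (twice-first t≤n))) (λ lt → g (<-≤-trans lt (≤-reflexive (sym (twice-first t≤n)))))
    eq₂ : cnt b (t + n) ≡ count-from r (q 0) (p t + r)
    eq₂ = sum-cong λ j → let f , g = b<⇔ j (+-monoˡ-≤ n t≤n) in
      χ-cong {b j} {v j} {t + n} {p t + r} (λ lt → <-≤-trans (f lt) (≤-reflexive (twice-second P t))) (λ lt → g (<-≤-trans lt (≤-reflexive (sym (twice-second P t)))))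
    total : count-from r (q 0) (p t) + count-from r (q 0) (p t + r) + q 0 ≡ p t + r
    -- The two turns share the levels: below `q 0` the first count vanishes, above it the second is
    -- full.
    total with ≤-total (p t) (q 0)
    ... | inj₁ le rewrite count-none r le =
      count-some r (≤-trans q0≤ (+-monoˡ-≤ r (mono P z≤n t≤n))) (+-monoˡ-≤ r le)
    ... | inj₂ ge rewrite count-all r {q 0} {p t + r} (+-monoˡ-≤ r ge) =
      lin 4 (λ c q₀ r pt → c ⊹ q₀ ≐ pt ⊢ ∎ c ⊹ r ⊹ q₀ ≐ pt ⊹ r) (count-from r (q 0) (p t)) (q 0) r (p t)
        (count-some r ge (≤-trans (low≤high B t t≤n) (≤-trans (mono Q t≤n ≤-refl) (≤-reflexive (turn Q)))))

  spanned⇔ : ∀ {ℓ X} → (∀ x → ℓ x < n) → Spanned B ℓ X ⇔ Spanned (interval-band intervals) ℓ X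
  spanned⇔ ℓ< = mk⇔
    (shift-spanned {B₁ = B} {interval-band intervals} {r} {q 0} refl low-heights high-heights ℓ<)
    (shift-spanned {B₁ = interval-band intervals} {B} {q 0} {r} refl (λ t l → sym (low-heights t l)) (λ t l → sym (high-heights t l)) ℓ<)

-- From positions back to a cyclic permutation and an antichain

previous : ℕ → ℕ → ℕ
previous m zero    = m
previous m (suc z) = z

previous< : ∀ {m z} → z < suc m → previous m z < suc m
previous< {z = zero}  _ = ≤-refl
previous< {z = suc z} l = <-trans (n<1+n z) l

next-previous : ∀ {m z} → z < suc m → next m (previous m z) ≡ z
next-previous {m} {zero} _ with m ≟ m
... | yes _   = refl
... | no m≢m  = contradiction refl m≢m
next-previous {m} {suc z} (s≤s z<m) with z ≟ m
... | yes refl = contradiction z<m (<-irrefl refl)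
... | no  _    = refl

previous-next : ∀ m z → previous m (next m z) ≡ z
previous-next m z with z ≟ m
... | yes refl = refl
... | no  _    = refl

module Labelled {m} (ℓ : Fin (suc m) → ℕ) (ℓ< : ∀ x → ℓ x < suc m) (ℓ-inj : Injective _≡_ _≡_ ℓ) where
  private
    n = suc m

  abstract
    at : ∀ {t} → t < n → Fin n
    at t<n = proj₁ (label-onto ℓ ℓ< ℓ-inj t<n)

    ℓ-at : ∀ {t} (t<n : t < n) → ℓ (at t<n) ≡ t
    ℓ-at t<n = proj₂ (label-onto ℓ ℓ< ℓ-inj t<n)

  σ : Permutation′ n
  σ = permutation (λ x → at (next< (ℓ< x))) (λ x → at (previous< (ℓ< x)))
    (λ x → ℓ-inj (trans (ℓ-at _) (trans (cong (next m) (ℓ-at _)) (next-previous (ℓ< x)))))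
    (λ x → ℓ-inj (trans (ℓ-at _) (trans (cong (previous m) (ℓ-at _)) (previous-next m (ℓ x)))))

  Lifts : ℕ → Fin n → Set
  Lifts s x = s ≡ ℓ x ⊎ s ≡ ℓ x + n

  lifts-unique : ∀ {s x y} → Lifts s x → Lifts s y → x ≡ y
  lifts-unique (inj₁ p) (inj₁ q) = ℓ-inj (trans (sym p) q)
  lifts-unique (inj₂ p) (inj₂ q) = ℓ-inj (+-cancelʳ-≡ n _ _ (trans (sym p) q))
  lifts-unique {x = x} {y} (inj₁ p) (inj₂ q) = contradiction (ℓ< x) (≤⇒≯ (≤-trans (m≤n+m n (ℓ y)) (≤-reflexive (trans (sym q) p))))
  lifts-unique {x = x} {y} (inj₂ p) (inj₁ q) = contradiction (ℓ< y) (≤⇒≯ (≤-trans (m≤n+m n (ℓ x)) (≤-reflexive (trans (sym p) q))))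

  lifted-at : ∀ {s} → s < n + n → ∃ (Lifts s)
  lifted-at s< with split-turn {n} s<
  ... | inj₁ s<n             = at s<n , inj₁ (sym (ℓ-at s<n))
  ... | inj₂ (t , t<n , eq)  = at t<n , inj₂ (trans eq (cong (_+ n) (sym (ℓ-at t<n))))

  iter-lifts : ∀ i x → ℓ x + i < n + n → Lifts (ℓ x + i) (iter σ i x)
  iter-lifts zero    x _ = inj₁ (+-identityʳ (ℓ x))
  iter-lifts (suc i) x l rewrite +-suc (ℓ x) i with iter-lifts i x (<-trans (n<1+n _) l) | ℓ-at (next< (ℓ< (iter σ i x)))
  ... | prev | e with ℓ (iter σ i x) ≟ m
  iter-lifts (suc i) x l | inj₁ p | e | yes z≡m = inj₂ (trans (cong suc (trans p z≡m)) (cong (_+ n) (sym e)))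
  iter-lifts (suc i) x l | inj₂ p | e | yes z≡m = contradiction l (<⇒≱ (s≤s (≤-reflexive (cong suc (sym (trans p (cong (_+ n) z≡m)))))))
  iter-lifts (suc i) x l | inj₁ p | e | no  z≢m = inj₁ (trans (cong suc p) (sym e))
  iter-lifts (suc i) x l | inj₂ p | e | no  z≢m = inj₂ (trans (cong suc p) (cong (_+ n) (sym e)))

  reach : ∀ {s x y} → ℓ x ≤ s → s < n + n → Lifts s y → iter σ (s ∸ ℓ x) x ≡ y
  reach {s} {x} x≤s s< at-y = lifts-unique (subst (λ t → Lifts t (iter σ (s ∸ ℓ x) x)) (m+[n∸m]≡n x≤s)
    (iter-lifts (s ∸ ℓ x) x (≤-<-trans (≤-reflexive (m+[n∸m]≡n x≤s)) s<))) at-y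

  σ-cyclic : IsCyclic σ
  σ-cyclic x y = ℓ y + n ∸ ℓ x , reach {ℓ y + n} (≤-trans (<⇒≤ (ℓ< x)) (m≤n+m n (ℓ y))) (+-monoˡ-< n (ℓ< y)) (inj₂ refl)

  module _ {k} (I : Intervals n k) where
    private
      a = first I
      b = last I

    covers-interval : ∀ j → IsInterval σ (Covers I ℓ j)
    covers-interval j = at (first< I j) , b j ∸ a j , λ x → mk⇔
      (λ (s , lo , hi , eq) → s ∸ a j , ∸-monoˡ-≤ (a j) hi ,
        subst (λ z → iter σ (s ∸ z) (at (first< I j)) ≡ x) ℓa (reach (≤-trans (≤-reflexive ℓa) lo) (≤-<-trans hi (last<n+n I j)) eq))
      (λ { (i , i≤ , refl) →
        let s≤b = ≤-trans (+-monoʳ-≤ (a j) i≤) (≤-reflexive (m+[n∸m]≡n (first≤last I j))) in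
        a j + i , m≤m+n (a j) i , s≤b ,
        subst (λ z → Lifts (z + i) (iter σ i (at (first< I j)))) ℓa
          (iter-lifts i _ (≤-<-trans (≤-trans (≤-reflexive (cong (_+ i) ℓa)) s≤b) (last<n+n I j))) })
      where
      ℓa : ℓ (at (first< I j)) ≡ a j
      ℓa = ℓ-at (first< I j)

    -- If the first element of interval i lies in interval j, then the
    -- element following the last one of interval j lies in interval i only.
    module _ (gap : ∀ {i j : Fin k} → i ≢ j → b j + 2 ≤ a j + n)
             {i j} (i≢j : i ≢ j) (sub : ∀ {x} → Covers I ℓ i x → Covers I ℓ j x) where
      starts-wrapped : ¬ (a i + n ≤ b j)
      starts-wrapped ai+n≤bj = escape (sub {at w<n} (w , ai≤w , w≤bi , inj₁ (sym (ℓ-at w<n))))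
        where
        w = suc (b j) ∸ n
        w+n : w + n ≡ suc (b j)
        w+n = m∸n+n≡m (≤-trans (m≤n+m n (a i)) (m≤n⇒m≤1+n ai+n≤bj))
        w<aj : w < a j
        -- The gap of two means that `j` misses an element, so the successor of its last element
        -- comes before its first one.
        w<aj = lin 4 (λ w n b a → w ⊹ n ≐ 𝕤 b ⊢ b ⊹ # 2 ≼ a ⊹ n ⊢ ∎ 𝕤 w ≼ a) w n (b j) (a j) w+n (gap i≢j)
        w<n : w < n
        w<n = <-trans w<aj (first< I j)
        ai≤w : a i ≤ w
        ai≤w = lin 4 (λ w n b a → w ⊹ n ≐ 𝕤 b ⊢ a ⊹ n ≼ b ⊢ ∎ a ≼ w) w n (b j) (a i) w+n ai+n≤bj
        w≤bi : w ≤ b i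
        w≤bi = lin 4 (λ w n b b′ → w ⊹ n ≐ 𝕤 b ⊢ 𝕤 b ≼ b′ ⊹ n ⊢ ∎ w ≼ b′) w n (b j) (b i) w+n (unwound I j i)
        escape : ¬ Covers I ℓ j (at w<n)
        escape (s , lo , hi , inj₁ eq) = contradiction (≤-trans lo (≤-reflexive (trans eq (ℓ-at w<n)))) (<⇒≱ w<aj)
        escape (s , lo , hi , inj₂ eq) = contradiction
          (≤-trans (≤-reflexive (sym (trans eq (trans (cong (_+ n) (ℓ-at w<n)) w+n)))) hi) 1+n≰n

      starts-inside : a j ≤ a i → ¬ (a i ≤ b j)
      starts-inside aj≤ai ai≤bj = escape (proj₂ y) (sub {proj₁ y} (suc (b j) , m≤n⇒m≤1+n ai≤bj , b<b , proj₂ y))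
        where
        b<b : b j < b i
        b<b = ordered I (i≢j ∘ sym) aj≤ai
        y = lifted-at (≤-<-trans b<b (last<n+n I i))
        escape : ∀ {x} → Lifts (suc (b j)) x → ¬ Covers I ℓ j x
        escape (inj₁ p) (s , lo , hi , inj₁ q) = contradiction (≤-trans (≤-reflexive (trans p (sym q))) hi) 1+n≰n
        escape (inj₂ p) (s , lo , hi , inj₂ q) = contradiction (≤-trans (≤-reflexive (trans p (sym q))) hi) 1+n≰n
        escape {x} (inj₁ p) (s , lo , hi , inj₂ q) = contradiction
          (≤-trans (≤-reflexive p) (≤-trans (m≤m+n (ℓ x) n) (≤-trans (≤-reflexive (sym q)) hi))) 1+n≰n
        escape {x} (inj₂ p) (s , lo , hi , inj₁ q) = contradiction
          (lin 5 (λ b a n s x → b ⊹ # 2 ≼ a ⊹ n ⊢ 𝕤 b ≐ x ⊹ n ⊢ a ≼ s ⊢ s ≐ x ⊢ ∎ # 1 ≼ # 0) (b j) (a j) n s (ℓ x) (gap i≢j) p lo q)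
          λ ()

      not-nested : Covers I ℓ j (at (first< I i)) → a i ≤ a j ⊎ a j ≤ a i → Empty.⊥
      not-nested (s , lo , hi , inj₂ eq) _ =
        starts-wrapped (≤-trans (≤-reflexive (sym (trans eq (cong (_+ n) (ℓ-at (first< I i)))))) hi)
      not-nested (s , lo , hi , inj₁ eq) (inj₁ ai≤aj) =
        i≢j (first-injective I i j (≤-antisym ai≤aj (≤-trans lo (≤-reflexive (trans eq (ℓ-at (first< I i)))))))
      not-nested (s , lo , hi , inj₁ eq) (inj₂ aj≤ai) =
        starts-inside aj≤ai (≤-trans (≤-reflexive (sym (trans eq (ℓ-at (first< I i))))) hi)

    -- An interval of a whole turn would contain every other one, and the gap rules it out. The gap
    -- is asked only if there are two intervals, since a single one may be the ground set.
    covers-antichain : (∀ {i j : Fin k} → i ≢ j → b j + 2 ≤ a j + n) → IsAntichain (Covers I ℓ)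
    covers-antichain gap i j i≢j sub = not-nested gap i≢j sub
      (sub (a i , ≤-refl , first≤last I i , inj₁ (sym (ℓ-at (first< I i))))) (≤-total (a i) (a j))

2⊓ : ∀ {r} → r ≢ 0 → 1 ≤ 2 ⊓ r
2⊓ {zero}        r≢0 = contradiction refl r≢0
2⊓ {suc zero}    _   = ≤-refl
2⊓ {suc (suc r)} _   = s≤s z≤n

Fin≢0 : ∀ {r} → Fin r → r ≢ 0
Fin≢0 () refl

distinct⇒2≤ : ∀ {r} {i j : Fin r} → i ≢ j → 2 ≤ r
distinct⇒2≤ {suc zero}    {zero} {zero} i≢j = contradiction refl i≢j
distinct⇒2≤ {suc (suc r)} _ = s≤s (s≤s z≤n)

to-multi-path : ∀ {n} {Ind : IndepPred n} → Model Ind → IsMultiPath Ind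
to-multi-path {zero} {Ind} M = Perm.id , (λ ()) , 0 , (λ ()) , (λ ()) , (λ ()) , λ { [] → mk⇔
  (λ _ → (λ ()) , (λ ()) , (λ ()))
  (λ _ → from (spec M []) (low (band M) , low∈ (band M) , λ ())) }
to-multi-path {suc m} {Ind} M =
  σ , σ-cyclic , r , Covers I ℓ , covers-interval I , covers-antichain I gap , λ X → mk⇔
    (λ ind → from (spec cover X) (to (E.spanned⇔ (label< M)) (to (N.normal-model ℓ (label< M) (spec M) X) ind)))
    (λ t → from (N.normal-model ℓ (label< M) (spec M) X) (from (E.spanned⇔ (label< M)) (to (spec cover X) t)))
  where
  ℓ = label M
  r = rank (band M)
  -- Normalising requires `d ≤ r`. From rank two on every interval has to miss an element; in rank
  -- one the gap 1 merely keeps the interval within a turn.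
  d = 2 ⊓ r
  d≤n : d ≤ suc m
  d≤n = ≤-trans (m⊓n≤n 2 r) (r≤n (low-path (band M)))
  module N = Normalise (band M) d (m⊓n≤n 2 r)
  module E = Ends N.normal d d≤n (λ j → 2⊓ (Fin≢0 j)) N.normal-high
  I = E.intervals
  cover : Model (M[ Covers I ℓ ])
  cover = Transversals.interval-model I ℓ (label< M) (label-inj M)
  open Labelled ℓ (label< M) (label-inj M)
  gap : ∀ {i j : Fin r} → i ≢ j → last I j + 2 ≤ first I j + suc m
  gap {i} {j} i≢j = ≤-trans (+-monoʳ-≤ (last I j) (≤-reflexive (sym (m≤n⇒m⊓n≡m (distinct⇒2≤ i≢j))))) (E.last-capped j)

-- Lattice path matroids as bands with equal starts

norths-rising : ∀ {n} (v : Vec Bool n) → Rising n (northsUpTo v)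
norths-rising (b ∷ v) zero    _       = z≤n
norths-rising (b ∷ v) (suc t) (s≤s l) = +-monoʳ-≤ (if b then 1 else 0) (norths-rising v t l)

norths-slow : ∀ {n} (v : Vec Bool n) → Slow n (northsUpTo v)
norths-slow (true ∷ v)  zero    _       = s≤s z≤n
norths-slow (false ∷ v) zero    _       = z≤n
norths-slow (b ∷ v)     (suc t) (s≤s l) =
  ≤-trans (+-monoʳ-≤ (if b then 1 else 0) (norths-slow v t l)) (≤-reflexive (+-suc (if b then 1 else 0) _))

norths-lookup : ∀ {n} (v : Vec Bool n) j → lookup v j ≡ true → northsUpTo v (suc (toℕ j)) ≡ suc (northsUpTo v (toℕ j))
norths-lookup (true ∷ v) zero    refl = refl
norths-lookup (b ∷ v)    (suc j) eq   = trans (cong ((if b then 1 else 0) +_) (norths-lookup v j eq)) (+-suc (if b then 1 else 0) _)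

-- `NotAbove` compares paths at every natural number, hence also past their end.
norths-end : ∀ {n} (v : Vec Bool n) {t} → n ≤ t → northsUpTo v t ≡ northsUpTo v n
norths-end []      {zero}  _       = refl
norths-end []      {suc t} _       = refl
norths-end (b ∷ v) {suc t} (s≤s l) = cong ((if b then 1 else 0) +_) (norths-end v l)

bits : ∀ n → (ℕ → ℕ) → Vec Bool n
bits n h = tabulate (λ j → does (Step? h (toℕ j)))

norths-bits : ∀ {n h} → Rising n h → Slow n h → ∀ {t} → t ≤ n → northsUpTo (bits n h) t + h 0 ≡ h t
norths-bits ri sl {zero} _ = refl
norths-bits {suc n} {h} ri sl {suc t} (s≤s l) with increase? (h 0) (h 1) | norths-bits {n} {h ∘ suc} (λ t l → ri (suc t) (s≤s l)) (λ t l → sl (suc t) (s≤s l)) l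
... | yes st | eq = trans (sym (+-suc _ (h 0))) (trans (cong (northsUpTo (bits n (h ∘ suc)) t +_) (≤-antisym st (sl 0 z<s))) eq)
... | no ¬st | eq = trans (cong (northsUpTo (bits n (h ∘ suc)) t +_) (≤-antisym (ri 0 z<s) (≮⇒≥ ¬st))) eq

module LatticePaths (m r : ℕ) (P Q : Vec Bool (m + r)) (isP : IsLatticePath m r P) (isQ : IsLatticePath m r Q)
                    (P≤Q : NotAbove P Q) where
  private
    n = m + r
    p = northsUpTo P
    q = northsUpTo Q

  P-path : Path n r p
  P-path = record { up = norths-rising P ; lip = norths-slow P ; turn = isP }

  Q-path : Path n r q
  Q-path = record { up = norths-rising Q ; lip = norths-slow Q ; turn = isQ }

  -- The path whose i-th north step is j: a single step there, clamped
  -- between P and Q.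
  module Through (i : Fin r) (j : Fin n) (lo : p (toℕ j) ≤ toℕ i) (hi : toℕ i < q (suc (toℕ j))) where
    private
      step : ℕ → ℕ
      step t = toℕ i + χ (toℕ j) t
      h : ℕ → ℕ
      h t = p t ⊔ (q t ⊓ step t)

    h-path : Path n r h
    h-path = record
      { up   = λ t l → ⊔-mono-≤ (norths-rising P t l) (⊓-mono-≤ (norths-rising Q t l) (+-monoʳ-≤ (toℕ i) (χ-up (toℕ j) t)))
      ; lip  = λ t l → ⊔-mono-≤ (norths-slow P t l) (⊓-mono-≤ (norths-slow Q t l)
          (≤-trans (+-monoʳ-≤ (toℕ i) (≤-trans (χ≤1 (toℕ j) (suc t)) (s≤s z≤n))) (≤-reflexive (+-suc (toℕ i) (χ (toℕ j) t)))))
      ; turn = trans (m≥n⇒m⊔n≡m (≤-trans (m⊓n≤m (q n) _) (≤-reflexive (trans isQ (sym isP))))) isP }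

    R : Vec Bool n
    R = bits n h

    norths-R : ∀ {t} → t ≤ n → northsUpTo R t ≡ h t
    norths-R t≤n = trans (sym (+-identityʳ _)) (norths-bits (up h-path) (lip h-path) t≤n)

    h-j : h (toℕ j) ≡ toℕ i
    h-j rewrite χ-≥ {toℕ j} {toℕ j} ≤-refl | +-identityʳ (toℕ i) =
      trans (cong (p (toℕ j) ⊔_) (m≥n⇒m⊓n≡n (≤-pred (≤-trans hi (norths-slow Q (toℕ j) (Fin.toℕ<n j)))))) (m≤n⇒m⊔n≡n lo)

    h-j′ : h (suc (toℕ j)) ≡ suc (toℕ i)
    h-j′ rewrite χ-< {toℕ j} {suc (toℕ j)} ≤-refl | +-comm (toℕ i) 1 =
      trans (cong (p (suc (toℕ j)) ⊔_) (m≥n⇒m⊓n≡n hi)) (m≤n⇒m⊔n≡n (≤-trans (norths-slow P (toℕ j) (Fin.toℕ<n j)) (s≤s lo)))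

    between : NotAbove P R × NotAbove R Q
    between = below-R , above-R
      where
      below-R : NotAbove P R
      below-R t with t ≤? n
      ... | yes t≤n = ≤-trans (m≤m⊔n (p t) _) (≤-reflexive (sym (norths-R t≤n)))
      ... | no  t≰n rewrite norths-end P (<⇒≤ (≰⇒> t≰n)) | norths-end R (<⇒≤ (≰⇒> t≰n)) =
        ≤-trans (m≤m⊔n (p n) _) (≤-reflexive (sym (norths-R ≤-refl)))
      above-R : NotAbove R Q
      above-R t with t ≤? n
      ... | yes t≤n = ≤-trans (≤-reflexive (norths-R t≤n)) (⊔-lub (P≤Q t) (m⊓n≤m (q t) _))
      ... | no  t≰n rewrite norths-end Q (<⇒≤ (≰⇒> t≰n)) | norths-end R (<⇒≤ (≰⇒> t≰n)) =
        ≤-trans (≤-reflexive (norths-R ≤-refl)) (⊔-lub (P≤Q n) (m⊓n≤m (q n) _))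

    through : Nset m r P Q i j
    through = R , trans (norths-R ≤-refl) (turn h-path) , proj₁ between , proj₂ between ,
      trans (lookup∘tabulate _ j) (dec-true (Step? h (toℕ j)) (≤-reflexive (trans (cong suc h-j) (sym h-j′)))) ,
      trans (norths-R (Fin.toℕ<n j)) h-j′

  -- The bounds are necessary because the path goes from height `i` to `suc i` at `j`; `Through`
  -- builds a path showing that they suffice.
  Nset⇔ : ∀ i j → Nset m r P Q i j ⇔ (p (toℕ j) ≤ toℕ i × toℕ i < q (suc (toℕ j)))
  Nset⇔ i j = mk⇔
    (λ (R , _ , P≤R , R≤Q , north , at) →
      ≤-trans (P≤R (toℕ j)) (≤-reflexive (suc-injective (trans (sym (norths-lookup R j north)) at))) ,
      ≤-trans (≤-reflexive (sym at)) (R≤Q (suc (toℕ j))))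
    (λ (lo , hi) → Through.through i j lo hi)

  private
    q-level : ∀ (i : Fin r) → ∃ λ t → t < n × q t ≡ toℕ i × q (suc t) ≡ suc (toℕ i)
    q-level i = level Q-path z≤n (<-≤-trans (Fin.toℕ<n i) (≤-reflexive (sym isQ)))
    p-level : ∀ (i : Fin r) → ∃ λ t → t < n × p t ≡ toℕ i × p (suc t) ≡ suc (toℕ i)
    p-level i = level P-path z≤n (<-≤-trans (Fin.toℕ<n i) (≤-reflexive (sym isP)))
    a b : Fin r → ℕ
    a i = proj₁ (q-level i)
    b i = proj₁ (p-level i)
    a< : ∀ i → a i < n
    a< i = proj₁ (proj₂ (q-level i))
    b< : ∀ i → b i < n
    b< i = proj₁ (proj₂ (p-level i))
    qa : ∀ i → q (a i) ≡ toℕ i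
    qa i = proj₁ (proj₂ (proj₂ (q-level i)))
    qa′ : ∀ i → q (suc (a i)) ≡ suc (toℕ i)
    qa′ i = proj₂ (proj₂ (proj₂ (q-level i)))
    pb : ∀ i → p (b i) ≡ toℕ i
    pb i = proj₁ (proj₂ (proj₂ (p-level i)))
    pb′ : ∀ i → p (suc (b i)) ≡ suc (toℕ i)
    pb′ i = proj₂ (proj₂ (proj₂ (p-level i)))

  intervals : Intervals n r
  intervals = record
    { first = a ; last = b ; first< = a<
    ; first≤last = λ i → ≤-pred (below-height P-path (<⇒≤ (a< i))
        (<-≤-trans (s≤s (≤-trans (P≤Q (a i)) (≤-reflexive (qa i)))) (≤-reflexive (sym (pb′ i)))))
    ; last< = λ i → <-≤-trans (b< i) (m≤n+m n (a i))
    ; ordered = λ {i} {j} i≢j a≤ → below-height P-path (<⇒≤ (b< i)) (subst₂ _<_ (sym (pb i)) (sym (pb j))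
        (≤∧≢⇒< (subst₂ _≤_ (qa i) (qa j) (mono Q-path a≤ (<⇒≤ (a< j)))) (i≢j ∘ Fin.toℕ-injective)))
    ; unwound = λ i j → <-≤-trans (b< i) (m≤n+m n (b j)) }

  Nset⇔Covers : ∀ i j → Nset m r P Q i j ⇔ Covers intervals toℕ i j
  Nset⇔Covers i j = mk⇔
    (λ Nij → let lo , hi = to (Nset⇔ i j) Nij in
      toℕ j ,
      ≤-pred (below-height Q-path (<⇒≤ (a< i)) (≤-<-trans (≤-reflexive (qa i)) hi)) ,
      ≤-pred (below-height P-path (<⇒≤ (Fin.toℕ<n j)) (≤-<-trans lo (≤-reflexive (sym (pb′ i))))) ,
      inj₁ refl)
    λ where
      (_ , lo , hi , inj₁ refl) → from (Nset⇔ i j)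
        ( ≤-trans (mono P-path hi (<⇒≤ (b< i))) (≤-reflexive (pb i))
        , ≤-trans (≤-reflexive (sym (qa′ i))) (mono Q-path (s≤s lo) (Fin.toℕ<n j)))
      (_ , lo , hi , inj₂ refl) → contradiction (≤-trans (m≤n+m n (toℕ j)) hi) (<⇒≱ (b< i))

  -- No interval passes the end of the turn, so every first and every last element counts exactly
  -- once at 0.
  equal-starts : low (interval-band intervals) 0 ≡ high (interval-band intervals) 0
  equal-starts = sum-cong λ i → cong₂ _+_ (trans (χ-≥ {b i} z≤n) (sym (χ-≥ {a i} z≤n))) (trans (χ-< (b< i)) (sym (χ-< (a< i))))

module _ {n n′ k} (φ : Permutation n n′) {A : SetSystem n k} {A′ : SetSystem n′ k} where
  preimage : Subset n → Subset n′
  preimage X = tabulate (λ y → lookup X (φ ⟨$⟩ˡ y))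

  ∈-preimage : ∀ X x → x ∈ X ⇔ (φ ⟨$⟩ʳ x) ∈ preimage X
  ∈-preimage X x = mk⇔
    (λ x∈ → lookup⇒[]= _ _ (trans (lookup∘tabulate _ (φ ⟨$⟩ʳ x)) (trans (cong (lookup X) (inverseˡ φ)) ([]=⇒lookup x∈))))
    (λ y∈ → lookup⇒[]= x X (trans (cong (lookup X) (sym (inverseˡ φ))) (trans (sym (lookup∘tabulate _ (φ ⟨$⟩ʳ x))) ([]=⇒lookup y∈))))

  transport-transversal : (∀ j x → A j x ⇔ A′ j (φ ⟨$⟩ʳ x)) → ∀ X → M[ A′ ] (preimage X) ⇔ M[ A ] X
  transport-transversal A⇔A′ X = mk⇔
    (λ (f , inj , mem) →
      (λ x x∈ → f (φ ⟨$⟩ʳ x) (to (∈-preimage X x) x∈)) ,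
      (λ x y x∈ y∈ eq → trans (sym (inverseˡ φ)) (trans (cong (φ ⟨$⟩ˡ_) (inj _ _ _ _ eq)) (inverseˡ φ))) ,
      λ x x∈ → from (A⇔A′ _ x) (mem _ _))
    (λ (f , inj , mem) →
      (λ y y∈ → f (φ ⟨$⟩ˡ y) (back y y∈)) ,
      (λ x y x∈ y∈ eq → trans (sym (inverseʳ φ)) (trans (cong (φ ⟨$⟩ʳ_) (inj _ _ _ _ eq)) (inverseʳ φ))) ,
      λ y y∈ → subst (A′ _) (inverseʳ φ) (to (A⇔A′ _ _) (mem _ (back y y∈))))
    where
    back : ∀ y → y ∈ preimage X → (φ ⟨$⟩ˡ y) ∈ X
    back y y∈ = from (∈-preimage X _) (subst (_∈ preimage X) (sym (inverseʳ φ)) y∈)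

from-lattice-path : ∀ {n} {Ind : IndepPred n} → IsLatticePathMatroid Ind → Σ (Model Ind) λ M → low (band M) 0 ≡ high (band M) 0
from-lattice-path {n} {Ind} (m , r , P , Q , isP , isQ , P≤Q , φ , iso) = relabel (↔⇒≡ φ) φ iso
  where
  open LatticePaths m r P Q isP isQ P≤Q
  -- With the size generalised, the equality `n ≡ m + r` coming from the bijection can be matched
  -- against `refl`.
  relabel : ∀ {n} {Ind : IndepPred n} → n ≡ m + r → (φ : Permutation n (m + r)) →
            (∀ X Y → (∀ x → x ∈ X ⇔ (φ ⟨$⟩ʳ x) ∈ Y) → (Ind X ⇔ M[_,_] {m} {r} P Q Y)) →
            Σ (Model Ind) λ M → low (band M) 0 ≡ high (band M) 0
  relabel {Ind = Ind} refl φ iso = model-resp Ind⇔ (Transversals.interval-model intervals ℓ (λ x → Fin.toℕ<n (φ ⟨$⟩ʳ x)) ℓ-inj) , equal-starts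
    where
    ℓ : Fin (m + r) → ℕ
    ℓ x = toℕ (φ ⟨$⟩ʳ x)
    ℓ-inj : Injective _≡_ _≡_ ℓ
    ℓ-inj eq = trans (sym (inverseˡ φ)) (trans (cong (φ ⟨$⟩ˡ_) (Fin.toℕ-injective eq)) (inverseˡ φ))
    Ind⇔ : ∀ X → M[ Covers intervals ℓ ] X ⇔ Ind X
    Ind⇔ X = mk⇔
      (λ t → from (iso X _ (∈-preimage φ {Covers intervals ℓ} {Nset m r P Q} X)) (from (tr X) t))
      (λ ind → to (tr X) (to (iso X _ (∈-preimage φ {Covers intervals ℓ} {Nset m r P Q} X)) ind))
      where
      tr = transport-transversal φ {Covers intervals ℓ} {Nset m r P Q}
             (λ i x → mk⇔ (from (Nset⇔Covers i (φ ⟨$⟩ʳ x))) (to (Nset⇔Covers i (φ ⟨$⟩ʳ x))))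

χ-decreases : ∀ {x y t} → χ y t < χ x t → x < y
χ-decreases {x} {y} {t} lt with x <? t | y <? t
... | yes x<t | no y≮t = <-≤-trans x<t (≮⇒≥ y≮t)
... | yes x<t | yes y<t = contradiction (≤-trans lt (≤-reflexive (trans (χ-< x<t) (sym (χ-< y<t))))) 1+n≰n
... | no x≮t  | _       = contradiction (≤-trans lt (≤-reflexive (χ-≥ (≮⇒≥ x≮t)))) λ ()

image? : ∀ {k n} (T : Fin k → Fin n) x → Dec (∃ λ i → T i ≡ x)
image? T x = Fin.any? (λ i → T i Fin.≟ x)

-- Sets of a given size enter as images of injections: an exchange is then an update at one index,
-- and it affects a single summand of the count.
image : ∀ {k n} → (Fin k → Fin n) → Subset n
image T = ⟪ image? T ⟫

∈-image : ∀ {k n} (T : Fin k → Fin n) i → T i ∈ image T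
∈-image T i = ∈⟪⟫⁺ (image? T) (i , refl)

update-injective : ∀ {k n} {f : Fin k → Fin n} {z w} → Injective _≡_ _≡_ f → (∀ i → f i ≢ w) → Injective _≡_ _≡_ (f [ z ↦ w ])
update-injective {z = z} inj new {i} {j} eq with i Fin.≟ z | j Fin.≟ z
... | yes i≡z | yes j≡z = trans i≡z (sym j≡z)
... | yes _   | no  _   = contradiction (sym eq) (new j)
... | no  _   | yes _   = contradiction eq (new i)
... | no  _   | no  _   = inj eq

-- Exchange-rigid dependent sets of a lattice path matroid

module LabelCount {n} {Ind : IndepPred n} (M : Model Ind) {r} {T : Fin r → Fin n} (T-inj : Injective _≡_ _≡_ T) where
    open Count n using (cnt)
    private
      ℓ = label M
      τ : Fin r → ℕ
      τ = ℓ ∘ T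

    count-full : cnt τ n ≡ r
    count-full = trans (sum-cong λ i → trans (χ-< (label< M (T i))) (sym (χ-< (Fin.toℕ<n i)))) (count-all r {0} {r} ≤-refl)

    count-empty : cnt τ 0 ≡ 0
    count-empty = trans (sum-cong {r} λ i → trans (χ-≥ {τ i} {0} z≤n) (sym (χ-≥ {toℕ i} {0} z≤n))) (count-none r {0} {0} z≤n)

    count-path : Path n r (cnt τ)
    count-path = record
      { up   = λ t _ → sum-mono λ i → χ-up (τ i) t
      ; lip  = λ t _ → sum-slow (λ i → ≤-trans (χ≤1 (τ i) (suc t)) (s≤s z≤n))
                 λ i j u v → T-inj (label-inj M (trans (χ-jump {τ i} u) (sym (χ-jump {τ j} v))))
      ; turn = trans count-full (cong (_+ r) (sym count-empty)) }

    count-step : ∀ {t} → Step (cnt τ) t → ∃ λ i → τ i ≡ t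
    count-step st = let i , jump = sum-<⇒∃ {r} st in i , χ-jump {τ i} jump

    step-count : ∀ i → Step (cnt τ) (τ i)
    step-count i = sum-strict (λ j → χ-up (τ j) (τ i)) i (subst₂ _<_ (sym (χ-≥ {τ i} ≤-refl)) (sym (χ-< {τ i} ≤-refl)) (s≤s z≤n))

    path-dominates : ∀ {h} → (∀ x → x ∈ image T → Step h (ℓ x)) → Dominates n h (cnt τ)
    path-dominates {h} s t t<n st with count-step st
    ... | i , refl = s (T i) (∈-image T i)

    independent⇒≤rank : Ind (image T) → r ≤ rank (band M)
    independent⇒≤rank ind with to (spec M _) ind
    ... | h , h∈ , s = lin 6 (λ cn c₀ hn h₀ k r → cn ⊹ h₀ ≼ hn ⊹ c₀ ⊢ cn ≐ r ⊢ c₀ ≐ # 0 ⊢ hn ≐ h₀ ⊹ k ⊢ ∎ r ≼ k)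
      (cnt τ n) (cnt τ 0) (h n) (h 0) (rank (band M)) r
      (gap-≤ count-path (path h∈) (path-dominates s) z≤n ≤-refl) count-full count-empty (turn (path h∈))

module Rigid {n} {Ind : IndepPred n} (M : Model Ind) (equal : low (band M) 0 ≡ high (band M) 0) where
  open Count n using (cnt)
  private
    B = band M; r = rank B; ℓ = label M; p = low B; q = high B

  module _ {T : Fin r → Fin n} (T-inj : Injective _≡_ _≡_ T) where
    open LabelCount M T-inj
    private
      τ : Fin r → ℕ
      τ = ℓ ∘ T

    module _ (ind : Ind (image T)) where
      private
        h = proj₁ (to (spec M _) ind)
        h∈ : h ∈ᵇ B
        h∈ = proj₁ (proj₂ (to (spec M _) ind))
        dominates : Dominates n h (cnt τ)
        dominates = path-dominates (proj₂ (proj₂ (to (spec M _) ind)))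

      h0≡p0 : h 0 ≡ p 0
      h0≡p0 = ≤-antisym (≤-trans (below h∈ 0 z≤n) (≤-reflexive (sym equal))) (above h∈ 0 z≤n)

      count-≤-high : ∀ {t} → t ≤ n → cnt τ t + p 0 ≤ q t
      count-≤-high {t} t≤n = lin 6 (λ c h₀ p₀ h q c₀ → c ⊹ h₀ ≼ h ⊹ c₀ ⊢ h₀ ≐ p₀ ⊢ h ≼ q ⊢ c₀ ≐ # 0 ⊢ ∎ c ⊹ p₀ ≼ q)
        (cnt τ t) (h 0) (p 0) (h t) (q t) (cnt τ 0)
        (gap-≤ count-path (path h∈) dominates z≤n t≤n) h0≡p0 (below h∈ t t≤n) count-empty

      low-≤-count : ∀ {t} → t ≤ n → p t ≤ cnt τ t + p 0
      low-≤-count {t} t≤n = lin 8 (λ cn ct hn ht h₀ p₀ p r →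
          cn ⊹ ht ≼ hn ⊹ ct ⊢ hn ≐ h₀ ⊹ r ⊢ cn ≐ r ⊢ h₀ ≐ p₀ ⊢ p ≼ ht ⊢ ∎ p ≼ ct ⊹ p₀)
        (cnt τ n) (cnt τ t) (h n) (h t) (h 0) (p 0) (p t) r
        (gap-≤ count-path (path h∈) dominates t≤n ≤-refl) (turn (path h∈)) count-full h0≡p0 (above h∈ t t≤n)

    -- With the start fixed, a set of rank size has only one candidate path, its own count raised by
    -- `p 0`. Dependence means that this path leaves the band somewhere.
    violation : ¬ Ind (image T) → ∃ λ t → t ≤ n × (q t < cnt τ t + p 0 ⊎ cnt τ t + p 0 < p t)
    violation dep with anyUpTo? (λ t → (suc (q t) ≤? cnt τ t + p 0) ⊎-dec (suc (cnt τ t + p 0) ≤? p t)) (suc n)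
    ... | yes (t , s≤s t≤n , bad) = t , t≤n , bad
    ... | no fine = contradiction (from (spec M _) (g , g∈ , steps-g)) dep
      where
      g : ℕ → ℕ
      g t = cnt τ t + p 0
      g∈ : g ∈ᵇ B
      g∈ = record
        { path  = record
            { up = λ t l → +-monoˡ-≤ (p 0) (up count-path t l) ; lip = λ t l → +-monoˡ-≤ (p 0) (lip count-path t l)
            ; turn = lin 4 (λ c c₀ r p → c ≐ c₀ ⊹ r ⊢ ∎ c ⊹ p ≐ c₀ ⊹ p ⊹ r) (cnt τ n) (cnt τ 0) r (p 0) (turn count-path) }
        ; above = λ t l → ≮⇒≥ λ bad → fine (t , s≤s l , inj₂ bad)
        ; below = λ t l → ≮⇒≥ λ bad → fine (t , s≤s l , inj₁ bad) }
      steps-g : ∀ x → x ∈ image T → Step g (ℓ x)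
      steps-g x x∈ with ∈⟪⟫⁻ (image? T) x∈
      ... | i , refl = +-monoˡ-< (p 0) (step-count i)

  module _ {T : Fin r → Fin n} (T-inj : Injective _≡_ _≡_ T) (dep : ¬ Ind (image T))
           (swap : ∀ z w → (∀ i → T i ≢ w) → Ind (image (T [ z ↦ w ]))) where
    private
      τ : Fin r → ℕ
      τ = ℓ ∘ T
      τ′ : Fin r → Fin n → Fin r → ℕ
      τ′ z w = ℓ ∘ (T [ z ↦ w ])

    swap-count-≤ : ∀ z w t → χ (ℓ w) t ≤ χ (τ z) t → cnt (τ′ z w) t ≤ cnt τ t
    swap-count-≤ z w t le = sum-mono {r} pointwise
      where
      pointwise : ∀ i → χ (τ′ z w i) t ≤ χ (τ i) t
      pointwise i with i Fin.≟ z
      ... | yes refl = le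
      ... | no  _    = ≤-refl

    swap-count-≥ : ∀ z w t → χ (τ z) t ≤ χ (ℓ w) t → cnt τ t ≤ cnt (τ′ z w) t
    swap-count-≥ z w t le = sum-mono {r} pointwise
      where
      pointwise : ∀ i → χ (τ i) t ≤ χ (τ′ z w i) t
      pointwise i with i Fin.≟ z
      ... | yes refl = le
      ... | no  _    = ≤-refl

    -- Every exchange has to repair the violation at the same position `t`. If the count is too
    -- large there, the removed element lies before `t` and the added one does not; if it is too
    -- small, the reverse holds.
    initial-or-final : (∀ z w → (∀ i → T i ≢ w) → τ z < ℓ w) ⊎ (∀ z w → (∀ i → T i ≢ w) → ℓ w < τ z)
    initial-or-final with violation T-inj dep
    ... | t , t≤n , inj₁ over = inj₁ λ z w new → χ-decreases {t = t} (≰⇒> λ le → contradiction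
            (≤-trans (+-monoˡ-≤ (p 0) (swap-count-≥ z w t le)) (count-≤-high (update-injective T-inj new) (swap z w new) t≤n)) (<⇒≱ over))
    ... | t , t≤n , inj₂ under = inj₂ λ z w new → χ-decreases {t = t} (≰⇒> λ le → contradiction
            (≤-trans (low-≤-count (update-injective T-inj new) (swap z w new) t≤n) (+-monoˡ-≤ (p 0) (swap-count-≤ z w t le))) (<⇒≱ under))

-- The 3-whirl

-- On the hexagon the intervals are {0,1,2}, {2,3,4} and {4,5,0}. The third passes the end of the
-- turn, so its last element is lifted to 6.
whirl-intervals : Intervals 6 3
whirl-intervals = record
  { first = first′ ; last = last′
  ; first< = from-yes (Fin.all? λ j → first′ j <? 6)
  ; first≤last = from-yes (Fin.all? λ j → first′ j ≤? last′ j)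
  ; last< = from-yes (Fin.all? λ j → last′ j <? first′ j + 6)
  ; ordered = λ {i} {j} → from-yes (Fin.all? λ i → Fin.all? λ j → ¬? (i Fin.≟ j) →-dec ((first′ i ≤? first′ j) →-dec (last′ i <? last′ j))) i j
  ; unwound = from-yes (Fin.all? λ i → Fin.all? λ j → last′ i <? last′ j + 6) }
  where
  first′ last′ : Fin 3 → ℕ
  first′ j = 2 * toℕ j
  last′ j = 2 + 2 * toℕ j

Whirl : IndepPred 6
Whirl = M[ Covers whirl-intervals toℕ ]

covers? : ∀ {n k} (I : Intervals n k) (ℓ : Fin n → ℕ) j x → Dec (Covers I ℓ j x)
covers? {n} I ℓ j x = map′ found lost
  (((first I j ≤? ℓ x) ×-dec (ℓ x ≤? last I j)) ⊎-dec ((first I j ≤? ℓ x + n) ×-dec (ℓ x + n ≤? last I j)))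
  where
  found : _ → Covers I ℓ j x
  found (inj₁ (lo , hi)) = _ , lo , hi , inj₁ refl
  found (inj₂ (lo , hi)) = _ , lo , hi , inj₂ refl
  lost : Covers I ℓ j x → _
  lost (_ , lo , hi , inj₁ refl) = inj₁ (lo , hi)
  lost (_ , lo , hi , inj₂ refl) = inj₂ (lo , hi)

-- Line c is the complement of the c-th interval.
line : Fin 3 → Fin 3 → Fin 6
line c = lookup (lookup ((3F ∷ 4F ∷ 5F ∷ []) ∷ (5F ∷ 0F ∷ 1F ∷ []) ∷ (1F ∷ 2F ∷ 3F ∷ []) ∷ []) c)

line-injective : ∀ c → Injective _≡_ _≡_ (line c)
line-injective c {i} {j} = from-yes (Fin.all? λ c → Fin.all? λ i → Fin.all? λ j → (line c i Fin.≟ line c j) →-dec (i Fin.≟ j)) c i j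

line-uncovered : ∀ c i → ¬ Covers whirl-intervals toℕ c (line c i)
line-uncovered = from-yes (Fin.all? λ c → Fin.all? λ i → ¬? (covers? whirl-intervals toℕ c (line c i)))

private-middle : ∀ c c′ → c ≢ c′ → ∀ i → line c′ i ≢ line c 1F
private-middle = from-yes (Fin.all? λ c → Fin.all? λ c′ → ¬? (c Fin.≟ c′) →-dec Fin.all? λ i → ¬? (line c′ i Fin.≟ line c 1F))

-- Three elements avoiding interval `c` would have to be matched to the two remaining intervals.
line-dependent : ∀ c → ¬ Whirl (image (line c))
line-dependent c (f , inj , mem) = contradiction (Fin.injective⇒≤ {f = g} g-inj) 1+n≰n
  where
  on : ∀ i → line c i ∈ image (line c)
  on = ∈-image (line c)
  c≢ : ∀ i → c ≢ f (line c i) (on i)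
  c≢ i eq = line-uncovered c i (subst (λ j → Covers whirl-intervals toℕ j (line c i)) (sym eq) (mem (line c i) (on i)))
  g : Fin 3 → Fin 2
  g i = punchOut (c≢ i)
  g-inj : Injective _≡_ _≡_ g
  g-inj {i} {j} eq = line-injective c (inj _ _ (on i) (on j) (Fin.punchOut-injective (c≢ i) (c≢ j) eq))

matched⇒Whirl : ∀ {k} (T : Fin k → Fin 6) (g : Fin k → Fin 3) → Injective _≡_ _≡_ g →
                (∀ i → Covers whirl-intervals toℕ (g i) (T i)) → Whirl (image T)
matched⇒Whirl T g g-inj mem = (λ x x∈ → g (proj₁ (source x x∈)))
  , (λ x y x∈ y∈ eq → trans (sym (proj₂ (source x x∈))) (trans (cong T (g-inj eq)) (proj₂ (source y y∈))))
  , λ x x∈ → subst (Covers whirl-intervals toℕ (g (proj₁ (source x x∈)))) (proj₂ (source x x∈)) (mem (proj₁ (source x x∈)))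
  where
  source : ∀ x → x ∈ image T → ∃ λ i → T i ≡ x
  source x = ∈⟪⟫⁻ (image? T)

-- A matching of three elements is searched for through its three values, so that the search is over
-- finite types.
triple : (a b c : Fin 3) → Fin 3 → Fin 3
triple a b c = lookup (a ∷ b ∷ c ∷ [])

swapped-line-matched : ∀ c z w → (∀ i → line c i ≢ w) → ∃ λ a → ∃ λ b → ∃ λ d →
  (∀ i j → triple a b d i ≡ triple a b d j → i ≡ j) × (∀ i → Covers whirl-intervals toℕ (triple a b d i) ((line c [ z ↦ w ]) i))
swapped-line-matched = from-yes (Fin.all? λ c → Fin.all? λ z → Fin.all? λ w → Fin.all? (λ i → ¬? (line c i Fin.≟ w)) →-dec
  Fin.any? λ a → Fin.any? λ b → Fin.any? λ d →
    Fin.all? (λ i → Fin.all? λ j → (triple a b d i Fin.≟ triple a b d j) →-dec (i Fin.≟ j)) ×-dec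
    Fin.all? (λ i → covers? whirl-intervals toℕ (triple a b d i) ((line c [ z ↦ w ]) i)))

line-swap : ∀ c z w → (∀ i → line c i ≢ w) → Whirl (image (line c [ z ↦ w ]))
line-swap c z w new = let a , b , d , inj , mem = swapped-line-matched c z w new in
  matched⇒Whirl _ (triple a b d) (inj _ _) mem

whirl-multi-path : IsMultiPath Whirl
whirl-multi-path = to-multi-path (Transversals.interval-model whirl-intervals toℕ Fin.toℕ<n Fin.toℕ-injective)

module _ (M : Model Whirl) where
  -- The model is an arbitrary one, so its rank is not given. The steps of its lower path form an
  -- independent set with one element per level, and these are matched injectively to three
  -- intervals.
  whirl-rank≤3 : rank (band M) ≤ 3
  whirl-rank≤3 = Fin.injective⇒≤ {f = λ j → f (element j) (element∈ j)} λ {i} {j} eq → same-level i j (inj _ _ (element∈ i) (element∈ j) eq)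
    where
    h = low (band M)
    H = low-path (band M)
    f-all = proj₁ (steps-basis M (low∈ (band M)))
    f = proj₁ f-all
    inj = proj₁ (proj₂ f-all)
    at-level : ∀ (j : Fin (rank (band M))) → ∃ λ t → t < 6 × h t ≡ h 0 + toℕ j × h (suc t) ≡ suc (h 0 + toℕ j)
    at-level j = level H (m≤m+n (h 0) (toℕ j)) (<-≤-trans (+-monoʳ-< (h 0) (Fin.toℕ<n j)) (≤-reflexive (sym (turn H))))
    element : Fin (rank (band M)) → Fin 6
    element j = proj₁ (labelled M (proj₁ (proj₂ (at-level j))))
    label-element : ∀ j → label M (element j) ≡ proj₁ (at-level j)
    label-element j = proj₂ (labelled M (proj₁ (proj₂ (at-level j))))
    height-element : ∀ j → h (label M (element j)) ≡ h 0 + toℕ j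
    height-element j = trans (cong h (label-element j)) (proj₁ (proj₂ (proj₂ (at-level j))))
    element∈ : ∀ j → element j ∈ steps M h
    element∈ j = steps⁺ M h (subst (Step h) (sym (label-element j))
      (≤-reflexive (trans (cong suc (proj₁ (proj₂ (proj₂ (at-level j))))) (sym (proj₂ (proj₂ (proj₂ (at-level j))))))))
    same-level : ∀ i j → element i ≡ element j → i ≡ j
    same-level i j eq = Fin.toℕ-injective (+-cancelˡ-≡ (h 0) _ _
      (trans (sym (height-element i)) (trans (cong (λ x → h (label M x)) eq) (height-element j))))

  whirl-rank : rank (band M) ≡ 3
  whirl-rank = ≤-antisym whirl-rank≤3 (LabelCount.independent⇒≤rank M (update-injective {z = 0F} (line-injective 0F) new) (line-swap 0F 0F 0F new))
    where
    new : ∀ i → line 0F i ≢ 0F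
    new = from-yes (Fin.all? λ i → ¬? (line 0F i Fin.≟ 0F))

whirl-not-lattice-path : ¬ IsLatticePathMatroid Whirl
whirl-not-lattice-path lpm = pigeonhole (extreme 0F) (extreme 1F) (extreme 2F)
  where
  M = proj₁ (from-lattice-path lpm)
  ℓ = label M
  Initial Final : Fin 3 → Set
  Initial c = ∀ z w → (∀ i → line c i ≢ w) → ℓ (line c z) < ℓ w
  Final c = ∀ z w → (∀ i → line c i ≢ w) → ℓ w < ℓ (line c z)
  extreme : ∀ c → Initial c ⊎ Final c
  -- `Rigid` takes injections from `Fin` of the rank; its statement is transported to `Fin 3` before
  -- the lines are put in.
  extreme c = subst
    (λ k → (T : Fin k → Fin 6) → Injective _≡_ _≡_ T → ¬ Whirl (image T) →
           (∀ z w → (∀ i → T i ≢ w) → Whirl (image (T [ z ↦ w ]))) →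
           (∀ z w → (∀ i → T i ≢ w) → ℓ (T z) < ℓ w) ⊎ (∀ z w → (∀ i → T i ≢ w) → ℓ w < ℓ (T z)))
    (whirl-rank M) (λ T → Rigid.initial-or-final M (proj₂ (from-lattice-path lpm)) {T})
    (line c) (line-injective c) (line-dependent c) (line-swap c)
  -- Each of the two lines has a middle element that the other misses, so each middle element would
  -- precede the other.
  initial-clash : ∀ c c′ → c ≢ c′ → Initial c → ¬ Initial c′
  initial-clash c c′ c≢c′ I I′ = <-asym (I 1F _ (private-middle c′ c (c≢c′ ∘ sym))) (I′ 1F _ (private-middle c c′ c≢c′))
  final-clash : ∀ c c′ → c ≢ c′ → Final c → ¬ Final c′
  final-clash c c′ c≢c′ F F′ = <-asym (F 1F _ (private-middle c′ c (c≢c′ ∘ sym))) (F′ 1F _ (private-middle c c′ c≢c′))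
  pigeonhole : Initial 0F ⊎ Final 0F → Initial 1F ⊎ Final 1F → ¬ (Initial 2F ⊎ Final 2F)
  pigeonhole (inj₁ x) (inj₁ y) _        = initial-clash 0F 1F (λ ()) x y
  pigeonhole (inj₂ x) (inj₂ y) _        = final-clash 0F 1F (λ ()) x y
  pigeonhole (inj₁ x) (inj₂ y) (inj₁ z) = initial-clash 0F 2F (λ ()) x z
  pigeonhole (inj₁ x) (inj₂ y) (inj₂ z) = final-clash 1F 2F (λ ()) y z
  pigeonhole (inj₂ x) (inj₁ y) (inj₁ z) = initial-clash 1F 2F (λ ()) y z
  pigeonhole (inj₂ x) (inj₁ y) (inj₂ z) = final-clash 0F 2F (λ ()) x z

theorem3p8 : ((n : ℕ) (Ind : IndepPred n) → IsMultiPath Ind → IsMultiPath (dual Ind))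
    × ((n m : ℕ) (Ind : IndepPred n) (e : Fin m → Fin n) (C : Subset n) →
    Injective _≡_ _≡_ e → (∀ y → e y ∉ C) →
    IsMultiPath Ind → IsMultiPath (minor Ind e C))
    × ((n : ℕ) (Ind : IndepPred n) → IsLatticePathMatroid Ind → IsMultiPath Ind)
    × Σ ℕ (λ n → Σ (IndepPred n) (λ Ind →
    IsMultiPath Ind × ¬ IsLatticePathMatroid Ind))
theorem3p8 =
    (λ n Ind mp → to-multi-path (dual-model (from-multi-path mp)))
  -- The presentation accompanies the model: the exchange of bases of `C` uses matchings, while the
  -- minor itself is taken in the band.
  , (λ n m Ind e C inj disj mp@(_ , _ , _ , A , _ , _ , present) →
      to-multi-path (minor-model (from-multi-path mp) {A = A} present e C inj disj))
  , (λ n Ind lpm → to-multi-path (proj₁ (from-lattice-path lpm)))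
  , 6 , Whirl , whirl-multi-path , whirl-not-lattice-path
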